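{- Let $r$ be a positive integer and let $G_r=(V,E)$ be the Chimera graph on $n=8r^2$ vertices. Given arbitrary real numbers $c_{uv}$ for $(u,v)\in E$ and $d_u$ for $u\in V$, and given $\varepsilon>0$, there is an algorithm running in time $O\!\left(n\cdot 2^{32/\varepsilon}\right)$ that computes an assignment $S'\in\{ -1,1\}^V$ with $H(S')\le (1-\varepsilon)H^*$, where $H(S)=\sum_{(u,v)\in E}c_{uv}S_uS_v+\sum_{u\in V}d_uS_u$ and $H^*=\min_{S\in\{ -1,1\}^V}H(S)$. That is, the minimum of $H$ can be approximated to within a factor $(1-\varepsilon)$ in this time.
   Context: The Chimera graph $G_r=(V,E)$: $V=\{(i,j,k,l)\in\mathbb{Z}^4: 1\le i,j\le r,\ 1\le k\le 4,\ l\in\{0,1\}\}$ (so $|V|=8r^2$). $E=E_0\cup E_1\cup E_{01}$ (disjoint), where $E_0$ consists of the edges $\{(i,j,k,0),(i+1,j,k,0)\}$ for $1\le i\le r-1$, $1\le j\le r$, $1\le k\le 4$; $E_1$ consists of the edges $\{(i,j,k,1),(i,j+1,k,1)\}$ for $1\le i\le r$, $1\le j\le r-1$, $1\le k\le 4$; and $E_{01}$ consists of the edges $\{(i,j,k_0,0),(i,j,k_1,1)\}$ for $1\le i,j\le r$, $1\le k_0,k_1\le 4$. Note $H^*\le 0$ since the average of $H$ over uniformly random $S$ is $0$. -}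

module Defs where

open import Algebra.Bundles using (CommutativeRing)
open import Algebra.Structures using (IsCommutativeRing)
import Algebra.Properties.CommutativeMonoid.Sum as Sum
import Algebra.Definitions.RawMonoid as RawMonoidDefs
open import Data.Bool.Base using (Bool; true; false; not; _∧_)
open import Data.Fin.Base using (Fin; zero; suc; toℕ; inject₁; combine)
open import Data.Nat.Base as ℕ using (ℕ; zero; suc; NonZero)
import Data.Nat.Properties as ℕₚ
open import Data.Product.Base using (Σ; ∃; _×_; _,_; proj₁; proj₂)
open import Data.Sign.Base using (Sign)
open import Level using (Level; _⊔_) renaming (suc to lsuc)
open import Relation.Binary.Core using (Rel)
open import Relation.Binary.PropositionalEquality.Core using (_≡_)
open import Relation.Binary.Structures using (IsDecTotalOrder)
open import Relation.Nullary.Decidable.Core using (⌊_⌋)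
open import Relation.Nullary.Negation.Core using (¬_)

------------------------------------------------------------------------
-- The real numbers, as a Dedekind-complete ordered field. The order is
-- decidable: this is the classical ℝ, and exact comparison is a
-- primitive of the machine model below.

record Reals (a ℓ : Level) : Set (lsuc (a ⊔ ℓ)) where
  infix  4 _≈_ _≤_ _<_
  infixl 6 _+_ _-_
  infixl 7 _*_
  infix  8 -_
  field
    Carrier           : Set a
    _≈_ _≤_           : Rel Carrier ℓ
    _+_ _*_           : Carrier → Carrier → Carrier
    -_                : Carrier → Carrier
    0# 1#             : Carrier
    isCommutativeRing : IsCommutativeRing _≈_ _+_ _*_ -_ 0# 1#
    isDecTotalOrder   : IsDecTotalOrder _≈_ _≤_
    0≉1               : ¬ (0# ≈ 1#)
    inverse           : ∀ x → ¬ (x ≈ 0#) → ∃ λ y → x * y ≈ 1#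
    +-monoˡ-≤         : ∀ x {y z} → y ≤ z → y + x ≤ z + x
    *-nonNeg          : ∀ {x y} → 0# ≤ x → 0# ≤ y → 0# ≤ x * y

  IsUpperBound : (Carrier → Set (a ⊔ ℓ)) → Carrier → Set (a ⊔ ℓ)
  IsUpperBound P b = ∀ x → P x → x ≤ b

  field
    complete : (P : Carrier → Set (a ⊔ ℓ)) → ∃ P → ∃ (IsUpperBound P) →
               ∃ λ s → IsUpperBound P s × (∀ b → IsUpperBound P b → s ≤ b)

  open IsDecTotalOrder isDecTotalOrder public using (_≤?_)

  _<_ : Rel Carrier ℓ
  x < y = ¬ (y ≤ x)

  _-_ : Carrier → Carrier → Carrier
  x - y = x + (- y)

  commutativeRing : CommutativeRing a ℓ
  commutativeRing = record { isCommutativeRing = isCommutativeRing }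

  open CommutativeRing commutativeRing public
    using (+-commutativeMonoid; +-rawMonoid)

  open Sum +-commutativeMonoid public using (sum; sum-syntax)
  open RawMonoidDefs +-rawMonoid public using () renaming (_×_ to _·_)

------------------------------------------------------------------------
-- The Chimera graph. Coordinates are zero-based: (i , j , k , l) stands
-- for the vertex (i+1, j+1, k+1, l).

Vertex : ℕ → Set
Vertex r = Fin r × Fin r × Fin 4 × Fin 2

data Edge : ℕ → Set where
  e₀  : ∀ {m} (i : Fin m) (j : Fin (suc m)) (k : Fin 4) → Edge (suc m)
  e₁  : ∀ {m} (i : Fin (suc m)) (j : Fin m) (k : Fin 4) → Edge (suc m)
  e₀₁ : ∀ {r} (i j : Fin r) (k₀ k₁ : Fin 4)             → Edge r

endpoints : ∀ {r} → Edge r → Vertex r × Vertex r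
endpoints (e₀ i j k)      = (inject₁ i , j , k , zero) , (suc i , j , k , zero)
endpoints (e₁ i j k)      = (i , inject₁ j , k , suc zero) , (i , suc j , k , suc zero)
endpoints (e₀₁ i j k₀ k₁) = (i , j , k₀ , zero) , (i , j , k₁ , suc zero)

order : ℕ → ℕ
order r = 8 ℕ.* r ℕ.^ 2

------------------------------------------------------------------------
-- The Ising Hamiltonian.

module Hamiltonian {a ℓ} (ℝ : Reals a ℓ) where
  open Reals ℝ

  sumV : ∀ r → (Vertex r → Carrier) → Carrier
  sumV r f = ∑[ i < r ] ∑[ j < r ] ∑[ k < 4 ] ∑[ l < 2 ] f (i , j , k , l)

  sumE : ∀ r → (Edge r → Carrier) → Carrier
  sumE zero      f = 0#
  sumE r@(suc m) f =
      (∑[ i < m ] ∑[ j < r ] ∑[ k < 4 ] f (e₀ i j k))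
    + (∑[ i < r ] ∑[ j < m ] ∑[ k < 4 ] f (e₁ i j k))
    + (∑[ i < r ] ∑[ j < r ] ∑[ k₀ < 4 ] ∑[ k₁ < 4 ] f (e₀₁ i j k₀ k₁))

  spin : Sign → Carrier
  spin Sign.+ = 1#
  spin Sign.- = - 1#

  H : ∀ {r} → (Edge r → Carrier) → (Vertex r → Carrier) → (Vertex r → Sign) → Carrier
  H {r} c d S =
      sumE r (λ e → let (u , v) = endpoints e in c e * spin (S u) * spin (S v))
    + sumV r (λ u → d u * spin (S u))

  IsMinimumOfH : ∀ {r} → (Edge r → Carrier) → (Vertex r → Carrier) → Carrier → Set ℓ
  IsMinimumOfH c d h = (∃ λ S → h ≈ H c d S) × (∀ S → h ≤ H c d S)

------------------------------------------------------------------------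
-- Real RAM programs. Memory consists of arrays of naturals and arrays of
-- reals; each array is infinite, is named by a literal in the program
-- text, and is accessed by computed index. The only integer operations
-- are addition and truncated subtraction, so that unit cost is
-- reasonable. There is no rounding or other conversion from reals to
-- naturals, and no division of reals (a result without it is stronger).

data NExp : Set where
  lit       : ℕ → NExp
  N_[_]     : ℕ → NExp → NExp
  _⊕_ _⊖_   : NExp → NExp → NExp

data RExp : Set where
  𝟎 𝟏           : RExp
  R_[_]         : ℕ → NExp → RExp
  _⊞_ _⊟_ _⊠_   : RExp → RExp → RExp

data Test : Set where
  _≤ᴺ_ : NExp → NExp → Test
  _≤ᴿ_ : RExp → RExp → Test
  notᵀ : Test → Test
  _∧ᵀ_ : Test → Test → Test

data Program : Set where
  skip           : Program
  N_[_]≔_        : ℕ → NExp → NExp → Program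
  R_[_]≔_        : ℕ → NExp → RExp → Program
  _⨾_            : Program → Program → Program
  if_then_else_  : Test → Program → Program → Program
  while_loop_    : Test → Program → Program

infixl 6 _⊕_ _⊖_ _⊞_ _⊟_
infixl 7 _⊠_
infix  5 _≤ᴺ_ _≤ᴿ_
infixr 4 _∧ᵀ_
infix  3 N_[_]≔_ R_[_]≔_
infixr 2 _⨾_
infix  3 if_then_else_ while_loop_

-- Every literal, memory access, arithmetic operation, comparison and
-- Boolean connective takes one unit of time.

costᴺ : NExp → ℕ
costᴺ (lit n)   = 1
costᴺ (N x [ e ]) = 1 ℕ.+ costᴺ e
costᴺ (e ⊕ f)   = 1 ℕ.+ costᴺ e ℕ.+ costᴺ f
costᴺ (e ⊖ f)   = 1 ℕ.+ costᴺ e ℕ.+ costᴺ f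

costᴿ : RExp → ℕ
costᴿ 𝟎         = 1
costᴿ 𝟏         = 1
costᴿ (R x [ e ]) = 1 ℕ.+ costᴺ e
costᴿ (e ⊞ f)   = 1 ℕ.+ costᴿ e ℕ.+ costᴿ f
costᴿ (e ⊟ f)   = 1 ℕ.+ costᴿ e ℕ.+ costᴿ f
costᴿ (e ⊠ f)   = 1 ℕ.+ costᴿ e ℕ.+ costᴿ f

costᵀ : Test → ℕ
costᵀ (e ≤ᴺ f)  = 1 ℕ.+ costᴺ e ℕ.+ costᴺ f
costᵀ (e ≤ᴿ f)  = 1 ℕ.+ costᴿ e ℕ.+ costᴿ f
costᵀ (notᵀ b)  = 1 ℕ.+ costᵀ b
costᵀ (b ∧ᵀ b′) = 1 ℕ.+ costᵀ b ℕ.+ costᵀ b′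

Memory : ∀ {a} → Set a → Set a
Memory A = ℕ → ℕ → A

write : ∀ {a} {A : Set a} → Memory A → ℕ → ℕ → A → Memory A
write M x i v y j with ⌊ x ℕₚ.≟ y ⌋ ∧ ⌊ i ℕₚ.≟ j ⌋
... | true  = v
... | false = M y j

module Semantics {a ℓ} (ℝ : Reals a ℓ) where
  open Reals ℝ

  record State : Set a where
    constructor ⟪_,_⟫
    field
      nats  : Memory ℕ
      reals : Memory Carrier
  open State public

  ⟦_⟧ᴺ : NExp → State → ℕ
  ⟦ lit n ⟧ᴺ   σ = n
  ⟦ N x [ e ] ⟧ᴺ σ = nats σ x (⟦ e ⟧ᴺ σ)
  ⟦ e ⊕ f ⟧ᴺ   σ = ⟦ e ⟧ᴺ σ ℕ.+ ⟦ f ⟧ᴺ σ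
  ⟦ e ⊖ f ⟧ᴺ   σ = ⟦ e ⟧ᴺ σ ℕ.∸ ⟦ f ⟧ᴺ σ

  ⟦_⟧ᴿ : RExp → State → Carrier
  ⟦ 𝟎 ⟧ᴿ       σ = 0#
  ⟦ 𝟏 ⟧ᴿ       σ = 1#
  ⟦ R x [ e ] ⟧ᴿ σ = reals σ x (⟦ e ⟧ᴺ σ)
  ⟦ e ⊞ f ⟧ᴿ   σ = ⟦ e ⟧ᴿ σ + ⟦ f ⟧ᴿ σ
  ⟦ e ⊟ f ⟧ᴿ   σ = ⟦ e ⟧ᴿ σ - ⟦ f ⟧ᴿ σ
  ⟦ e ⊠ f ⟧ᴿ   σ = ⟦ e ⟧ᴿ σ * ⟦ f ⟧ᴿ σ

  ⟦_⟧ᵀ : Test → State → Bool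
  ⟦ e ≤ᴺ f ⟧ᵀ  σ = ⌊ ⟦ e ⟧ᴺ σ ℕₚ.≤? ⟦ f ⟧ᴺ σ ⌋
  ⟦ e ≤ᴿ f ⟧ᵀ  σ = ⌊ ⟦ e ⟧ᴿ σ ≤? ⟦ f ⟧ᴿ σ ⌋
  ⟦ notᵀ b ⟧ᵀ  σ = not (⟦ b ⟧ᵀ σ)
  ⟦ b ∧ᵀ b′ ⟧ᵀ σ = ⟦ b ⟧ᵀ σ ∧ ⟦ b′ ⟧ᵀ σ

  -- P ⊢ σ ⇓ τ ∣ t : started in σ, P halts in τ after exactly t time units.

  infix 1 _⊢_⇓_∣_

  data _⊢_⇓_∣_ : Program → State → State → ℕ → Set a where
    skip⇓ : ∀ {σ} → skip ⊢ σ ⇓ σ ∣ 1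

    N≔⇓ : ∀ {σ x e f} →
      (N x [ e ]≔ f) ⊢ σ
        ⇓ ⟪ write (nats σ) x (⟦ e ⟧ᴺ σ) (⟦ f ⟧ᴺ σ) , reals σ ⟫
        ∣ 1 ℕ.+ costᴺ e ℕ.+ costᴺ f

    R≔⇓ : ∀ {σ x e f} →
      (R x [ e ]≔ f) ⊢ σ
        ⇓ ⟪ nats σ , write (reals σ) x (⟦ e ⟧ᴺ σ) (⟦ f ⟧ᴿ σ) ⟫
        ∣ 1 ℕ.+ costᴺ e ℕ.+ costᴿ f

    ⨾⇓ : ∀ {P Q ρ σ τ s t} →
      P ⊢ ρ ⇓ σ ∣ s → Q ⊢ σ ⇓ τ ∣ t → (P ⨾ Q) ⊢ ρ ⇓ τ ∣ s ℕ.+ t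

    if-true⇓ : ∀ {b P Q σ τ t} → ⟦ b ⟧ᵀ σ ≡ true →
      P ⊢ σ ⇓ τ ∣ t → (if b then P else Q) ⊢ σ ⇓ τ ∣ costᵀ b ℕ.+ t

    if-false⇓ : ∀ {b P Q σ τ t} → ⟦ b ⟧ᵀ σ ≡ false →
      Q ⊢ σ ⇓ τ ∣ t → (if b then P else Q) ⊢ σ ⇓ τ ∣ costᵀ b ℕ.+ t

    while-true⇓ : ∀ {b P ρ σ τ s t} → ⟦ b ⟧ᵀ ρ ≡ true →
      P ⊢ ρ ⇓ σ ∣ s → (while b loop P) ⊢ σ ⇓ τ ∣ t →
      (while b loop P) ⊢ ρ ⇓ τ ∣ costᵀ b ℕ.+ s ℕ.+ t

    while-false⇓ : ∀ {b P σ} → ⟦ b ⟧ᵀ σ ≡ false →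
      (while b loop P) ⊢ σ ⇓ σ ∣ costᵀ b

------------------------------------------------------------------------
-- Input and output conventions. Vertices and edges are stored in
-- lexicographic order of their coordinates; an edge of e₀ or e₁ is filed
-- under the coordinates (i, j, k) of its first endpoint, with stride r
-- for both i and j.

vertexIndex : ∀ {r} → Vertex r → ℕ
vertexIndex (i , j , k , l) = toℕ (combine (combine (combine i j) k) l)

edgeArray : ∀ {r} → Edge r → ℕ
edgeArray (e₀ _ _ _)    = 2
edgeArray (e₁ _ _ _)    = 3
edgeArray (e₀₁ _ _ _ _) = 4

edgeIndex : ∀ {r} → Edge r → ℕ
edgeIndex (e₀ i j k)      = toℕ (combine (combine (inject₁ i) j) k)
edgeIndex (e₁ i j k)      = toℕ (combine (combine i (inject₁ j)) k)
edgeIndex (e₀₁ i j k₀ k₁) = toℕ (combine (combine (combine i j) k₀) k₁)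

module InputOutput {a ℓ} (ℝ : Reals a ℓ) where
  open Reals ℝ
  open Semantics ℝ

  -- All cells not mentioned are uninitialised: their content is arbitrary.
  record Holds (σ : State) (r : ℕ) (c : Edge r → Carrier) (d : Vertex r → Carrier)
               (ε : Carrier) : Set ℓ where
    field
      holds-r : nats σ 0 0 ≡ r
      holds-ε : reals σ 0 0 ≈ ε
      holds-d : ∀ u → reals σ 1 (vertexIndex u) ≈ d u
      holds-c : ∀ e → reals σ (edgeArray e) (edgeIndex e) ≈ c e

  toSign : ℕ → Sign
  toSign zero    = Sign.-
  toSign (suc _) = Sign.+

  output : ∀ {r} → State → Vertex r → Sign
  output τ u = toSign (nats τ 1 (vertexIndex u))

------------------------------------------------------------------------
-- t ≤ B · 2^(b/ε) for real ε > 0, where 2^x is the infimum of the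
-- rational powers 2^(p/q) with p/q > x. The condition b/ε < p/q and the
-- inequality t ≤ B · 2^(p/q) are cleared of denominators and roots.

module RealExponent {a ℓ} (ℝ : Reals a ℓ) where
  open Reals ℝ

  _≤_·2^[_/_] : ℕ → ℕ → ℕ → Carrier → Set ℓ
  t ≤ B ·2^[ b / ε ] = ∀ p q → .{{NonZero q}} → (b ℕ.* q) · 1# < p · ε →
                       t ℕ.^ q ℕ.≤ B ℕ.^ q ℕ.* 2 ℕ.^ p

{-# OPTIONS --safe #-}
module Submission where

-- Write H(S) as the sum over all vertices u of S_u F_u(S), where the field F_u
-- reads d_u and the neighbours preceding u: the one in the row above, the one in
-- the column to the left, or the opposite side of the cell.
--
-- For L about 2/ε and each offset o < L, cut the grid above the rows i ≡ o
-- (mod L) and solve the resulting strips of at most L rows exactly, from top to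
-- bottom, each with the spins of the previous strips held fixed. In column order
-- all edges of a strip of height h join sites at distance at most 8h, so dynamic
-- programming over windows of 8h spins does this in time O(r h · 8h · 2^(8h)).
--
-- The result is no worse than any configuration M with values in {-1, 0, 1} that
-- vanishes on the rows i ≡ o: the strip energy is affine in each spin, so zeros
-- can be rounded to ±1 without increasing it, and the first row of a strip being
-- zero decouples M from the strips above. Let M_o be an optimal S* with those
-- rows set to zero. Summing over o loses every vertex once and every vertical
-- edge twice, so Σ_o H(M_o) = (L - 1) H* - V with V the vertical part of H(S*),
-- and V ≥ H* because V is the average of H over ±S* restricted to the side l = 0.
-- Hence the best of the L results is at most (1 - 2/L) H*.
--
-- If L would exceed r, then L = r already solves the whole grid exactly; this also
-- bounds the search for L without appeal to the Archimedean property. The cost is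
-- O(r² L² 2^(8L)) = O(r² 2^(16 (L - 1))), and L > 2 implies (L - 1) ε < 2.

open import Defs
open import Algebra.Bundles using (CommutativeMonoid; CommutativeRing)
import Algebra.Properties.CommutativeSemigroup as CSProps
import Algebra.Properties.Monoid.Mult as Mult
import Algebra.Properties.Ring as RingProps
open import Data.Bool.Base using (Bool; true; false; not; _∧_; _∨_; T)
open import Data.Empty using (⊥-elim)
open import Data.Fin.Base using (Fin; zero; suc; toℕ; fromℕ<; inject₁; combine; remQuot)
open import Data.Fin.Properties using (toℕ<n; toℕ-combine; toℕ-inject₁; fromℕ<-toℕ; remQuot-combine)
open import Data.Nat.Base as ℕ using (ℕ; zero; suc; z≤n; s≤s; s≤s⁻¹; NonZero; _∸_; _⊓_) renaming (_*_ to _*ℕ_)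
open import Data.Nat.DivMod using (_/_; _%_; m%n<n; m≡m%n+[m/n]*n; [m+n]%n≡m%n; [m+kn]%n≡m%n; m<n⇒m%n≡m; n%n≡0; m*n/n≡m; m<n*o⇒m/o<n; /-monoˡ-≤)
import Data.Nat.Properties as ℕ
open import Data.Nat.Tactic.RingSolver using (solve-∀)
open import Data.Product.Base using (_×_; _,_; proj₁; proj₂; ∃; ∃-syntax)
open import Data.Sign.Base using (Sign)
open import Data.Sum.Base using (_⊎_; inj₁; inj₂)
open import Level using (Level; _⊔_)
open import Relation.Binary.PropositionalEquality using (_≡_; _≢_; refl; sym; trans; cong; cong₂; subst; subst₂; module ≡-Reasoning)
open import Relation.Binary.Structures using (IsDecTotalOrder)
open import Relation.Nullary using (¬_; Dec; yes; no)
open import Relation.Nullary.Decidable using (⌊_⌋)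

-- Program logic: total correctness with time bounds

-- The program never deletes the cut rows. Solving a strip with the earlier spins held fixed keeps
-- the edges across its upper cut in the objective, so the strip energies add up to `H` of the
-- assignment actually produced; zero rows occur only in the competitors of the analysis. This is
-- why configurations take real values: spins, masked configurations and memory arrays are then
-- compared by one energy functional.
--
-- The exponent 32 comes from 8 bits of window per row of a strip, a doubling that absorbs the
-- remaining factor `L * L`, and `L` close to 2/ε. The exponent is kept as 16 (L - 2): the constant
-- factor 2^32 given away covers `L = 2`, where nothing bounds ε from above.
--
-- The machine can only add and subtract naturals and cannot round reals. Hence `L` is found by
-- adding ε up, powers of two are tabulated by doubling, and the digits of a window are split off by
-- comparison and subtraction.

writesN writesR : Program → ℕ → Bool
writesN skip x = false
writesN (N y [ e ]≔ f) x = ⌊ y ℕ.≟ x ⌋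
writesN (R y [ e ]≔ f) x = false
writesN (P ⨾ Q) x = writesN P x ∨ writesN Q x
writesN (if b then P else Q) x = writesN P x ∨ writesN Q x
writesN (while b loop P) x = writesN P x

writesR skip x = false
writesR (N y [ e ]≔ f) x = false
writesR (R y [ e ]≔ f) x = ⌊ y ℕ.≟ x ⌋
writesR (P ⨾ Q) x = writesR P x ∨ writesR Q x
writesR (if b then P else Q) x = writesR P x ∨ writesR Q x
writesR (while b loop P) x = writesR P x

∨-falseˡ : ∀ {x y} → x ∨ y ≡ false → x ≡ false
∨-falseˡ {false} _ = refl

∨-falseʳ : ∀ {x y} → x ∨ y ≡ false → y ≡ false
∨-falseʳ {false} e = e

module _ {a} {A : Set a} where

  write-otherArray : ∀ (M : Memory A) x i v {y} j → ⌊ x ℕ.≟ y ⌋ ≡ false → write M x i v y j ≡ M y j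
  write-otherArray M x i v {y} j e rewrite e = refl

  write-same : ∀ (M : Memory A) x {i} v {j} → i ≡ j → write M x i v x j ≡ v
  write-same M x {i} v refl with x ℕ.≟ x | i ℕ.≟ i
  ... | yes _ | yes _ = refl
  ... | yes _ | no n = ⊥-elim (n refl)
  ... | no n | _ = ⊥-elim (n refl)

  write-other : ∀ (M : Memory A) x {i} v {j} → i ≢ j → write M x i v x j ≡ M x j
  write-other M x {i} v {j} i≢j with x ℕ.≟ x | i ℕ.≟ j
  ... | yes _ | yes p = ⊥-elim (i≢j p)
  ... | yes _ | no _ = refl
  ... | no _ | _ = refl

true-test : ∀ {p} {P : Set p} (d : Dec P) → P → ⌊ d ⌋ ≡ true
true-test (yes _) _ = refl
true-test (no n) p = ⊥-elim (n p)

false-test : ∀ {p} {P : Set p} (d : Dec P) → ¬ P → ⌊ d ⌋ ≡ false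
false-test (no _) _ = refl
false-test (yes p) n = ⊥-elim (n p)

module Logic {a ℓ} (ℝ : Reals a ℓ) where
  open Semantics ℝ

  -- Arrays are named by literals, so the arrays a program may write can be computed from its text.
  -- For concrete programs the side conditions of a frame therefore hold by `refl`.
  record Frame (P : Program) (σ τ : State) : Set a where
    constructor frame
    field
      natsKept  : ∀ x → writesN P x ≡ false → ∀ i → nats τ x i ≡ nats σ x i
      realsKept : ∀ x → writesR P x ≡ false → ∀ i → reals τ x i ≡ reals σ x i
  open Frame public

  Frame-refl : ∀ {P σ} → Frame P σ σ
  Frame-refl = frame (λ _ _ _ → refl) (λ _ _ _ → refl)

  Frame-trans : ∀ {P ρ σ τ} → Frame P ρ σ → Frame P σ τ → Frame P ρ τ
  Frame-trans f g = frame
    (λ x e i → trans (natsKept g x e i) (natsKept f x e i))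
    (λ x e i → trans (realsKept g x e i) (realsKept f x e i))

  ⇓-frame : ∀ {P σ τ t} → P ⊢ σ ⇓ τ ∣ t → Frame P σ τ
  ⇓-frame skip⇓ = Frame-refl
  ⇓-frame (N≔⇓ {σ} {x}) = frame (λ y e i → write-otherArray (nats σ) x _ _ i e) (λ _ _ _ → refl)
  ⇓-frame (R≔⇓ {σ} {x}) = frame (λ _ _ _ → refl) (λ y e i → write-otherArray (reals σ) x _ _ i e)
  ⇓-frame (⨾⇓ p q) with ⇓-frame p | ⇓-frame q
  ... | f | g = frame
    (λ x e i → trans (natsKept g x (∨-falseʳ e) i) (natsKept f x (∨-falseˡ e) i))
    (λ x e i → trans (realsKept g x (∨-falseʳ e) i) (realsKept f x (∨-falseˡ e) i))
  ⇓-frame (if-true⇓ _ p) with ⇓-frame p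
  ... | f = frame (λ x e → natsKept f x (∨-falseˡ e)) (λ x e → realsKept f x (∨-falseˡ e))
  ⇓-frame (if-false⇓ _ p) with ⇓-frame p
  ... | f = frame (λ x e → natsKept f x (∨-falseʳ e)) (λ x e → realsKept f x (∨-falseʳ e))
  ⇓-frame (while-true⇓ _ p q) with ⇓-frame p | ⇓-frame q
  ... | f | g = frame
    (λ x e i → trans (natsKept g x e i) (natsKept f x e i))
    (λ x e i → trans (realsKept g x e i) (realsKept f x e i))
  ⇓-frame (while-false⇓ _) = Frame-refl

  record Runs {q} (P : Program) (σ : State) (B : ℕ) (Q : State → Set q) : Set (a ⊔ q) where
    constructor runs
    field
      {final} : State
      {time}  : ℕ
      run     : P ⊢ σ ⇓ final ∣ time
      bound   : time ℕ.≤ B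
      post    : Q final

  private variable
    p q : Level
    P₀ Q₀ : Program
    σ₀ : State
    B₀ B₁ : ℕ

  runs-⇒ : {Q : State → Set p} {Q′ : State → Set q} → Runs P₀ σ₀ B₀ Q → B₀ ℕ.≤ B₁ →
           (∀ τ → Frame P₀ σ₀ τ → Q τ → Q′ τ) → Runs P₀ σ₀ B₁ Q′
  runs-⇒ (runs r b q) le f = runs r (ℕ.≤-trans b le) (f _ (⇓-frame r) q)

  runs-map : {Q : State → Set p} {Q′ : State → Set q} → Runs P₀ σ₀ B₀ Q →
             (∀ τ → Frame P₀ σ₀ τ → Q τ → Q′ τ) → Runs P₀ σ₀ B₀ Q′
  runs-map r f = runs-⇒ r ℕ.≤-refl f

  runs-≤ : {Q : State → Set p} → Runs P₀ σ₀ B₀ Q → B₀ ℕ.≤ B₁ → Runs P₀ σ₀ B₁ Q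
  runs-≤ r le = runs-⇒ r le (λ _ _ x → x)

  runs-skip : {Q : State → Set p} → Q σ₀ → Runs skip σ₀ 1 Q
  runs-skip q = runs skip⇓ ℕ.≤-refl q

  runs-N≔ : ∀ {x e f} {Q : State → Set p} →
    Q ⟪ write (nats σ₀) x (⟦ e ⟧ᴺ σ₀) (⟦ f ⟧ᴺ σ₀) , reals σ₀ ⟫ →
    Runs (N x [ e ]≔ f) σ₀ (1 ℕ.+ costᴺ e ℕ.+ costᴺ f) Q
  runs-N≔ q = runs N≔⇓ ℕ.≤-refl q

  runs-R≔ : ∀ {x e f} {Q : State → Set p} →
    Q ⟪ nats σ₀ , write (reals σ₀) x (⟦ e ⟧ᴺ σ₀) (⟦ f ⟧ᴿ σ₀) ⟫ →
    Runs (R x [ e ]≔ f) σ₀ (1 ℕ.+ costᴺ e ℕ.+ costᴿ f) Q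
  runs-R≔ q = runs R≔⇓ ℕ.≤-refl q

  infixr 2 _⨟_
  -- The continuation is handed the frame of the first program besides its postcondition, so a
  -- postcondition has to mention only what has changed.
  _⨟_ : {Q : State → Set p} {Q′ : State → Set q} → Runs P₀ σ₀ B₀ Q →
        (∀ τ → Frame P₀ σ₀ τ → Q τ → Runs Q₀ τ B₁ Q′) → Runs (P₀ ⨾ Q₀) σ₀ (B₀ ℕ.+ B₁) Q′
  runs r b q ⨟ f with f _ (⇓-frame r) q
  ... | runs r′ b′ q′ = runs (⨾⇓ r r′) (ℕ.+-mono-≤ b b′) q′

  N≔⨾ : ∀ {x e f} {Q : State → Set q} →
    Runs Q₀ ⟪ write (nats σ₀) x (⟦ e ⟧ᴺ σ₀) (⟦ f ⟧ᴺ σ₀) , reals σ₀ ⟫ B₁ Q →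
    Runs ((N x [ e ]≔ f) ⨾ Q₀) σ₀ ((1 ℕ.+ costᴺ e ℕ.+ costᴺ f) ℕ.+ B₁) Q
  N≔⨾ (runs r b q) = runs (⨾⇓ N≔⇓ r) (ℕ.+-monoʳ-≤ _ b) q

  R≔⨾ : ∀ {x e f} {Q : State → Set q} →
    Runs Q₀ ⟪ nats σ₀ , write (reals σ₀) x (⟦ e ⟧ᴺ σ₀) (⟦ f ⟧ᴿ σ₀) ⟫ B₁ Q →
    Runs ((R x [ e ]≔ f) ⨾ Q₀) σ₀ ((1 ℕ.+ costᴺ e ℕ.+ costᴿ f) ℕ.+ B₁) Q
  R≔⨾ (runs r b q) = runs (⨾⇓ R≔⇓ r) (ℕ.+-monoʳ-≤ _ b) q

  runs-if : ∀ {b} {Q : State → Set q} →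
    (⟦ b ⟧ᵀ σ₀ ≡ true → Runs P₀ σ₀ B₀ Q) →
    (⟦ b ⟧ᵀ σ₀ ≡ false → Runs Q₀ σ₀ B₀ Q) →
    Runs (if b then P₀ else Q₀) σ₀ (costᵀ b ℕ.+ B₀) Q
  runs-if {σ₀ = σ} {b = b} f g with ⟦ b ⟧ᵀ σ in eq
  ... | true with f refl
  ...   | runs r le q = runs (if-true⇓ eq r) (ℕ.+-monoʳ-≤ (costᵀ b) le) q
  runs-if {σ₀ = σ} {b = b} f g | false with g refl
  ...   | runs r le q = runs (if-false⇓ eq r) (ℕ.+-monoʳ-≤ (costᵀ b) le) q

  costᵀ>0 : ∀ b → 0 ℕ.< costᵀ b
  costᵀ>0 (_ ≤ᴺ _) = ℕ.z<s
  costᵀ>0 (_ ≤ᴿ _) = ℕ.z<s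
  costᵀ>0 (notᵀ _) = ℕ.z<s
  costᵀ>0 (_ ∧ᵀ _) = ℕ.z<s

  -- The potential Φ pays for all remaining iterations.
  runs-while : ∀ {b P} (Inv : State → Set p) (Φ : State → ℕ) (σ : State) →
    (∀ σ → Inv σ → ⟦ b ⟧ᵀ σ ≡ true → ∃ λ B → Runs P σ B (λ τ → Inv τ × costᵀ b ℕ.+ B ℕ.+ Φ τ ℕ.≤ Φ σ)) →
    Inv σ → Runs (while b loop P) σ (Φ σ ℕ.+ costᵀ b) (λ τ → Inv τ × ⟦ b ⟧ᵀ τ ≡ false)
  runs-while {b = b} {P} Inv Φ σ step inv = go (Φ σ) σ ℕ.≤-refl inv
    where
    -- The fuel `n` bounds the potential. A test costs at least one unit, so every iteration lowers
    -- the potential and the fuel can drop with it.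
    go : ∀ n σ → Φ σ ℕ.≤ n → Inv σ →
      Runs (while b loop P) σ (Φ σ ℕ.+ costᵀ b) (λ τ → Inv τ × ⟦ b ⟧ᵀ τ ≡ false)
    go n σ Φ≤n inv with ⟦ b ⟧ᵀ σ in eq
    ... | false = runs (while-false⇓ eq) (ℕ.m≤n+m _ (Φ σ)) (inv , eq)
    ... | true with step σ inv eq
    ...   | B , runs {τ} {s} r s≤B (inv′ , pay) with n
    ...     | zero = ⊥-elim (ℕ.<⇒≱ (costᵀ>0 b) (ℕ.≤-trans (ℕ.≤-trans (ℕ.m≤m+n _ B) (ℕ.m≤m+n _ (Φ τ))) (ℕ.≤-trans pay Φ≤n)))
    ...     | suc m with go m τ (ℕ.s≤s⁻¹ (ℕ.≤-trans (ℕ.+-monoˡ-≤ (Φ τ) (ℕ.≤-trans (costᵀ>0 b) (ℕ.m≤m+n _ B))) (ℕ.≤-trans pay Φ≤n))) inv′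
    ...       | runs {_} {t} r′ t≤ q = runs (while-true⇓ eq r r′) le q
      where
      open ℕ.≤-Reasoning
      le : costᵀ b ℕ.+ s ℕ.+ t ℕ.≤ Φ σ ℕ.+ costᵀ b
      le = begin
        costᵀ b ℕ.+ s ℕ.+ t                         ≤⟨ ℕ.+-mono-≤ (ℕ.+-monoʳ-≤ (costᵀ b) s≤B) t≤ ⟩
        costᵀ b ℕ.+ B ℕ.+ (Φ τ ℕ.+ costᵀ b)        ≡⟨ ℕ.+-assoc (costᵀ b ℕ.+ B) (Φ τ) (costᵀ b) ⟨
        costᵀ b ℕ.+ B ℕ.+ Φ τ ℕ.+ costᵀ b          ≤⟨ ℕ.+-monoˡ-≤ (costᵀ b) pay ⟩
        Φ σ ℕ.+ costᵀ b                              ∎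

-- for x < n: the loop variable is cell 0 of the array x.
for : ℕ → NExp → Program → Program
for x n P = (N x [ lit 0 ]≔ lit 0) ⨾
  (while (N x [ lit 0 ] ⊕ lit 1 ≤ᴺ n) loop (P ⨾ (N x [ lit 0 ]≔ N x [ lit 0 ] ⊕ lit 1)))

module For {a ℓ} (ℝ : Reals a ℓ) where
  open Semantics ℝ
  open Logic ℝ

  setN : State → ℕ → ℕ → State
  setN σ x v = ⟪ write (nats σ) x 0 v , reals σ ⟫

  -- Each round pays `5 + costᴺ e` for the test and 6 for the increment. The initialisation costs 3,
  -- and the last, failing test `5 + costᴺ e`.
  forBound : NExp → ℕ → ℕ → ℕ
  forBound e n B = n ℕ.* (B ℕ.+ (costᴺ e ℕ.+ 11)) ℕ.+ (costᴺ e ℕ.+ 8)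

  -- The bound `e` is evaluated anew in every round, hence the hypothesis on all framed states. A
  -- step also receives the frame back to the initial state, so invariants need to describe only the
  -- arrays that the loop changes.
  runs-for : ∀ {p} x e P (Inv : ℕ → State → Set p) n B (σ : State) →
    writesN P x ≡ false →
    (∀ τ → Frame (for x e P) σ τ → ⟦ e ⟧ᴺ τ ≡ n) →
    (∀ k σ′ → k ℕ.< n → nats σ′ x 0 ≡ k → Frame (for x e P) σ σ′ → Inv k σ′ →
       Runs P σ′ B (λ τ → Inv (suc k) (setN τ x (suc k)))) →
    Inv 0 (setN σ x 0) →
    Runs (for x e P) σ (forBound e n B) (λ τ → Inv n τ)
  runs-for x e P Inv n B σ nowrite bd step inv₀ =
    runs-≤ (N≔⨾ (go n 0 (setN σ x 0) (ℕ.+-identityʳ n) (write-same (nats σ) x 0 refl) (⇓→F N≔⇓) inv₀)) le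
    where
    body = P ⨾ (N x [ lit 0 ]≔ N x [ lit 0 ] ⊕ lit 1)
    test = N x [ lit 0 ] ⊕ lit 1 ≤ᴺ e
    loop = while test loop body

    ⇓→F : ∀ {τ t} → (N x [ lit 0 ]≔ lit 0) ⊢ σ ⇓ τ ∣ t → Frame (for x e P) σ τ
    ⇓→F r = frame (λ y w → natsKept (⇓-frame r) y (∨-falseˡ w)) (λ y _ → realsKept (⇓-frame r) y refl)

    loop→F : ∀ {ρ τ} → Frame loop ρ τ → Frame (for x e P) ρ τ
    loop→F f = frame (λ y w → natsKept f y (∨-falseʳ {⌊ x ℕ.≟ y ⌋} w)) (realsKept f)

    loopBound : ℕ → ℕ
    loopBound m = m ℕ.* (B ℕ.+ (costᴺ e ℕ.+ 11)) ℕ.+ (costᴺ e ℕ.+ 5)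

    le : 3 ℕ.+ loopBound n ℕ.≤ forBound e n B
    le = ℕ.≤-reflexive (trans (ℕ.+-comm 3 (loopBound n))
           (trans (ℕ.+-assoc (n ℕ.* (B ℕ.+ (costᴺ e ℕ.+ 11))) (costᴺ e ℕ.+ 5) 3)
             (cong (n ℕ.* (B ℕ.+ (costᴺ e ℕ.+ 11)) ℕ.+_) (ℕ.+-assoc (costᴺ e) 5 3))))

    arith : ∀ s t m → s ℕ.≤ B ℕ.+ 6 → t ℕ.≤ loopBound m → costᵀ test ℕ.+ s ℕ.+ t ℕ.≤ loopBound (suc m)
    arith s t m s≤ t≤ = begin
      costᵀ test ℕ.+ s ℕ.+ t                                       ≤⟨ ℕ.+-mono-≤ (ℕ.+-monoʳ-≤ (costᵀ test) s≤) t≤ ⟩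
      5 ℕ.+ costᴺ e ℕ.+ (B ℕ.+ 6) ℕ.+ (m ℕ.* X ℕ.+ Y)             ≡⟨ cong (ℕ._+ (m ℕ.* X ℕ.+ Y)) eq ⟩
      X ℕ.+ (m ℕ.* X ℕ.+ Y)                                        ≡⟨ ℕ.+-assoc X (m ℕ.* X) Y ⟨
      loopBound (suc m)                                              ∎
      where
      open ℕ.≤-Reasoning
      X = B ℕ.+ (costᴺ e ℕ.+ 11)
      Y = costᴺ e ℕ.+ 5
      eq : 5 ℕ.+ costᴺ e ℕ.+ (B ℕ.+ 6) ≡ X
      eq = trans (ℕ.+-comm (5 ℕ.+ costᴺ e) (B ℕ.+ 6)) (trans (ℕ.+-assoc B 6 (5 ℕ.+ costᴺ e))
             (cong (B ℕ.+_) (ℕ.+-comm 11 (costᴺ e))))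

    go : ∀ m k ρ → m ℕ.+ k ≡ n → nats ρ x 0 ≡ k → Frame (for x e P) σ ρ → Inv k ρ →
         Runs loop ρ (loopBound m) (λ τ → Inv n τ)
    go zero k ρ refl xk fr inv = runs
      (while-false⇓ (false-test (nats ρ x 0 ℕ.+ 1 ℕ.≤? ⟦ e ⟧ᴺ ρ) λ le →
        ℕ.1+n≰n (subst₂ ℕ._≤_ (trans (cong (ℕ._+ 1) xk) (ℕ.+-comm k 1)) (bd ρ fr) le)))
      (ℕ.≤-reflexive (ℕ.+-comm 5 (costᴺ e))) inv
    go (suc m) k ρ eq xk fr inv
      with step k ρ (ℕ.≤-trans (ℕ.s≤s (ℕ.m≤n+m k m)) (ℕ.≤-reflexive eq)) xk fr inv
    ... | runs {τ} {t} r t≤ inv′ = 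
      let xτ = trans (natsKept (⇓-frame r) x nowrite 0) xk
          v≡ : nats τ x 0 ℕ.+ 1 ≡ suc k
          v≡ = trans (ℕ.+-comm _ 1) (cong suc xτ)
          step⇓ : body ⊢ ρ ⇓ setN τ x (suc k) ∣ t ℕ.+ 6
          step⇓ = subst (λ v → body ⊢ ρ ⇓ setN τ x v ∣ t ℕ.+ 6) v≡ (⨾⇓ r N≔⇓)
          fr′ = Frame-trans fr (loop→F (frame (natsKept (⇓-frame step⇓)) (realsKept (⇓-frame step⇓))))
          runs r′ t′≤ q = go m (suc k) (setN τ x (suc k)) (trans (ℕ.+-suc m k) eq)
                            (write-same (nats τ) x (suc k) refl) fr′ inv′
      in runs (while-true⇓ (true-test (nats ρ x 0 ℕ.+ 1 ℕ.≤? ⟦ e ⟧ᴺ ρ)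
                (subst₂ ℕ._≤_ (trans (ℕ.+-comm 1 k) (cong (ℕ._+ 1) (sym xk))) (sym (bd ρ fr))
                  (ℕ.≤-trans (ℕ.s≤s (ℕ.m≤n+m k m)) (ℕ.≤-reflexive eq)))) step⇓ r′)
              (arith (t ℕ.+ 6) _ m (ℕ.+-monoˡ-≤ 6 t≤) t′≤) q

-- Ordered fields and finite sums

module OrderedField {a ℓ} (ℝ : Reals a ℓ) where
  open Reals ℝ
  open CommutativeRing commutativeRing public
    using (setoid; ring; +-cong; +-congˡ; +-congʳ; +-assoc; +-comm
          ; +-identityˡ; +-identityʳ; *-cong; *-congˡ; *-congʳ; *-assoc; *-comm; *-identityˡ
          ; *-identityʳ; distribˡ; distribʳ; zeroˡ; zeroʳ; -‿cong; -‿inverseʳ; -‿inverseˡ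
          ; +-commutativeSemigroup)
    renaming (refl to ≈-refl; sym to ≈-sym; trans to ≈-trans; reflexive to ≈-reflexive)
  open RingProps ring public
    using (-1*x≈-x; -‿distribˡ-*; -‿distribʳ-*; -‿involutive; -0#≈0#)
  open CSProps +-commutativeSemigroup public using () renaming (interchange to +-interchange)
  open IsDecTotalOrder isDecTotalOrder public
    using (total; antisym; ≤-respˡ-≈; ≤-respʳ-≈)
    renaming (refl to ≤-refl; trans to ≤-trans; reflexive to ≤-reflexive)

  private variable
    v w x y z : Carrier

  open import Relation.Binary.Reasoning.Setoid setoid

  ≰⇒≥ : ¬ (x ≤ y) → y ≤ x
  ≰⇒≥ {x} {y} x≰y with total x y
  ... | inj₁ p = ⊥-elim (x≰y p)
  ... | inj₂ p = p

  ≤-resp₂ : v ≈ w → x ≈ y → v ≤ x → w ≤ y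
  ≤-resp₂ p q r = ≤-respʳ-≈ q (≤-respˡ-≈ p r)

  +-mono-≤ : v ≤ w → x ≤ y → v + x ≤ w + y
  +-mono-≤ {v} {w} {x} {y} p q =
    ≤-trans (+-monoˡ-≤ x p) (≤-resp₂ (+-comm x w) (+-comm y w) (+-monoˡ-≤ w q))

  x+y-y≈x : ∀ x y → x + y + (- y) ≈ x
  x+y-y≈x x y = begin
    x + y + (- y)   ≈⟨ +-assoc x y (- y) ⟩
    x + (y + (- y)) ≈⟨ +-congˡ (-‿inverseʳ y) ⟩
    x + 0#          ≈⟨ +-identityʳ x ⟩
    x               ∎

  x-y+y≈x : ∀ x y → x + (- y) + y ≈ x
  x-y+y≈x x y = begin
    x + (- y) + y   ≈⟨ +-assoc x (- y) y ⟩
    x + (- y + y)   ≈⟨ +-congˡ (-‿inverseˡ y) ⟩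
    x + 0#          ≈⟨ +-identityʳ x ⟩
    x               ∎

  +-cancelʳ-≤ : ∀ z → x + z ≤ y + z → x ≤ y
  +-cancelʳ-≤ {x} {y} z p = ≤-resp₂ (x+y-y≈x x z) (x+y-y≈x y z) (+-monoˡ-≤ (- z) p)

  neg-mono-≤ : x ≤ y → - y ≤ - x
  neg-mono-≤ {x} {y} p = +-cancelʳ-≤ (x + y) (≤-resp₂ eqˡ eqʳ p)
    where
    eqˡ : x ≈ - y + (x + y)
    eqˡ = ≈-sym (≈-trans (+-comm _ _) (x+y-y≈x x y))
    eqʳ : y ≈ - x + (x + y)
    eqʳ = ≈-sym (≈-trans (+-congˡ (+-comm x y)) (≈-trans (+-comm _ _) (x+y-y≈x y x)))

  +-mono-≰ : ¬ (w ≤ v) → x ≤ y → ¬ (w + y ≤ v + x)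
  +-mono-≰ {w} {v} {x} {y} p q r =
    p (+-cancelʳ-≤ y (≤-trans r (≤-resp₂ (+-comm x v) (+-comm y v) (+-monoˡ-≤ v q))))

  -- Chooses the sign when a zero is rounded; with `x` and `y` equal it halves an inequality.
  average : x + y ≤ z + z → (x ≤ z) ⊎ (y ≤ z)
  average {x} {y} {z} p with x ≤? z | y ≤? z
  ... | yes q | _     = inj₁ q
  ... | _     | yes q = inj₂ q
  ... | no q  | no q′ = ⊥-elim (+-mono-≰ q (≰⇒≥ q′) p)

  -- The product of the nonnegative numbers `y - x` and `- z` is nonnegative. It is applied with `z`
  -- the optimum, which is nonpositive, so that a lower bound on a factor becomes an upper bound on
  -- a product.
  *-antiˡ-nonPos : ∀ {x y z} → z ≤ 0# → x ≤ y → y * z ≤ x * z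
  *-antiˡ-nonPos {x} {y} {z} z≤0 x≤y = +-cancelʳ-≤ (x * - z) (≤-resp₂ eqˡ eqʳ step)
    where
    0≤-z : 0# ≤ - z
    0≤-z = ≤-respˡ-≈ -0#≈0# (neg-mono-≤ z≤0)
    0≤y-x : 0# ≤ y + - x
    0≤y-x = ≤-respˡ-≈ (-‿inverseʳ x) (+-monoˡ-≤ (- x) x≤y)
    nn : 0# ≤ (y + - x) * - z
    nn = *-nonNeg 0≤y-x 0≤-z
    step : 0# + (y * z + x * - z) ≤ (y + - x) * - z + (y * z + x * - z)
    step = +-monoˡ-≤ _ nn
    eqˡ : 0# + (y * z + x * - z) ≈ y * z + x * - z
    eqˡ = +-identityˡ _
    eqʳ : (y + - x) * - z + (y * z + x * - z) ≈ x * z + x * - z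
    eqʳ = begin
      (y + - x) * - z + (y * z + x * - z)            ≈⟨ +-congʳ (distribʳ (- z) y (- x)) ⟩
      (y * - z + - x * - z) + (y * z + x * - z)      ≈⟨ +-interchange _ _ _ _ ⟩
      (y * - z + y * z) + (- x * - z + x * - z)      ≈⟨ +-cong (≈-sym (distribˡ y (- z) z)) (+-congʳ (≈-trans (≈-sym (-‿distribˡ-* x (- z))) (≈-trans (-‿cong (≈-sym (-‿distribʳ-* x z))) (-‿involutive _)))) ⟩
      y * (- z + z) + (x * z + x * - z)              ≈⟨ +-congʳ (≈-trans (*-congˡ (-‿inverseˡ z)) (zeroʳ y)) ⟩
      0# + (x * z + x * - z)                         ≈⟨ +-identityˡ _ ⟩
      x * z + x * - z                                ∎

  opaque
    -- Indexed by naturals rather than by `Fin`, because configurations are functions of an address.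
    -- Being opaque, sums of literal length such as `⅀ 4` stay folded.
    ⅀ : ℕ → (ℕ → Carrier) → Carrier
    ⅀ zero    f = 0#
    ⅀ (suc n) f = ⅀ n f + f n

  private variable
    f g : ℕ → Carrier

  opaque
    unfolding ⅀

    ⅀-0 : ⅀ 0 f ≈ 0#
    ⅀-0 = ≈-refl

    ⅀-suc : ∀ n → ⅀ (suc n) f ≈ ⅀ n f + f n
    ⅀-suc n = ≈-refl

    ⅀-cong : ∀ n → (∀ k → k ℕ.< n → f k ≈ g k) → ⅀ n f ≈ ⅀ n g
    ⅀-cong zero    _ = ≈-refl
    ⅀-cong (suc n) h = +-cong (⅀-cong n (λ k k<n → h k (ℕ.m<n⇒m<1+n k<n))) (h n (ℕ.n<1+n n))

    ⅀-mono : ∀ n → (∀ k → k ℕ.< n → f k ≤ g k) → ⅀ n f ≤ ⅀ n g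
    ⅀-mono zero    _ = ≤-refl
    ⅀-mono (suc n) h = +-mono-≤ (⅀-mono n (λ k k<n → h k (ℕ.m<n⇒m<1+n k<n))) (h n (ℕ.n<1+n n))

    ⅀-zero : ∀ n → ⅀ n (λ _ → 0#) ≈ 0#
    ⅀-zero zero    = ≈-refl
    ⅀-zero (suc n) = ≈-trans (+-identityʳ _) (⅀-zero n)

    ⅀-≈0 : ∀ n → (∀ k → k ℕ.< n → f k ≈ 0#) → ⅀ n f ≈ 0#
    ⅀-≈0 n h = ≈-trans (⅀-cong n h) (⅀-zero n)

    ⅀-+ : ∀ n → ⅀ n f + ⅀ n g ≈ ⅀ n (λ k → f k + g k)
    ⅀-+ zero    = +-identityˡ 0#
    ⅀-+ (suc n) = ≈-trans (+-interchange _ _ _ _) (+-congʳ (⅀-+ n))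

    ⅀-*ˡ : ∀ n x → x * ⅀ n f ≈ ⅀ n (λ k → x * f k)
    ⅀-*ˡ zero    x = zeroʳ x
    ⅀-*ˡ (suc n) x = ≈-trans (distribˡ x _ _) (+-congʳ (⅀-*ˡ n x))

    ⅀-swap : ∀ m n (f : ℕ → ℕ → Carrier) →
      ⅀ m (λ i → ⅀ n (λ j → f i j)) ≈ ⅀ n (λ j → ⅀ m (λ i → f i j))
    ⅀-swap zero    n f = ≈-sym (⅀-zero n)
    ⅀-swap (suc m) n f = ≈-trans (+-congʳ (⅀-swap m n f)) (⅀-+ n)

    ⅀-split : ∀ m n (f : ℕ → Carrier) → ⅀ (n ℕ.+ m) f ≈ ⅀ m f + ⅀ n (λ k → f (k ℕ.+ m))
    ⅀-split m zero    f = ≈-sym (+-identityʳ _)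
    ⅀-split m (suc n) f = ≈-trans (+-congʳ (⅀-split m n f)) (+-assoc _ _ _)

    ⅀-* : ∀ m n (f : ℕ → Carrier) → ⅀ (m ℕ.* n) f ≈ ⅀ m (λ i → ⅀ n (λ j → f (i ℕ.* n ℕ.+ j)))
    ⅀-* zero    n f = ≈-refl
    ⅀-* (suc m) n f = ≈-trans (⅀-split (m ℕ.* n) n f)
      (+-cong (⅀-* m n f) (⅀-cong n (λ j _ → ≈-reflexive (cong f (ℕ.+-comm j (m ℕ.* n))))))

    ⅀-cons : ∀ n (f : ℕ → Carrier) → ⅀ (suc n) f ≈ f 0 + ⅀ n (λ k → f (suc k))
    ⅀-cons n f = ≈-trans (≈-reflexive (cong (λ k → ⅀ k f) (sym (ℕ.+-comm n 1))))
      (≈-trans (⅀-split 1 n f) (+-cong (+-identityˡ _)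
        (⅀-cong n (λ k _ → ≈-reflexive (cong f (ℕ.+-comm k 1))))))

    sum≈⅀ : ∀ n {f : Fin n → Carrier} → (∀ i → f i ≈ g (toℕ i)) → sum f ≈ ⅀ n g
    sum≈⅀ zero    h = ≈-refl
    sum≈⅀ {g} (suc n) h =
      ≈-trans (+-cong (h zero) (sum≈⅀ {λ k → g (suc k)} n (λ i → h (suc i)))) (≈-sym (⅀-cons n g))

    -- Totality of the order replaces division by the number of terms: if `y` were below `x`, one
    -- strict and `n` weak inequalities would add up to a contradiction.
    ⅀-cancel-≤ : ∀ n → ⅀ (suc n) (λ _ → x) ≤ ⅀ (suc n) (λ _ → y) → x ≤ y
    ⅀-cancel-≤ {x} {y} n p with x ≤? y
    ... | yes q = q
    ... | no q = ⊥-elim (+-mono-≰ q (⅀-mono n (λ _ _ → ≰⇒≥ q)) (≤-resp₂ (+-comm _ _) (+-comm _ _) p))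

  δ : ℕ → ℕ → Carrier → Carrier
  δ m n x with m ℕ.≟ n
  ... | yes _ = x
  ... | no _ = 0#

  δ-≡ : ∀ {m n} x → m ≡ n → δ m n x ≈ x
  δ-≡ {m} {n} x p with m ℕ.≟ n
  ... | yes _ = ≈-refl
  ... | no q = ⊥-elim (q p)

  δ-≢ : ∀ {m n} x → m ≢ n → δ m n x ≈ 0#
  δ-≢ {m} {n} x p with m ℕ.≟ n
  ... | yes q = ⊥-elim (p q)
  ... | no _ = ≈-refl

  ⅀-δ : ∀ n m x → m ℕ.< n → ⅀ n (λ k → δ m k x) ≈ x
  ⅀-δ (suc n) m x m<sn with m ℕ.≟ n
  ... | yes refl = ≈-trans (⅀-suc n) (≈-trans
          (+-cong (⅀-≈0 n (λ k k<n → δ-≢ {n} {k} x (λ e → ℕ.<-irrefl (sym e) k<n))) (δ-≡ {n} x refl)) (+-identityˡ x))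
  ... | no m≢n = ≈-trans (⅀-suc n) (≈-trans (+-congˡ (δ-≢ {m} {n} x m≢n))
          (≈-trans (+-identityʳ _) (⅀-δ n m x (ℕ.≤∧≢⇒< (ℕ.s≤s⁻¹ m<sn) m≢n))))

  IsSpin : Carrier → Set ℓ
  IsSpin x = (x ≈ 1#) ⊎ (x ≈ - 1#)

  IsSpin-resp : x ≈ y → IsSpin x → IsSpin y
  IsSpin-resp e (inj₁ p) = inj₁ (≈-trans (≈-sym e) p)
  IsSpin-resp e (inj₂ p) = inj₂ (≈-trans (≈-sym e) p)

-- Binary codes and digits

module Binary where
  open import Data.Nat.Base using (_+_; _*_; _^_; _≤_; _<_)
  open import Data.Nat.DivMod
  open import Data.Nat.Properties
  open import Relation.Binary.Definitions using (tri<; tri≈; tri>)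

  dbl : ℕ → ℕ
  dbl n = n + n

  dbl≡2* : ∀ n → dbl n ≡ 2 * n
  dbl≡2* n = cong (n +_) (sym (+-identityʳ n))

  weight : Bool → ℕ → ℕ
  weight true  w = w
  weight false w = 0

  -- The least significant digit is β 0.
  code : ℕ → (ℕ → Bool) → ℕ
  code zero    β = 0
  code (suc n) β = code n β + weight (β n) (2 ^ n)

  push : Bool → (ℕ → Bool) → ℕ → Bool
  push x β zero    = x
  push x β (suc m) = β m

  weight≤ : ∀ b w → weight b w ≤ w
  weight≤ true  w = ≤-refl
  weight≤ false w = z≤n

  weight-dbl : ∀ b w → dbl (weight b w) ≡ weight b (2 * w)
  weight-dbl true  w = dbl≡2* w
  weight-dbl false w = refl

  code<2^ : ∀ n β → code n β < 2 ^ n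
  code<2^ zero    β = s≤s z≤n
  code<2^ (suc n) β = subst (code (suc n) β <_) (dbl≡2* (2 ^ n))
    (+-mono-<-≤ (code<2^ n β) (weight≤ (β n) (2 ^ n)))

  -- This is the sliding of the window: the old digits move up by one doubling, the new spin enters
  -- as the lowest digit, and the oldest digit `β n` drops out.
  code-push : ∀ n x β → code (suc n) (push x β) ≡ dbl (code n β) + weight x 1
  code-push zero    x β = refl
  code-push (suc n) x β = begin
    code (suc n) (push x β) + weight (β n) (2 * 2 ^ n)          ≡⟨ cong (_+ weight (β n) (2 * 2 ^ n)) (code-push n x β) ⟩
    dbl (code n β) + weight x 1 + weight (β n) (2 * 2 ^ n)      ≡⟨ cong (dbl (code n β) + weight x 1 +_) (weight-dbl (β n) (2 ^ n)) ⟨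
    dbl (code n β) + weight x 1 + dbl (weight (β n) (2 ^ n))    ≡⟨ rearrange (code n β) (weight x 1) (weight (β n) (2 ^ n)) ⟩
    dbl (code n β + weight (β n) (2 ^ n)) + weight x 1          ∎
    where
    open ≡-Reasoning
    rearrange : ∀ c w v → (c + c) + w + (v + v) ≡ ((c + v) + (c + v)) + w
    rearrange = solve-∀

  -- Without shifts or division on the machine, the top digit is detected by comparison with `2 ^ n`
  -- and removed by subtraction. This lemma and the next justify the two branches of that test.
  code-top-true : ∀ n β → 2 ^ n ≤ code (suc n) β → (β n ≡ true) × (code (suc n) β ∸ 2 ^ n ≡ code n β)
  code-top-true n β le with β n
  ... | true  = refl , m+n∸n≡m (code n β) (2 ^ n)
  ... | false = ⊥-elim (<⇒≱ (code<2^ n β) (subst (2 ^ n ≤_) (+-identityʳ _) le))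

  code-top-false : ∀ n β → ¬ (2 ^ n ≤ code (suc n) β) → (β n ≡ false) × (code (suc n) β ≡ code n β)
  code-top-false n β nle with β n
  ... | true  = ⊥-elim (nle (m≤n+m (2 ^ n) (code n β)))
  ... | false = refl , +-identityʳ _

  -- Windows are digit functions on all naturals, whereas a table cell is a number. Injectivity lets
  -- the cell speak for every digit function with its code.
  code-injective : ∀ n β γ → code n β ≡ code n γ → ∀ m → m < n → β m ≡ γ m
  code-injective (suc n) β γ e m m<sn with 2 ^ n ≤? code (suc n) β
  ... | yes le = step (code-top-true n β le) (code-top-true n γ (subst (2 ^ n ≤_) e le))
    where
    step : (β n ≡ true) × (code (suc n) β ∸ 2 ^ n ≡ code n β) →
           (γ n ≡ true) × (code (suc n) γ ∸ 2 ^ n ≡ code n γ) → β m ≡ γ m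
    step (b , eb) (c , ec) with m ≟ n
    ... | yes refl = trans b (sym c)
    ... | no m≢n = code-injective n β γ (trans (sym eb) (trans (cong (_∸ 2 ^ n) e) ec)) m (≤∧≢⇒< (s≤s⁻¹ m<sn) m≢n)
  ... | no nle = step (code-top-false n β nle) (code-top-false n γ (λ le → nle (subst (2 ^ n ≤_) (sym e) le)))
    where
    step : (β n ≡ false) × (code (suc n) β ≡ code n β) →
           (γ n ≡ false) × (code (suc n) γ ≡ code n γ) → β m ≡ γ m
    step (b , eb) (c , ec) with m ≟ n
    ... | yes refl = trans b (sym c)
    ... | no m≢n = code-injective n β γ (trans (sym eb) (trans e ec)) m (≤∧≢⇒< (s≤s⁻¹ m<sn) m≢n)

  override : ℕ → Bool → (ℕ → Bool) → ℕ → Bool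
  override n x β m with m ≟ n
  ... | yes _ = x
  ... | no _  = β m

  override-≡ : ∀ n x β → override n x β n ≡ x
  override-≡ n x β with n ≟ n
  ... | yes _ = refl
  ... | no q  = ⊥-elim (q refl)

  override-≢ : ∀ n x β m → m ≢ n → override n x β m ≡ β m
  override-≢ n x β m m≢n with m ≟ n
  ... | yes p = ⊥-elim (m≢n p)
  ... | no _  = refl

  code-cong : ∀ n β γ → (∀ m → m < n → β m ≡ γ m) → code n β ≡ code n γ
  code-cong zero    β γ h = refl
  code-cong (suc n) β γ h =
    cong₂ _+_ (code-cong n β γ (λ m m<n → h m (m<n⇒m<1+n m<n))) (cong (λ b → weight b (2 ^ n)) (h n (n<1+n n)))

  code-override : ∀ n x β → code (suc n) (override n x β) ≡ code n β + weight x (2 ^ n)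
  code-override n x β = cong₂ _+_
    (code-cong n _ β (λ m m<n → override-≢ n x β m (<⇒≢ m<n)))
    (cong (λ b → weight b (2 ^ n)) (override-≡ n x β))

  code-surjective : ∀ n s → s < 2 ^ n → ∃ λ β → code n β ≡ s
  code-surjective zero    zero    _ = (λ _ → false) , refl
  code-surjective zero    (suc s) (s≤s ())
  code-surjective (suc n) s s< with 2 ^ n ≤? s
  ... | yes le with code-surjective n (s ∸ 2 ^ n) (subst (s ∸ 2 ^ n <_) (m+n∸n≡m (2 ^ n) (2 ^ n))
                      (∸-monoˡ-< (subst (s <_) (sym (dbl≡2* (2 ^ n))) s<) le))
  ...   | β , e = override n true β , trans (code-override n true β) (trans (cong (_+ 2 ^ n) e) (m∸n+n≡m le))
  code-surjective (suc n) s s< | no nle with code-surjective n s (≰⇒> nle)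
  ...   | β , e = override n false β , trans (code-override n false β) (trans (+-identityʳ _) e)

  digits-injective : ∀ n {q q′ d d′} → d < n → d′ < n → q * n + d ≡ q′ * n + d′ → (q ≡ q′) × (d ≡ d′)
  digits-injective n {q} {q′} {d} {d′} d< d′< e with <-cmp q q′
  ... | tri≈ _ refl _ = refl , +-cancelˡ-≡ (q * n) d d′ e
  ... | tri< q<q′ _ _ = ⊥-elim (<-irrefl e (≤-trans (+-monoʳ-< (q * n) d<)
          (≤-trans (≤-trans (≤-reflexive (+-comm (q * n) n)) (*-monoˡ-≤ n q<q′)) (m≤m+n (q′ * n) d′))))
  ... | tri> _ _ q′<q = ⊥-elim (<-irrefl (sym e) (≤-trans (+-monoʳ-< (q′ * n) d′<)
          (≤-trans (≤-trans (≤-reflexive (+-comm (q′ * n) n)) (*-monoˡ-≤ n q′<q)) (m≤m+n (q * n) d))))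

  digits< : ∀ {m n q d} → q < m → d < n → q * n + d < m * n
  digits< {m} {n} {q} {d} q<m d<n = ≤-trans (+-monoʳ-< (q * n) d<n)
    (≤-trans (≤-reflexive (+-comm (q * n) n)) (*-monoˡ-≤ n q<m))

  digits-surjective : ∀ m n x → x < m * n → ∃ λ q → ∃ λ d → (q < m) × (d < n) × (x ≡ q * n + d)
  digits-surjective m zero    x x< = ⊥-elim (n≮0 (subst (x <_) (*-zeroʳ m) x<))
  digits-surjective m n@(suc _) x x< =
    x / n , x % n , m<n*o⇒m/o<n x< , m%n<n x n , trans (m≡m%n+[m/n]*n x n) (+-comm (x % n) _)

open Binary

-- The Hamiltonian as a sum of spins times local fields

module Address (r : ℕ) where
  open import Data.Nat.Base using (_+_; _*_; _<_; _≤_)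

  -- The vertex number of the input layout. Multiplication by constants is spelled as repeated
  -- doubling in order to agree definitionally with the index expressions of the program.
  addr : ℕ → ℕ → ℕ → ℕ → ℕ
  addr i j k l = dbl (dbl (dbl (i * r + j)) + k) + l

  edgeAddr : ℕ → ℕ → ℕ → ℕ
  edgeAddr i j k = dbl (dbl (i * r + j)) + k

  cellAddr : ℕ → ℕ → ℕ → ℕ → ℕ
  cellAddr i j k₀ k₁ = dbl (dbl (dbl (dbl (i * r + j)) + k₀)) + k₁

  -- Rows occupy consecutive blocks of `r * 8` addresses, so lying above a strip is a single
  -- inequality between addresses.
  rowStart : ℕ → ℕ
  rowStart i = i * (r * 8)

  addr-digits : ∀ i j k l → addr i j k l ≡ ((i * r + j) * 4 + k) * 2 + l
  addr-digits i j k l = lemma (i * r + j) k l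
    where
    lemma : ∀ g k l → (((g + g) + (g + g)) + k) + (((g + g) + (g + g)) + k) + l ≡ (g * 4 + k) * 2 + l
    lemma = solve-∀

  addr-rowStart : ∀ i j k l → addr i j k l ≡ i * (r * 8) + (j * 8 + (k * 2 + l))
  addr-rowStart i j k l = trans (addr-digits i j k l) (lemma i r j k l)
    where
    lemma : ∀ i r j k l → ((i * r + j) * 4 + k) * 2 + l ≡ i * (r * 8) + (j * 8 + (k * 2 + l))
    lemma = solve-∀

  offset< : ∀ {j k l} → j < r → k < 4 → l < 2 → j * 8 + (k * 2 + l) < r * 8
  offset< j< k< l< = digits< j< (digits< {4} {2} k< l<)

  rowStart≤addr : ∀ i j k l → rowStart i ≤ addr i j k l
  rowStart≤addr i j k l = subst (rowStart i ≤_) (sym (addr-rowStart i j k l)) (ℕ.m≤m+n _ _)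

  addr<rowStart : ∀ i {j k l} → j < r → k < 4 → l < 2 → addr i j k l < rowStart (suc i)
  addr<rowStart i {j} {k} {l} j< k< l< = subst₂ _<_ (sym (addr-rowStart i j k l)) (ℕ.+-comm (i * (r * 8)) (r * 8))
    (ℕ.+-monoʳ-< (i * (r * 8)) (offset< j< k< l<))

  rowStart-mono : ∀ {i i′} → i ≤ i′ → rowStart i ≤ rowStart i′
  rowStart-mono = ℕ.*-monoˡ-≤ (r * 8)

  addr-injective : ∀ {i i′ j j′ k k′ l l′} → j < r → j′ < r → k < 4 → k′ < 4 → l < 2 → l′ < 2 →
    addr i j k l ≡ addr i′ j′ k′ l′ → (i ≡ i′) × (j ≡ j′) × (k ≡ k′) × (l ≡ l′)
  addr-injective {i} {i′} {j} {j′} {k} {k′} {l} {l′} j< j′< k< k′< l< l′< e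
    with digits-injective 2 l< l′< (trans (sym (addr-digits i j k l)) (trans e (addr-digits i′ j′ k′ l′)))
  ... | e₂ , l≡ with digits-injective 4 k< k′< e₂
  ... | e₃ , k≡ with digits-injective r j< j′< e₃
  ... | i≡ , j≡ = i≡ , j≡ , k≡ , l≡

  addr-parity : ∀ i j k {l} → l < 2 → addr i j k l % 2 ≡ l
  addr-parity i j k {l} l< = trans (cong (_% 2) (trans (addr-digits i j k l) (ℕ.+-comm _ l)))
    (trans ([m+kn]%n≡m%n l ((i * r + j) * 4 + k) 2) (m<n⇒m%n≡m l<))

-- Consecutive rows are never cut by the same offset, so a row and its vertical edges are not
-- subtracted twice in the averaging argument. In base `L`, equal last digits would make 1 and 0 the
-- same digit.
suc-% : ∀ i L .{{_ : NonZero L}} → 2 ℕ.≤ L → suc i % L ≢ i % L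
suc-% i L 2≤L e with digits-injective L {i / L} {suc i / L} {1} {0} 2≤L (ℕ.≤-trans (s≤s z≤n) 2≤L) eq
  where
  eq : i / L ℕ.* L ℕ.+ 1 ≡ suc i / L ℕ.* L ℕ.+ 0
  eq = ℕ.+-cancelˡ-≡ (i % L) _ _ (trans (sym (ℕ.+-assoc (i % L) _ 1))
    (trans (cong (ℕ._+ 1) (sym (m≡m%n+[m/n]*n i L)))
    (trans (ℕ.+-comm i 1) (trans (m≡m%n+[m/n]*n (suc i) L)
      (cong₂ ℕ._+_ e (sym (ℕ.+-identityʳ _)))))))
... | _ , ()

module Energy {a ℓ} (ℝ : Reals a ℓ) (r : ℕ) (dd up lf cc : ℕ → Reals.Carrier ℝ) where
  open Reals ℝ
  open OrderedField ℝ
  open Address r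

  Config : Set a
  Config = ℕ → Carrier

  upTerm leftTerm cellTerm : ℕ → ℕ → ℕ → Config → Carrier
  upTerm zero    j k X = 0#
  upTerm (suc i) j k X = up (edgeAddr i j k) * X (addr i j k 0)
  leftTerm i zero    k X = 0#
  leftTerm i (suc j) k X = lf (edgeAddr i j k) * X (addr i j k 1)
  cellTerm i j k X = ⅀ 4 (λ k₀ → cc (cellAddr i j k₀ k) * X (addr i j k₀ 0))

  -- Only the side `l = 1` reads across the cell, so each edge of a cell is counted once. No field
  -- reads its own vertex.
  field′ : ℕ → ℕ → ℕ → ℕ → Config → Carrier
  field′ i j k zero    X = dd (addr i j k 0) + upTerm i j k X
  field′ i j k (suc _) X = dd (addr i j k 1) + (leftTerm i j k X + cellTerm i j k X)

  -- Within a cell the side `l` is summed outside `k`, which is the order in which the dynamic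
  -- program visits the sites.
  row : ℕ → Config → Carrier
  row i X = ⅀ r λ j → ⅀ 2 λ l → ⅀ 4 λ k → X (addr i j k l) * field′ i j k l X

  strip : ℕ → ℕ → Config → Carrier
  strip i₀ h X = ⅀ h λ i → row (i₀ ℕ.+ i) X

  -- The dependence of a field on the configuration, turned into data. Congruence, affinity of the
  -- energy and locality of the window then reduce to case analyses on it.
  data Reads : ℕ → ℕ → ℕ → ℕ → ℕ → Set where
    reads-up   : ∀ {i j k} → Reads (suc i) j k 0 (addr i j k 0)
    reads-left : ∀ {i j k l} → Reads i (suc j) k (suc l) (addr i j k 1)
    reads-cell : ∀ {i j k k₀ l} → k₀ ℕ.< 4 → Reads i j k (suc l) (addr i j k₀ 0)

  upTerm-cong : ∀ i j k {X Y} → (∀ z → Reads i j k 0 z → X z ≈ Y z) → upTerm i j k X ≈ upTerm i j k Y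
  upTerm-cong zero    j k h = ≈-refl
  upTerm-cong (suc i) j k h = *-congˡ (h _ reads-up)

  leftTerm-cong : ∀ i j k {X Y} → (∀ z → Reads i j k 1 z → X z ≈ Y z) → leftTerm i j k X ≈ leftTerm i j k Y
  leftTerm-cong i zero    k h = ≈-refl
  leftTerm-cong i (suc j) k h = *-congˡ (h _ reads-left)

  field-cong : ∀ i j k {l} → l ℕ.< 2 → ∀ {X Y} → (∀ z → Reads i j k l z → X z ≈ Y z) →
    field′ i j k l X ≈ field′ i j k l Y
  field-cong i j k {0} _ h = +-congˡ (upTerm-cong i j k h)
  field-cong i j k {1} _ h = +-congˡ (+-cong (leftTerm-cong i j k h)
    (⅀-cong 4 (λ k₀ k₀< → *-congˡ (h _ (reads-cell k₀<)))))
  field-cong i j k {suc (suc _)} (s≤s (s≤s ())) h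

  reads-≢ : ∀ {i j k l z} → j ℕ.< r → k ℕ.< 4 → l ℕ.< 2 → Reads i j k l z → z ≢ addr i j k l
  reads-≢ j< k< l< (reads-up {i} {j} {k}) e =
    ℕ.m≢1+m+n i (trans (proj₁ (addr-injective j< j< k< k< l< l< e)) (cong suc (sym (ℕ.+-identityʳ i))))
  reads-≢ j< k< (s≤s (s≤s z≤n)) (reads-left {i} {j} {k} {0}) e =
    ℕ.<-irrefl (proj₁ (proj₂ (addr-injective {i} {i} (ℕ.<-trans (ℕ.n<1+n j) j<) j< k< k< (s≤s (s≤s z≤n)) (s≤s (s≤s z≤n)) e))) (ℕ.n<1+n j)
  reads-≢ j< k< l< (reads-cell {i} {j} {k} {k₀} {l} k₀<) e
    with proj₂ (proj₂ (proj₂ (addr-injective {i} {i} j< j< k₀< k< (s≤s z≤n) l< e)))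
  ... | ()

  reads-row : ∀ {i j k l z} → j ℕ.< r → k ℕ.< 4 → Reads i j k l z →
    (rowStart (i ℕ.∸ 1) ℕ.≤ z) × (z ℕ.< rowStart (suc i))
  reads-row j< k< (reads-up {i} {j} {k}) =
    rowStart≤addr i j k 0 , ℕ.≤-trans (addr<rowStart i j< k< (s≤s z≤n)) (rowStart-mono (ℕ.n≤1+n (suc i)))
  reads-row j< k< (reads-left {i} {j} {k}) =
    ℕ.≤-trans (rowStart-mono (ℕ.m∸n≤m i 1)) (rowStart≤addr i j k 1) ,
    addr<rowStart i (ℕ.<-trans (ℕ.n<1+n j) j<) k< (s≤s (s≤s z≤n))
  reads-row j< k< (reads-cell {i} {j} {k} {k₀} k₀<) =
    ℕ.≤-trans (rowStart-mono (ℕ.m∸n≤m i 1)) (rowStart≤addr i j k₀ 0) ,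
    addr<rowStart i j< k₀< (s≤s z≤n)

  row-cong : ∀ i {X Y} → (∀ z → rowStart (i ℕ.∸ 1) ℕ.≤ z → z ℕ.< rowStart (suc i) → X z ≈ Y z) → row i X ≈ row i Y
  row-cong i h = ⅀-cong r λ j j< → ⅀-cong 2 λ l l< → ⅀-cong 4 λ k k< → *-cong
    (h _ (ℕ.≤-trans (rowStart-mono (ℕ.m∸n≤m i 1)) (rowStart≤addr i j k l)) (addr<rowStart i j< k< l<))
    (field-cong i j k l< λ z rd → let p , q = reads-row j< k< rd in h z p q)

  strip-cong : ∀ i₀ h {X Y} → (∀ z → z ℕ.< rowStart (i₀ ℕ.+ h) → X z ≈ Y z) → strip i₀ h X ≈ strip i₀ h Y
  strip-cong i₀ h eq = ⅀-cong h λ i i<h → row-cong (i₀ ℕ.+ i) λ z _ z< →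
    eq z (ℕ.≤-trans z< (rowStart-mono (ℕ.≤-trans (ℕ.≤-reflexive (sym (ℕ.+-suc i₀ i))) (ℕ.+-monoʳ-≤ i₀ i<h))))

  row-zero : ∀ i {X} → (∀ z → rowStart i ℕ.≤ z → z ℕ.< rowStart (suc i) → X z ≈ 0#) → row i X ≈ 0#
  row-zero i h = ⅀-≈0 r λ j j< → ⅀-≈0 2 λ l l< → ⅀-≈0 4 λ k k< →
    ≈-trans (*-congʳ (h _ (rowStart≤addr i j k l) (addr<rowStart i j< k< l<))) (zeroˡ _)

  strip-+ : ∀ i₀ h X → strip 0 (h ℕ.+ i₀) X ≈ strip 0 i₀ X + strip i₀ h X
  strip-+ i₀ h X = ≈-trans (⅀-split i₀ h (λ i → row i X))
    (+-congˡ (⅀-cong h λ i _ → ≈-reflexive (cong (λ k → row k X) (ℕ.+-comm i i₀))))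

  update : Config → ℕ → Carrier → Config
  update X v c z with z ℕ.≟ v
  ... | yes _ = c
  ... | no _ = X z

  update-≢ : ∀ X v c {z} → z ≢ v → update X v c z ≈ X z
  update-≢ X v c {z} n with z ℕ.≟ v
  ... | yes e = ⊥-elim (n e)
  ... | no _ = ≈-refl

  -- Affinity is expressed as the midpoint identity between the three values -1, 0 and 1, which is
  -- the form that rounding consumes and which is closed under sums.
  AffineAt : ℕ → (Config → Carrier) → Set (a ⊔ ℓ)

  AffineAt v G = ∀ X → G (update X v 1#) + G (update X v (- 1#)) ≈ G (update X v 0#) + G (update X v 0#)

-- Rounding configurations with values in {-1, 0, 1}

module Rounding {a ℓ} (ℝ : Reals a ℓ) (r : ℕ) .{{r≢0 : NonZero r}} (dd up lf cc : ℕ → Reals.Carrier ℝ) where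
  open Reals ℝ
  open OrderedField ℝ
  open Address r
  open Energy ℝ r dd up lf cc
  open import Relation.Binary.Reasoning.Setoid setoid

  update-cong : ∀ v {X Y c d} → (∀ z → X z ≈ Y z) → c ≈ d → ∀ z → update X v c z ≈ update Y v d z
  update-cong v h e z with z ℕ.≟ v
  ... | yes _ = e
  ... | no _ = h z

  update-self : ∀ X v {c} → X v ≈ c → ∀ z → update X v c z ≈ X z
  update-self X v e z with z ℕ.≟ v
  ... | yes refl = ≈-sym e
  ... | no _ = ≈-refl

  ConstantAt : ℕ → (Config → Carrier) → Set (a ⊔ ℓ)
  ConstantAt v G = ∀ X c d → G (update X v c) ≈ G (update X v d)

  constant⇒affine : ∀ {v} G → ConstantAt v G → AffineAt v G
  constant⇒affine G h X = +-cong (h X 1# 0#) (h X (- 1#) 0#)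

  affine-+ : ∀ {v} G G′ → AffineAt v G → AffineAt v G′ → AffineAt v (λ X → G X + G′ X)
  affine-+ G G′ p q X = ≈-trans (+-interchange _ _ _ _) (≈-trans (+-cong (p X) (q X)) (+-interchange _ _ _ _))

  affine-⅀ : ∀ {v} n (G : ℕ → Config → Carrier) → (∀ k → k ℕ.< n → AffineAt v (G k)) →
    AffineAt v (λ X → ⅀ n (λ k → G k X))
  affine-⅀ n G p X = ≈-trans (⅀-+ n) (≈-trans (⅀-cong n (λ k k<n → p k k<n X)) (≈-sym (⅀-+ n)))

  affine-*ˡ : ∀ {v} G G′ → ConstantAt v G → AffineAt v G′ → AffineAt v (λ X → G X * G′ X)
  affine-*ˡ {v} G G′ p q X = begin
    G (update X v 1#) * G′ (update X v 1#) + G (update X v (- 1#)) * G′ (update X v (- 1#))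
      ≈⟨ +-cong (*-congʳ (p X 1# 0#)) (*-congʳ (p X (- 1#) 0#)) ⟩
    G (update X v 0#) * G′ (update X v 1#) + G (update X v 0#) * G′ (update X v (- 1#))
      ≈⟨ distribˡ _ _ _ ⟨
    G (update X v 0#) * (G′ (update X v 1#) + G′ (update X v (- 1#)))
      ≈⟨ *-congˡ (q X) ⟩
    G (update X v 0#) * (G′ (update X v 0#) + G′ (update X v 0#))
      ≈⟨ distribˡ _ _ _ ⟩
    G (update X v 0#) * G′ (update X v 0#) + G (update X v 0#) * G′ (update X v 0#) ∎

  affine-*ʳ : ∀ {v} G G′ → AffineAt v G → ConstantAt v G′ → AffineAt v (λ X → G X * G′ X)
  affine-*ʳ G G′ p q X = ≈-trans (+-cong (*-comm _ _) (*-comm _ _))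
    (≈-trans (affine-*ˡ G′ G q p X) (+-cong (*-comm _ _) (*-comm _ _)))

  constant-at : ∀ {v z} → z ≢ v → ConstantAt v (λ X → X z)
  constant-at {v} {z} ne X c d = ≈-trans (update-≢ X v c ne) (≈-sym (update-≢ X v d ne))

  affine-at : ∀ v z → AffineAt v (λ X → X z)
  affine-at v z X with z ℕ.≟ v
  ... | yes _ = ≈-trans (-‿inverseʳ 1#) (≈-sym (+-identityʳ 0#))
  ... | no _  = ≈-refl

  affine-scaled : ∀ v c z → AffineAt v (λ X → c * X z)
  affine-scaled v c z = affine-*ˡ (λ _ → c) (λ X → X z) (λ _ _ _ → ≈-refl) (affine-at v z)

  affine-const : ∀ v c → AffineAt v (λ _ → c)
  affine-const v c = constant⇒affine {v} (λ _ → c) (λ _ _ _ → ≈-refl)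

  affine-up : ∀ v i j k → AffineAt v (upTerm i j k)
  affine-up v zero    j k = affine-const v 0#
  affine-up v (suc i) j k = affine-scaled v (up (edgeAddr i j k)) (addr i j k 0)

  affine-left : ∀ v i j k → AffineAt v (leftTerm i j k)
  affine-left v i zero    k = affine-const v 0#
  affine-left v i (suc j) k = affine-scaled v (lf (edgeAddr i j k)) (addr i j k 1)

  affine-field : ∀ v i j k l → AffineAt v (field′ i j k l)
  affine-field v i j k zero    = affine-+ (λ _ → dd (addr i j k 0)) (upTerm i j k) (affine-const v _) (affine-up v i j k)
  affine-field v i j k (suc _) =
    affine-+ (λ _ → dd (addr i j k 1)) (λ X → leftTerm i j k X + cellTerm i j k X) (affine-const v _)
      (affine-+ (leftTerm i j k) (cellTerm i j k) (affine-left v i j k)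
        (affine-⅀ 4 (λ k₀ X → cc (cellAddr i j k₀ k) * X (addr i j k₀ 0))
          (λ k₀ _ → affine-scaled v (cc (cellAddr i j k₀ k)) (addr i j k₀ 0))))

  -- At most one factor of the product depends on `v`, since a field does not read its own vertex.
  -- Otherwise the term would be quadratic and rounding would fail.
  affine-term : ∀ v i {j k l} → j ℕ.< r → k ℕ.< 4 → l ℕ.< 2 →
    AffineAt v (λ X → X (addr i j k l) * field′ i j k l X)
  affine-term v i {j} {k} {l} j< k< l< = by-cases (addr i j k l ℕ.≟ v)
    where
    by-cases : Dec (addr i j k l ≡ v) → AffineAt v (λ X → X (addr i j k l) * field′ i j k l X)
    by-cases (no ne) = affine-*ˡ {v} (λ X → X (addr i j k l)) (field′ i j k l) (constant-at {v} {addr i j k l} ne) (affine-field v i j k l)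
    by-cases (yes refl) = affine-*ʳ {v} (λ X → X (addr i j k l)) (field′ i j k l) (affine-at v v)
      (λ X c d → field-cong i j k l< λ z rd → constant-at {v} {z} (reads-≢ j< k< l< rd) X c d)

  affine-row : ∀ v i → AffineAt v (row i)
  affine-row v i = affine-⅀ r (λ j X → ⅀ 2 λ l → ⅀ 4 λ k → X (addr i j k l) * field′ i j k l X) λ j j< →
    affine-⅀ 2 (λ l X → ⅀ 4 λ k → X (addr i j k l) * field′ i j k l X) λ l l< →
    affine-⅀ 4 (λ k X → X (addr i j k l) * field′ i j k l X) λ k k< → affine-term v i j< k< l<

  affine-strip : ∀ v i₀ h → AffineAt v (strip i₀ h)
  affine-strip v i₀ h = affine-⅀ h (λ i → row (i₀ ℕ.+ i)) λ i _ → affine-row v (i₀ ℕ.+ i)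

  IsTrit : Carrier → Set ℓ
  IsTrit x = IsSpin x ⊎ x ≈ 0#

  -- The method of conditional expectations, one address at a time: the value at a zero is the mean
  -- of the values at the two spins, so one spin is at least as good. Nothing outside the interval
  -- moves, which keeps earlier strips in place.
  round : (G : Config → Carrier) → (∀ {X Y} → (∀ z → X z ≈ Y z) → G X ≈ G Y) → (∀ v → AffineAt v G) →
    ∀ lo n X → (∀ z → lo ℕ.≤ z → z ℕ.< n ℕ.+ lo → IsTrit (X z)) →
    ∃ λ Y → (∀ z → z ℕ.< lo → Y z ≈ X z) × (∀ z → n ℕ.+ lo ℕ.≤ z → Y z ≈ X z)
          × (∀ z → lo ℕ.≤ z → z ℕ.< n ℕ.+ lo → IsSpin (Y z)) × G Y ≤ G X
  round G G-cong aff lo zero X trit =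
    X , (λ _ _ → ≈-refl) , (λ _ _ → ≈-refl) , (λ z p q → ⊥-elim (ℕ.<⇒≱ q p)) , ≤-refl
  round G G-cong aff lo (suc n) X trit
    with round G G-cong aff lo n X (λ z p q → trit z p (ℕ.m<n⇒m<1+n q))
  ... | Y , below , above , spin , G≤ = choose (trit v (ℕ.m≤n+m lo n) ℕ.≤-refl)
    where
    v = n ℕ.+ lo
    Result = ∃ λ Y → (∀ z → z ℕ.< lo → Y z ≈ X z) × (∀ z → suc n ℕ.+ lo ℕ.≤ z → Y z ≈ X z)
          × (∀ z → lo ℕ.≤ z → z ℕ.< suc n ℕ.+ lo → IsSpin (Y z)) × G Y ≤ G X

    set : ∀ c → IsSpin c → G (update Y v c) ≤ G X → Result
    set c sp le = update Y v c
      , (λ z z<lo → ≈-trans (update-≢ Y v c (ℕ.<⇒≢ (ℕ.≤-trans z<lo (ℕ.m≤n+m lo n)))) (below z z<lo))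
      , (λ z z≥ → ≈-trans (update-≢ Y v c (λ e → ℕ.<-irrefl (sym e) z≥)) (above z (ℕ.<⇒≤ z≥)))
      , spins , le
      where
      spins : ∀ z → lo ℕ.≤ z → z ℕ.< suc n ℕ.+ lo → IsSpin (update Y v c z)
      spins z lo≤z z< with z ℕ.≟ v
      ... | yes _ = sp
      ... | no ne = spin z lo≤z (ℕ.≤∧≢⇒< (s≤s⁻¹ z<) ne)

    Yv≈Xv : Y v ≈ X v
    Yv≈Xv = above v ℕ.≤-refl

    choose : IsTrit (X v) → Result
    choose (inj₁ sp) = set (Y v) (IsSpin-resp (≈-sym Yv≈Xv) sp)
      (≤-respˡ-≈ (≈-sym (G-cong (update-self Y v ≈-refl))) G≤)
    choose (inj₂ z) with average (≤-reflexive (aff v Y))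
    ... | inj₁ le = set 1# (inj₁ ≈-refl) (≤-trans le (≤-respˡ-≈ (≈-sym (G-cong (update-self Y v (≈-trans Yv≈Xv z)))) G≤))
    ... | inj₂ le = set (- 1#) (inj₂ ≈-refl) (≤-trans le (≤-respˡ-≈ (≈-sym (G-cong (update-self Y v (≈-trans Yv≈Xv z)))) G≤))

  -- Fixes the last spin in both ways and compares the two minima, the order being total. `G` is a
  -- variable because the recursive call is made for the functional with that coordinate frozen.
  minimiser : (G : Config → Carrier) → (∀ {X Y} → (∀ z → X z ≈ Y z) → G X ≈ G Y) → ∀ n (X : Config) →
    ∃ λ (Y : Config) → (∀ z → z ℕ.< n → IsSpin (Y z))
          × (∀ (Z : Config) → (∀ z → n ℕ.≤ z → Z z ≈ X z) → (∀ z → z ℕ.< n → IsSpin (Z z)) → G Y ≤ G Z)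
  minimiser G G-cong zero X = X , (λ _ ()) , λ Z h _ → ≤-reflexive (G-cong (λ z → ≈-sym (h z z≤n)))
  minimiser G G-cong (suc n) X = pick (total (G (proj₁ Y₊)) (G (proj₁ Y₋)))
    where
    Spins : Config → Set ℓ
    Spins Y = ∀ z → z ℕ.< suc n → IsSpin (Y z)

    Best : Carrier → Set (a ⊔ ℓ)
    Best c = ∃ λ (Y : Config) → Spins Y × (∀ (Z : Config) → (∀ z → suc n ℕ.≤ z → Z z ≈ X z) → Spins Z → Z n ≈ c → G Y ≤ G Z)

    fix : ∀ c → IsSpin c → Best c
    fix c sp with minimiser (λ Y → G (update Y n c)) (λ h → G-cong (update-cong n h ≈-refl)) n X
    ... | Y , spY , min = update Y n c , spins , λ Z off spZ Zn≈c →
      ≤-respʳ-≈ (G-cong (λ z → restore Z off Zn≈c z))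
        (min (update Z n (X n)) (λ z n≤z → agree Z off z n≤z)
          (λ z z<n → IsSpin-resp (≈-sym (update-≢ Z n (X n) (ℕ.<⇒≢ z<n))) (spZ z (ℕ.m<n⇒m<1+n z<n))))
      where
      spins : Spins (update Y n c)
      spins z z< with z ℕ.≟ n
      ... | yes _ = sp
      ... | no ne = spY z (ℕ.≤∧≢⇒< (s≤s⁻¹ z<) ne)
      agree : ∀ (Z : Config) → (∀ z → suc n ℕ.≤ z → Z z ≈ X z) → ∀ z → n ℕ.≤ z → update Z n (X n) z ≈ X z
      agree Z off z n≤z with z ℕ.≟ n
      ... | yes refl = ≈-refl
      ... | no ne = off z (ℕ.≤∧≢⇒< n≤z (λ e → ne (sym e)))
      restore : ∀ (Z : Config) → (∀ z → suc n ℕ.≤ z → Z z ≈ X z) → Z n ≈ c → ∀ z → update (update Z n (X n)) n c z ≈ Z z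
      restore Z off e z with z ℕ.≟ n
      ... | yes refl = ≈-sym e
      ... | no ne = update-≢ Z n (X n) ne

    Y₊ = fix 1# (inj₁ ≈-refl)
    Y₋ = fix (- 1#) (inj₂ ≈-refl)

    pick : (G (proj₁ Y₊) ≤ G (proj₁ Y₋)) ⊎ (G (proj₁ Y₋) ≤ G (proj₁ Y₊)) →
      ∃ λ (Y : Config) → Spins Y × (∀ (Z : Config) → (∀ z → suc n ℕ.≤ z → Z z ≈ X z) → Spins Z → G Y ≤ G Z)
    pick (inj₁ le) = proj₁ Y₊ , proj₁ (proj₂ Y₊) , λ Z off spZ → case Z off spZ (spZ n ℕ.≤-refl)
      where
      case : ∀ (Z : Config) → (∀ z → suc n ℕ.≤ z → Z z ≈ X z) → Spins Z → IsSpin (Z n) → G (proj₁ Y₊) ≤ G Z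
      case Z off spZ (inj₁ e) = proj₂ (proj₂ Y₊) Z off spZ e
      case Z off spZ (inj₂ e) = ≤-trans le (proj₂ (proj₂ Y₋) Z off spZ e)
    pick (inj₂ le) = proj₁ Y₋ , proj₁ (proj₂ Y₋) , λ Z off spZ → case Z off spZ (spZ n ℕ.≤-refl)
      where
      case : ∀ (Z : Config) → (∀ z → suc n ℕ.≤ z → Z z ≈ X z) → Spins Z → IsSpin (Z n) → G (proj₁ Y₋) ≤ G Z
      case Z off spZ (inj₁ e) = ≤-trans le (proj₂ (proj₂ Y₊) Z off spZ e)
      case Z off spZ (inj₂ e) = proj₂ (proj₂ Y₋) Z off spZ e

  strip-cong′ : ∀ i₀ h {X Y} → (∀ z → X z ≈ Y z) → strip i₀ h X ≈ strip i₀ h Y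
  strip-cong′ i₀ h e = strip-cong i₀ h (λ z _ → e z)

  splice : ℕ → Config → Config → Config
  splice n X M z with z ℕ.<? n
  ... | yes _ = X z
  ... | no _ = M z

  splice-< : ∀ n X M {z} → z ℕ.< n → splice n X M z ≈ X z
  splice-< n X M {z} p with z ℕ.<? n
  ... | yes _ = ≈-refl
  ... | no q = ⊥-elim (q p)

  splice-≥ : ∀ n X M {z} → n ℕ.≤ z → splice n X M z ≈ M z
  splice-≥ n X M {z} p with z ℕ.<? n
  ... | yes q = ⊥-elim (ℕ.<⇒≱ q p)
  ... | no _ = ≈-refl

  VanishesOnRow : Config → ℕ → Set ℓ
  VanishesOnRow M i = ∀ z → rowStart i ℕ.≤ z → z ℕ.< rowStart (suc i) → M z ≈ 0#

  -- Only the first row of the strip can see the spliced part, and in both configurations that row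
  -- is multiplied by zero spins. For `i₀ ≡ 0` there is no spliced part.
  strip-splice : ∀ i₀ h X M → (i₀ ≡ 0) ⊎ VanishesOnRow M i₀ →
    strip i₀ h (splice (rowStart i₀) X M) ≈ strip i₀ h M
  strip-splice i₀ h X M van = ⅀-cong h λ { zero _ → first van
                                         ; (suc i) _ → row-cong (i₀ ℕ.+ suc i) λ z z≥ _ → splice-≥ _ X M (later i z z≥) }
    where
    Y = splice (rowStart i₀) X M
    later : ∀ i z → rowStart (i₀ ℕ.+ suc i ℕ.∸ 1) ℕ.≤ z → rowStart i₀ ℕ.≤ z
    later i z p = ℕ.≤-trans (rowStart-mono (subst (i₀ ℕ.≤_) (cong (ℕ._∸ 1) (sym (ℕ.+-suc i₀ i))) (ℕ.m≤m+n i₀ i))) p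
    first : (i₀ ≡ 0) ⊎ VanishesOnRow M i₀ → row (i₀ ℕ.+ 0) Y ≈ row (i₀ ℕ.+ 0) M
    first (inj₁ refl) = row-cong 0 λ z _ _ → splice-≥ 0 X M z≤n
    first (inj₂ v) = subst (λ i → row i Y ≈ row i M) (sym (ℕ.+-identityʳ i₀))
      (≈-trans (row-zero i₀ (λ z p q → ≈-trans (splice-≥ _ X M p) (v z p q))) (≈-sym (row-zero i₀ v)))

  SpinsBetween : ℕ → ℕ → Config → Set ℓ
  SpinsBetween m n X = ∀ z → rowStart m ℕ.≤ z → z ℕ.< rowStart n → IsSpin (X z)

  rowStart-∸ : ∀ i₀ h → h ℕ.* (r ℕ.* 8) ℕ.+ rowStart i₀ ≡ rowStart (i₀ ℕ.+ h)
  rowStart-∸ i₀ h = trans (sym (ℕ.*-distribʳ-+ (r ℕ.* 8) h i₀)) (cong rowStart (ℕ.+-comm h i₀))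

  -- `M` itself is no competitor for `opt`: it may contain zeros and differ from `X` above the
  -- strip. Grafting it below `X` and rounding only the addresses of the strip repairs both without
  -- raising the strip energy.
  strip-bound : ∀ i₀ h X M → (∀ z → IsTrit (M z)) → (i₀ ≡ 0) ⊎ VanishesOnRow M i₀ →
    (∀ (Z : Config) → (∀ z → z ℕ.< rowStart i₀ → Z z ≈ X z) → SpinsBetween i₀ (i₀ ℕ.+ h) Z → strip i₀ h X ≤ strip i₀ h Z) →
    strip i₀ h X ≤ strip i₀ h M
  strip-bound i₀ h X M trit van opt
    with round (strip i₀ h) (strip-cong′ i₀ h) (λ v → affine-strip v i₀ h) (rowStart i₀) (h ℕ.* (r ℕ.* 8))
           (splice (rowStart i₀) X M) (λ z p _ → trits z p)
    where
    trits : ∀ z → rowStart i₀ ℕ.≤ z → IsTrit (splice (rowStart i₀) X M z)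
    trits z p with trit z
    ... | inj₁ s = inj₁ (IsSpin-resp (≈-sym (splice-≥ _ X M p)) s)
    ... | inj₂ e = inj₂ (≈-trans (splice-≥ _ X M p) e)
  ... | Z , below , _ , spins , le = ≤-trans
    (opt Z (λ z p → ≈-trans (below z p) (splice-< _ X M p))
           (λ z p q → spins z p (subst (z ℕ.<_) (sym (rowStart-∸ i₀ h)) q)))
    (≤-respʳ-≈ (strip-splice i₀ h X M van) le)

-- Averaging over the L ways to cut

module Averaging {a ℓ} (ℝ : Reals a ℓ) (r : ℕ) .{{r≢0 : NonZero r}} (dd up lf cc : ℕ → Reals.Carrier ℝ) where
  open Reals ℝ
  open OrderedField ℝ
  open Address r
  open Energy ℝ r dd up lf cc
  open Rounding ℝ r dd up lf cc
  open import Relation.Binary.Reasoning.Setoid setoid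

  instance
    r*8≢0 : NonZero (r ℕ.* 8)
    r*8≢0 = ℕ.m*n≢0 r 8

  -- `vertical` is the part of a row that reads the row above. `interior` is confined to its own row
  -- and therefore survives when the row above is masked.
  vertical interior : ℕ → Config → Carrier
  vertical i X = ⅀ r λ j → ⅀ 4 λ k → X (addr i j k 0) * upTerm i j k X
  interior i X = ⅀ r λ j → (⅀ 4 λ k → X (addr i j k 0) * dd (addr i j k 0)) + (⅀ 4 λ k → X (addr i j k 1) * field′ i j k 1 X)

  ⅀-2 : ∀ f → ⅀ 2 f ≈ f 0 + f 1
  ⅀-2 f = ≈-trans (⅀-suc 1) (+-congʳ (≈-trans (⅀-suc 0) (≈-trans (+-congʳ ⅀-0) (+-identityˡ _))))

  row-split : ∀ i X → row i X ≈ vertical i X + interior i X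
  row-split i X = ≈-trans (⅀-cong r λ j _ → split j) (≈-sym (⅀-+ r))
    where
    split : ∀ j → (⅀ 2 λ l → ⅀ 4 λ k → X (addr i j k l) * field′ i j k l X) ≈
      (⅀ 4 λ k → X (addr i j k 0) * upTerm i j k X) +
      ((⅀ 4 λ k → X (addr i j k 0) * dd (addr i j k 0)) + (⅀ 4 λ k → X (addr i j k 1) * field′ i j k 1 X))
    split j = ≈-trans (⅀-2 _) (≈-trans (+-congʳ (≈-trans (⅀-cong 4 λ k _ → ≈-trans (distribˡ _ _ _) (+-comm _ _)) (≈-sym (⅀-+ 4)))) (+-assoc _ _ _))

  interior-cong : ∀ i {X Y} → (∀ z → rowStart i ℕ.≤ z → z ℕ.< rowStart (suc i) → X z ≈ Y z) → interior i X ≈ interior i Y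
  interior-cong i h = ⅀-cong r λ j j< → +-cong
    (⅀-cong 4 λ k k< → *-congʳ (h _ (rowStart≤addr i j k 0) (addr<rowStart i j< k< (s≤s z≤n))))
    (⅀-cong 4 λ k k< → *-cong (h _ (rowStart≤addr i j k 1) (addr<rowStart i j< k< (s≤s (s≤s z≤n))))
      (field-cong i j k (s≤s (s≤s z≤n)) λ { _ (reads-left {j = j}) → h _ (rowStart≤addr i j k 1) (addr<rowStart i (ℕ.<-trans (ℕ.n<1+n j) j<) k< (s≤s (s≤s z≤n)))
                                          ; _ (reads-cell {k₀ = k₀} k₀<) → h _ (rowStart≤addr i j k₀ 0) (addr<rowStart i j< k₀< (s≤s z≤n)) }))

  vertical-zero : ∀ i {X} → VanishesOnRow X i → vertical (suc i) X ≈ 0#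
  vertical-zero i v = ⅀-≈0 r λ j j< → ⅀-≈0 4 λ k k< →
    ≈-trans (*-congˡ (≈-trans (*-congˡ (v _ (rowStart≤addr i j k 0) (addr<rowStart i j< k< (s≤s z≤n)))) (zeroʳ _))) (zeroʳ _)

  vertical-0 : ∀ X → vertical 0 X ≈ 0#
  vertical-0 X = ⅀-≈0 r λ j j< → ⅀-≈0 4 λ k k< → zeroʳ _

  energy : Config → Carrier
  energy = strip 0 r

  module _ (L : ℕ) .{{_ : NonZero L}} where

    mask : ℕ → Config → Config
    mask o X z with (z / (r ℕ.* 8)) % L ℕ.≟ o
    ... | yes _ = 0#
    ... | no _ = X z

    mask-≡ : ∀ {o} X {z} → (z / (r ℕ.* 8)) % L ≡ o → mask o X z ≈ 0#
    mask-≡ {o} X {z} e with (z / (r ℕ.* 8)) % L ℕ.≟ o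
    ... | yes _ = ≈-refl
    ... | no n = ⊥-elim (n e)

    mask-≢ : ∀ {o} X {z} → (z / (r ℕ.* 8)) % L ≢ o → mask o X z ≈ X z
    mask-≢ {o} X {z} n with (z / (r ℕ.* 8)) % L ℕ.≟ o
    ... | yes e = ⊥-elim (n e)
    ... | no _ = ≈-refl

    mask-trit : ∀ o X → (∀ z → IsTrit (X z)) → ∀ z → IsTrit (mask o X z)
    mask-trit o X h z with (z / (r ℕ.* 8)) % L ℕ.≟ o
    ... | yes _ = inj₂ ≈-refl
    ... | no _ = h z

    rowOf : ∀ i z → rowStart i ℕ.≤ z → z ℕ.< rowStart (suc i) → z / (r ℕ.* 8) ≡ i
    rowOf i z p q = ℕ.≤-antisym (s≤s⁻¹ (m<n*o⇒m/o<n {z} {suc i} {r ℕ.* 8} q))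
      (subst (ℕ._≤ z / (r ℕ.* 8)) (m*n/n≡m i (r ℕ.* 8)) (/-monoˡ-≤ (r ℕ.* 8) p))

    mask-vanishes : ∀ {o} X i → i % L ≡ o → VanishesOnRow (mask o X) i
    mask-vanishes X i e z p q = mask-≡ X (trans (cong (_% L) (rowOf i z p q)) e)

    mask-keeps : ∀ {o} X i → i % L ≢ o → ∀ z → rowStart i ℕ.≤ z → z ℕ.< rowStart (suc i) → mask o X z ≈ X z
    mask-keeps X i n z p q = mask-≢ X (λ e → n (trans (sym (cong (_% L) (rowOf i z p q))) e))

    module _ (2≤L : 2 ℕ.≤ L) (X : Config) where

      -- Either the row itself is masked and is lost entirely, or the row above is masked and only
      -- the vertical part is lost; `suc-%` excludes both at once. In row 0, where `i ∸ 1` is 0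
      -- again, both corrections may fire, harmlessly because its vertical part is zero.
      row-mask : ∀ i o → row i (mask o X) + (δ (i % L) o (row i X) + δ ((i ℕ.∸ 1) % L) o (vertical i X)) ≈ row i X
      row-mask i o with i % L ℕ.≟ o
      row-mask zero o | yes e = begin
        row 0 (mask o X) + (row 0 X + δ (0 % L) o (vertical 0 X))
          ≈⟨ +-cong (row-zero 0 (mask-vanishes X 0 e)) (+-congˡ (≈-trans (δ-≡ {0 % L} {o} (vertical 0 X) e) (vertical-0 X))) ⟩
        0# + (row 0 X + 0#) ≈⟨ ≈-trans (+-identityˡ _) (+-identityʳ _) ⟩
        row 0 X ∎
      row-mask (suc i) o | yes e = begin
        row (suc i) (mask o X) + (row (suc i) X + δ (i % L) o (vertical (suc i) X))
          ≈⟨ +-cong (row-zero (suc i) (mask-vanishes X (suc i) e)) (+-congˡ (δ-≢ {i % L} {o} (vertical (suc i) X) (λ e′ → suc-% i L 2≤L (trans e (sym e′))))) ⟩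
        0# + (row (suc i) X + 0#) ≈⟨ ≈-trans (+-identityˡ _) (+-identityʳ _) ⟩
        row (suc i) X ∎
      row-mask zero o | no n = begin
        row 0 (mask o X) + (0# + δ (0 % L) o (vertical 0 X))
          ≈⟨ +-cong (row-cong 0 (mask-keeps X 0 n)) (+-congˡ (δ-≢ {0 % L} {o} (vertical 0 X) n)) ⟩
        row 0 X + (0# + 0#) ≈⟨ ≈-trans (+-congˡ (+-identityˡ _)) (+-identityʳ _) ⟩
        row 0 X ∎
      row-mask (suc i) o | no n = ≈-trans (+-congˡ (+-identityˡ _)) (by-cases (i % L ℕ.≟ o))
        where
        by-cases : Dec (i % L ≡ o) → row (suc i) (mask o X) + δ (i % L) o (vertical (suc i) X) ≈ row (suc i) X
        by-cases (yes e) = begin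
          row (suc i) (mask o X) + δ (i % L) o (vertical (suc i) X)
            ≈⟨ +-cong (row-split (suc i) _) (δ-≡ {i % L} {o} _ e) ⟩
          (vertical (suc i) (mask o X) + interior (suc i) (mask o X)) + vertical (suc i) X
            ≈⟨ +-congʳ (+-cong (vertical-zero i (mask-vanishes X i e)) (interior-cong (suc i) (mask-keeps X (suc i) n))) ⟩
          (0# + interior (suc i) X) + vertical (suc i) X
            ≈⟨ ≈-trans (+-congʳ (+-identityˡ _)) (+-comm _ _) ⟩
          vertical (suc i) X + interior (suc i) X ≈⟨ row-split (suc i) X ⟨
          row (suc i) X ∎
        by-cases (no n′) = ≈-trans (+-cong (row-cong (suc i) keeps) (δ-≢ {i % L} {o} _ n′)) (+-identityʳ _)
          where
          keeps : ∀ z → rowStart i ℕ.≤ z → z ℕ.< rowStart (suc (suc i)) → mask o X z ≈ X z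
          keeps z p q with z ℕ.<? rowStart (suc i)
          ... | yes z< = mask-keeps X i n′ z p z<
          ... | no z≮ = mask-keeps X (suc i) n z (ℕ.≮⇒≥ z≮) q

      -- Every row is masked for exactly one o, and every vertical edge is lost for exactly two.
      mask-average : (⅀ L λ o → energy (mask o X)) + (energy X + (⅀ r λ i → vertical i X)) ≈ ⅀ L (λ _ → energy X)
      mask-average = begin
        (⅀ L λ o → ⅀ r λ i → row i (mask o X)) + (energy X + (⅀ r λ i → vertical i X))
          ≈⟨ +-cong (⅀-swap L r (λ o i → row i (mask o X))) (⅀-+ r) ⟩
        (⅀ r λ i → ⅀ L λ o → row i (mask o X)) + (⅀ r λ i → row i X + vertical i X)
          ≈⟨ ⅀-+ r ⟩
        (⅀ r λ i → (⅀ L λ o → row i (mask o X)) + (row i X + vertical i X))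
          ≈⟨ ⅀-cong r (λ i _ → per-row i) ⟩
        (⅀ r λ i → ⅀ L λ _ → row i X)
          ≈⟨ ⅀-swap r L (λ i _ → row i X) ⟩
        (⅀ L λ _ → energy X) ∎
        where
        per-row : ∀ i → (⅀ L λ o → row i (mask o X)) + (row i X + vertical i X) ≈ ⅀ L λ _ → row i X
        per-row i = begin
          (⅀ L λ o → row i (mask o X)) + (row i X + vertical i X)
            ≈⟨ +-congˡ (+-cong (⅀-δ L (i % L) (row i X) (m%n<n i L)) (⅀-δ L ((i ℕ.∸ 1) % L) (vertical i X) (m%n<n (i ℕ.∸ 1) L))) ⟨
          (⅀ L λ o → row i (mask o X)) + ((⅀ L λ o → δ (i % L) o (row i X)) + (⅀ L λ o → δ ((i ℕ.∸ 1) % L) o (vertical i X)))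
            ≈⟨ +-congˡ (⅀-+ L) ⟩
          (⅀ L λ o → row i (mask o X)) + (⅀ L λ o → δ (i % L) o (row i X) + δ ((i ℕ.∸ 1) % L) o (vertical i X))
            ≈⟨ ⅀-+ L ⟩
          (⅀ L λ o → row i (mask o X) + (δ (i % L) o (row i X) + δ ((i ℕ.∸ 1) % L) o (vertical i X)))
            ≈⟨ ⅀-cong L (λ o _ → row-mask i o) ⟩
          (⅀ L λ _ → row i X) ∎

  -- Keeping only the spins with l = 0, once as they are and once negated, isolates the vertical edges.
  evens : (Carrier → Carrier) → Config → Config
  evens f X z with z % 2 ℕ.≟ 0
  ... | yes _ = f (X z)
  ... | no _ = 0#

  evens-0 : ∀ f X i j k → evens f X (addr i j k 0) ≈ f (X (addr i j k 0))
  evens-0 f X i j k with addr i j k 0 % 2 ℕ.≟ 0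
  ... | yes _ = ≈-refl
  ... | no n = ⊥-elim (n (addr-parity i j k (s≤s z≤n)))

  evens-1 : ∀ f X i j k → evens f X (addr i j k 1) ≈ 0#
  evens-1 f X i j k with addr i j k 1 % 2 ℕ.≟ 0
  ... | yes e = ⊥-elim (ℕ.1+n≢0 (trans (sym (addr-parity i j k (s≤s (s≤s z≤n)))) e))
  ... | no _ = ≈-refl

  IsLinear : (Carrier → Carrier) → Set _
  IsLinear f = (∀ c x → f (c * x) ≈ c * f x) × f 0# ≈ 0#

  evens-up : ∀ f X → IsLinear f → ∀ i j k → upTerm i j k (evens f X) ≈ f (upTerm i j k X)
  evens-up f X (_ , f0) zero    j k = ≈-sym f0
  evens-up f X (fc , _) (suc i) j k = ≈-trans (*-congˡ (evens-0 f X i j k)) (≈-sym (fc _ _))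

  evens-row : ∀ f X → IsLinear f → ∀ i → row i (evens f X) ≈
    (⅀ r λ j → ⅀ 4 λ k → f (X (addr i j k 0)) * (dd (addr i j k 0) + f (upTerm i j k X)))
  evens-row f X lin i = ⅀-cong r λ j _ → ≈-trans (⅀-2 _) (≈-trans (+-cong
    (⅀-cong 4 λ k _ → *-cong (evens-0 f X i j k) (+-congˡ (evens-up f X lin i j k)))
    (⅀-≈0 4 λ k _ → ≈-trans (*-congʳ (evens-1 f X i j k)) (zeroˡ _))) (+-identityʳ _))

  id-linear : IsLinear (λ x → x)
  id-linear = (λ _ _ → ≈-refl) , ≈-refl

  neg-linear : IsLinear (-_)
  neg-linear = -‿distribʳ-* , -0#≈0#

  -- Flipping all spins cancels the external field, which is odd, and doubles the coupling, which is
  -- even.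
  opposite-fields : ∀ x d u → x * (d + u) + - x * (d + - u) ≈ x * u + x * u
  opposite-fields x d u = begin
    x * (d + u) + - x * (d + - u)               ≈⟨ +-cong (distribˡ x d u) (distribˡ (- x) d (- u)) ⟩
    (x * d + x * u) + (- x * d + - x * - u)     ≈⟨ +-interchange _ _ _ _ ⟩
    (x * d + - x * d) + (x * u + - x * - u)     ≈⟨ +-cong (≈-sym (distribʳ d x (- x))) (+-congˡ (≈-trans (≈-sym (-‿distribˡ-* x (- u))) (≈-trans (-‿cong (≈-sym (-‿distribʳ-* x u))) (-‿involutive _)))) ⟩
    (x + - x) * d + (x * u + x * u)             ≈⟨ +-congʳ (≈-trans (*-congʳ (-‿inverseʳ x)) (zeroˡ d)) ⟩
    0# + (x * u + x * u)                        ≈⟨ +-identityˡ _ ⟩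
    x * u + x * u                               ∎

  evens-energy : ∀ X → energy (evens (λ x → x) X) + energy (evens -_ X) ≈
    (⅀ r λ i → vertical i X) + (⅀ r λ i → vertical i X)
  evens-energy X = ≈-trans (⅀-+ r) (≈-trans (⅀-cong r λ i _ → per-row i) (≈-sym (⅀-+ r)))
    where
    per-row : ∀ i → row i (evens (λ x → x) X) + row i (evens -_ X) ≈ vertical i X + vertical i X
    per-row i = ≈-trans (+-cong (evens-row (λ x → x) X id-linear i) (evens-row -_ X neg-linear i))
      (≈-trans (⅀-+ r) (≈-trans (⅀-cong r λ j _ → ≈-trans (⅀-+ 4) (≈-trans (⅀-cong 4 λ k _ → opposite-fields _ _ _) (≈-sym (⅀-+ 4)))) (≈-sym (⅀-+ r))))

  evens-trit : ∀ f → (∀ {x} → IsSpin x → IsSpin (f x)) → ∀ X → (∀ z → IsSpin (X z)) → ∀ z → IsTrit (evens f X z)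
  evens-trit f h X sp z with z % 2 ℕ.≟ 0
  ... | yes _ = inj₁ (h (sp z))
  ... | no _ = inj₂ ≈-refl

  neg-spin : ∀ {x} → IsSpin x → IsSpin (- x)
  neg-spin (inj₁ e) = inj₂ (-‿cong e)
  neg-spin (inj₂ e) = inj₁ (≈-trans (-‿cong e) (-‿involutive 1#))

  module _ (X* : Config) (spins : ∀ z → IsSpin (X* z))
           (optimal : ∀ Z → SpinsBetween 0 r Z → energy X* ≤ energy Z) where

    -- By rounding over the whole grid, configurations with zeros become legitimate competitors. The
    -- zero configuration gives nonpositivity of the optimum, and the `evens` configurations bound
    -- its vertical part.
    optimal-trit : ∀ M → (∀ z → IsTrit (M z)) → energy X* ≤ energy M
    optimal-trit M trit with round energy (strip-cong′ 0 r) (λ v → affine-strip v 0 r) 0 (r ℕ.* (r ℕ.* 8)) M (λ z _ _ → trit z)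
    ... | Z , _ , _ , sp , le = ≤-trans (optimal Z (λ z p q → sp z z≤n (subst (z ℕ.<_) (sym (ℕ.+-identityʳ _)) q))) le

    optimal-nonPos : energy X* ≤ 0#
    optimal-nonPos = ≤-respʳ-≈ (⅀-≈0 r λ i _ → row-zero i λ _ _ _ → ≈-refl) (optimal-trit (λ _ → 0#) (λ _ → inj₂ ≈-refl))

    optimal≤vertical : energy X* ≤ ⅀ r λ i → vertical i X*
    optimal≤vertical = halve
      where
      twice : energy X* + energy X* ≤ (⅀ r λ i → vertical i X*) + (⅀ r λ i → vertical i X*)
      twice = ≤-respʳ-≈ (evens-energy X*) (+-mono-≤
        (optimal-trit _ (evens-trit (λ x → x) (λ s → s) X* spins)) (optimal-trit _ (evens-trit -_ neg-spin X* spins)))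
      halve : energy X* ≤ ⅀ r λ i → vertical i X*
      halve with average twice
      ... | inj₁ le = le
      ... | inj₂ le = le

    masked-energies : ∀ L .{{_ : NonZero L}} → 2 ℕ.≤ L →
      (⅀ L λ o → energy (mask L o X*)) + (energy X* + energy X*) ≤ ⅀ L (λ _ → energy X*)
    masked-energies L 2≤L = ≤-respʳ-≈ (mask-average L 2≤L X*)
      (+-mono-≤ ≤-refl (+-mono-≤ ≤-refl optimal≤vertical))

-- Vertex and edge indices of the input as explicit addresses

module _ {r : ℕ} where
  open Address r

  toℕ-combine₄ : ∀ {m} (g : Fin m) (k : Fin 4) {x} → toℕ g ≡ x → toℕ (combine g k) ≡ dbl (dbl x) ℕ.+ toℕ k
  toℕ-combine₄ g k {x} refl = trans (toℕ-combine g k) (cong (ℕ._+ toℕ k) (lemma x))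
    where
    lemma : ∀ x → 4 ℕ.* x ≡ (x ℕ.+ x) ℕ.+ (x ℕ.+ x)
    lemma = solve-∀

  toℕ-cell : ∀ (i j : Fin r) {x} → toℕ i ≡ x → toℕ (combine i j) ≡ x ℕ.* r ℕ.+ toℕ j
  toℕ-cell i j refl = trans (toℕ-combine i j) (cong (ℕ._+ toℕ j) (ℕ.*-comm r (toℕ i)))

  vertexIndex≡addr : ∀ (i j : Fin r) k l → vertexIndex (i , j , k , l) ≡ addr (toℕ i) (toℕ j) (toℕ k) (toℕ l)
  vertexIndex≡addr i j k l = trans (toℕ-combine (combine (combine i j) k) l)
    (cong (ℕ._+ toℕ l) (trans (sym (dbl≡2* (toℕ (combine (combine i j) k)))) (cong dbl (toℕ-combine₄ (combine i j) k (toℕ-cell i j refl)))))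

module _ {m : ℕ} where
  open Address (suc m)

  edgeIndex-e₀ : ∀ (i : Fin m) (j : Fin (suc m)) k → edgeIndex (e₀ i j k) ≡ edgeAddr (toℕ i) (toℕ j) (toℕ k)
  edgeIndex-e₀ i j k = toℕ-combine₄ {suc m} (combine (inject₁ i) j) k (toℕ-cell (inject₁ i) j (toℕ-inject₁ i))

  edgeIndex-e₁ : ∀ (i : Fin (suc m)) (j : Fin m) k → edgeIndex (e₁ i j k) ≡ edgeAddr (toℕ i) (toℕ j) (toℕ k)
  edgeIndex-e₁ i j k = toℕ-combine₄ {suc m} (combine i (inject₁ j)) k
    (trans (toℕ-cell i (inject₁ j) refl) (cong (toℕ i ℕ.* suc m ℕ.+_) (toℕ-inject₁ j)))

  edgeIndex-e₀₁ : ∀ (i j : Fin (suc m)) k₀ k₁ →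
    edgeIndex (e₀₁ i j k₀ k₁) ≡ cellAddr (toℕ i) (toℕ j) (toℕ k₀) (toℕ k₁)
  edgeIndex-e₀₁ i j k₀ k₁ = toℕ-combine₄ {suc m} (combine (combine i j) k₀) k₁
    (toℕ-combine₄ {suc m} (combine i j) k₀ (toℕ-cell i j refl))

-- The Hamiltonian equals the energy of the induced configuration

module HamiltonianEnergy {a ℓ} (ℝ : Reals a ℓ) (m : ℕ) (dd up lf cc : ℕ → Reals.Carrier ℝ) where
  open Reals ℝ
  open Hamiltonian ℝ
  open OrderedField ℝ
  open Address (suc m)
  open Energy ℝ (suc m) dd up lf cc
  open Averaging ℝ (suc m) dd up lf cc
  open import Relation.Binary.Reasoning.Setoid setoid

  private
    r = suc m

  module _ (c : Edge r → Carrier) (d : Vertex r → Carrier) (S : Vertex r → Sign) (X : Config)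
    (holds-d : ∀ u → dd (vertexIndex u) ≈ d u)
    (holds-e₀ : ∀ i j k → up (edgeIndex (e₀ {m} i j k)) ≈ c (e₀ i j k))
    (holds-e₁ : ∀ i j k → lf (edgeIndex (e₁ {m} i j k)) ≈ c (e₁ i j k))
    (holds-e₀₁ : ∀ i j k₀ k₁ → cc (edgeIndex (e₀₁ {r} i j k₀ k₁)) ≈ c (e₀₁ i j k₀ k₁))
    (X≈S : ∀ u → X (vertexIndex u) ≈ spin (S u)) where

    private
      at : ∀ {f : ℕ → Carrier} {x y z} → f x ≈ z → x ≡ y → z ≈ f y
      at p refl = ≈-sym p

    X-at : ∀ i j k l → spin (S (i , j , k , l)) ≈ X (addr (toℕ i) (toℕ j) (toℕ k) (toℕ l))
    X-at i j k l = at {X} (X≈S (i , j , k , l)) (vertexIndex≡addr i j k l)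

    X-at′ : ∀ i j {x y} k l → toℕ i ≡ x → toℕ j ≡ y → spin (S (i , j , k , l)) ≈ X (addr x y (toℕ k) (toℕ l))
    X-at′ i j k l refl refl = X-at i j k l

    -- A vertical edge is charged to its lower end, so edges with index `i` match row `suc i`. The
    -- remaining row 0 has no vertical energy.
    verticalEdges : (∑[ i < m ] ∑[ j < r ] ∑[ k < 4 ] (c (e₀ i j k) * spin (S (inject₁ i , j , k , zero)) * spin (S (suc i , j , k , zero))))
      ≈ ⅀ r λ i → vertical i X
    verticalEdges = ≈-trans (sum≈⅀ {g = λ i → vertical (suc i) X} m λ i → sum≈⅀ r λ j → sum≈⅀ 4 λ k →
        ≈-trans (*-comm _ _) (*-cong (X-at (suc i) j k zero) (*-cong (at {up} (holds-e₀ i j k) (edgeIndex-e₀ i j k)) (X-at′ (inject₁ i) j k zero (toℕ-inject₁ i) refl))))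
      (≈-sym (≈-trans (⅀-cons m _) (≈-trans (+-congʳ (vertical-0 X)) (+-identityˡ _))))

    horizontal inner external : ℕ → Config → Carrier
    horizontal i Y = ⅀ r λ j → ⅀ 4 λ k → Y (addr i j k 1) * leftTerm i j k Y
    inner i Y = ⅀ r λ j → ⅀ 4 λ k → Y (addr i j k 1) * cellTerm i j k Y
    external i Y = ⅀ r λ j → (⅀ 4 λ k → Y (addr i j k 0) * dd (addr i j k 0)) + (⅀ 4 λ k → Y (addr i j k 1) * dd (addr i j k 1))

    horizontalEdges : (∑[ i < r ] ∑[ j < m ] ∑[ k < 4 ] (c (e₁ i j k) * spin (S (i , inject₁ j , k , suc zero)) * spin (S (i , suc j , k , suc zero))))
      ≈ ⅀ r λ i → horizontal i X
    horizontalEdges = sum≈⅀ r λ i → ≈-trans (sum≈⅀ {g = λ j → ⅀ 4 λ k → X (addr (toℕ i) (suc j) k 1) * leftTerm (toℕ i) (suc j) k X} m λ j → sum≈⅀ 4 λ k →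
        ≈-trans (*-comm _ _) (*-cong (X-at i (suc j) k (suc zero)) (*-cong (at {lf} (holds-e₁ i j k) (edgeIndex-e₁ i j k)) (X-at′ i (inject₁ j) k (suc zero) refl (toℕ-inject₁ j)))))
      (≈-sym (≈-trans (⅀-cons m _) (≈-trans (+-congʳ (⅀-≈0 4 λ k _ → zeroʳ _)) (+-identityˡ _))))

    innerEdges : (∑[ i < r ] ∑[ j < r ] ∑[ k₀ < 4 ] ∑[ k₁ < 4 ] (c (e₀₁ i j k₀ k₁) * spin (S (i , j , k₀ , zero)) * spin (S (i , j , k₁ , suc zero))))
      ≈ ⅀ r λ i → inner i X
    innerEdges = sum≈⅀ r λ i → sum≈⅀ r λ j → ≈-trans (sum≈⅀ 4 λ k₀ → sum≈⅀ 4 λ k₁ →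
        ≈-trans (*-comm _ _) (*-cong (X-at i j k₁ (suc zero)) (*-cong (at {cc} (holds-e₀₁ i j k₀ k₁) (edgeIndex-e₀₁ i j k₀ k₁)) (X-at i j k₀ zero))))
      (≈-trans (⅀-swap 4 4 (λ k₀ k₁ → X (addr (toℕ i) (toℕ j) k₁ 1) * (cc (cellAddr (toℕ i) (toℕ j) k₀ k₁) * X (addr (toℕ i) (toℕ j) k₀ 0))))
        (⅀-cong 4 λ k₁ _ → ≈-sym (⅀-*ˡ 4 _)))

    externalFields : sumV r (λ u → d u * spin (S u)) ≈ ⅀ r λ i → external i X
    externalFields = sum≈⅀ r λ i → sum≈⅀ r λ j → ≈-trans
      (sum≈⅀ 4 λ k → sum≈⅀ {g = λ l → X (addr (toℕ i) (toℕ j) (toℕ k) l) * dd (addr (toℕ i) (toℕ j) (toℕ k) l)} 2 λ l →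
        ≈-trans (*-comm _ _) (*-cong (X-at i j k l) (at {dd} (holds-d (i , j , k , l)) (vertexIndex≡addr i j k l))))
      (≈-trans (⅀-cong 4 λ k _ → ⅀-2 (λ l → X (addr (toℕ i) (toℕ j) k l) * dd (addr (toℕ i) (toℕ j) k l))) (≈-sym (⅀-+ 4)))

    interior-split : ∀ i → interior i X ≈ external i X + (horizontal i X + inner i X)
    interior-split i = ≈-trans (⅀-cong r λ j _ → ≈-trans (+-congˡ (≈-trans (⅀-cong 4 λ k _ →
        ≈-trans (distribˡ _ _ _) (+-congˡ (distribˡ _ _ _))) (≈-trans (≈-sym (⅀-+ 4)) (+-congˡ (≈-sym (⅀-+ 4)))))) (≈-sym (+-assoc _ _ _)))
      (≈-trans (≈-sym (⅀-+ r)) (+-congˡ (≈-sym (⅀-+ r))))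

    H≈energy : H c d S ≈ energy X
    H≈energy = ≈-trans (+-cong (+-cong (+-cong verticalEdges horizontalEdges) innerEdges) externalFields) (≈-sym (begin
      energy X
        ≈⟨ ⅀-cong r (λ i _ → ≈-trans (row-split i X) (+-congˡ (interior-split i))) ⟩
      (⅀ r λ i → vertical i X + (external i X + (horizontal i X + inner i X)))
        ≈⟨ ⅀-+ r ⟨
      V + (⅀ r λ i → external i X + (horizontal i X + inner i X))
        ≈⟨ +-congˡ (⅀-+ r) ⟨
      V + (D + (⅀ r λ i → horizontal i X + inner i X))
        ≈⟨ +-congˡ (+-congˡ (⅀-+ r)) ⟨
      V + (D + (B + C))   ≈⟨ +-congˡ (+-comm _ _) ⟩
      V + ((B + C) + D)   ≈⟨ +-assoc _ _ _ ⟨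
      (V + (B + C)) + D   ≈⟨ +-congʳ (+-assoc _ _ _) ⟨
      ((V + B) + C) + D   ∎))
      where
      V = ⅀ r λ i → vertical i X
      B = ⅀ r λ i → horizontal i X
      C = ⅀ r λ i → inner i X
      D = ⅀ r λ i → external i X

-- Dynamic programming over a sliding window of sites

-- The table is indexed by the number `u` of remaining sites and the forward pass by the number `t`
-- of sites done. These two lemmas convert between the counts.
∸-suc : ∀ {m n} → m ℕ.< n → n ∸ m ≡ suc (n ∸ suc m)
∸-suc {m} {n} m<n = trans (cong (_∸ m) (sym (ℕ.suc-pred n {{ℕ.>-nonZero (ℕ.≤-trans (s≤s z≤n) m<n)}})))
  (trans (ℕ.+-∸-assoc 1 (ℕ.<⇒≤pred m<n)) (cong suc (pred∸ n m)))
  where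
  pred∸ : ∀ n m → ℕ.pred n ∸ m ≡ n ∸ suc m
  pred∸ zero    zero    = refl
  pred∸ zero    (suc m) = refl
  pred∸ (suc n) m       = refl

∸-∸ : ∀ {m n} → m ℕ.< n → n ∸ suc (n ∸ suc m) ≡ m
∸-∸ {m} {n} m<n = trans (cong (n ∸_) (sym (∸-suc m<n))) (ℕ.m∸[m∸n]≡n (ℕ.<⇒≤ m<n))

-- An abstract setting: `T` sites are visited in order, site `t` sits at address `v t` and has field
-- `F t`, addresses below `lo` are frozen, and `b` spins are remembered. The geometry of a strip
-- enters only later, through the hypotheses `inj`, `above` and `local`.
module Window {a ℓ} (ℝ : Reals a ℓ) (T b′ lo : ℕ) (v : ℕ → ℕ)
              (F : ℕ → (ℕ → Reals.Carrier ℝ) → Reals.Carrier ℝ) where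
  open Reals ℝ
  open OrderedField ℝ
  open import Relation.Binary.Reasoning.Setoid setoid

  b P : ℕ
  b = suc b′
  P = 2 ℕ.^ b

  spinᵇ : Bool → Carrier
  spinᵇ true  = 1#
  spinᵇ false = - 1#

  spinᵇ-IsSpin : ∀ x → IsSpin (spinᵇ x)
  spinᵇ-IsSpin true  = inj₁ ≈-refl
  spinᵇ-IsSpin false = inj₂ ≈-refl

  -- The program adds or subtracts a field instead of multiplying it by a spin; this mirrors it
  -- literally.
  signed : Bool → Carrier → Carrier
  signed true  x = x
  signed false x = - x

  spinᵇ-* : ∀ x y → spinᵇ x * y ≈ signed x y
  spinᵇ-* true  y = *-identityˡ y
  spinᵇ-* false y = -1*x≈-x y

  fromSpin : ∀ {x} → IsSpin x → ∃ λ c → x ≈ spinᵇ c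
  fromSpin (inj₁ e) = true , e
  fromSpin (inj₂ e) = false , e

  Agree : (X Y : ℕ → Carrier) → Set ℓ
  Agree X Y = ∀ z → z ℕ.< lo → X z ≈ Y z

  -- Digit m of the window is the spin of site t ∸ 1 ∸ m.
  Matches : ℕ → (ℕ → Bool) → (ℕ → Carrier) → Set ℓ
  Matches t β X = ∀ m → m ℕ.< b → m ℕ.< t → X (v (t ∸ suc m)) ≈ spinᵇ (β m)

  Matches-push : ∀ t β X x → Matches t β X → X (v t) ≈ spinᵇ x → Matches (suc t) (push x β) X
  Matches-push t β X x h e zero    _  _   = e
  Matches-push t β X x h e (suc m) m< m<t = h m (ℕ.<-trans (ℕ.n<1+n m) m<) (s≤s⁻¹ m<t)

  next : (ℕ → Bool) → ℕ
  next β = dbl (code b′ β)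

  option : (W : ℕ → Carrier) → ℕ → (ℕ → Bool) → Carrier → Bool → Carrier
  option W u β f x = W (u ℕ.* P ℕ.+ (next β ℕ.+ weight x 1)) + signed x f

  record IsMin (w x y : Carrier) : Set ℓ where
    field
      ≤ˡ : w ≤ x
      ≤ʳ : w ≤ y
      ≥  : (x ≤ w) ⊎ (y ≤ w)
  open IsMin public

  -- W holds, at index u * P + s, the least energy of the last u sites given the window s.
  Layer : (W X₀ : ℕ → Carrier) → ℕ → Set (a ⊔ ℓ)
  Layer W X₀ u = ∀ β X → Agree X X₀ → Matches (T ∸ suc u) β X →
    let f = F (T ∸ suc u) X in
    IsMin (W (suc u ℕ.* P ℕ.+ code b β)) (option W u β f false) (option W u β f true)

  energyBelow : ℕ → (ℕ → Carrier) → Carrier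
  energyBelow t X = ⅀ t λ s → X (v s) * F s X

  tail : ℕ → (ℕ → Carrier) → Carrier
  tail zero    X = 0#
  tail (suc u) X = X (v (T ∸ suc u)) * F (T ∸ suc u) X + tail u X

  tail-total : ∀ u X → u ℕ.≤ T → energyBelow (T ∸ u) X + tail u X ≈ energyBelow T X
  tail-total zero    X _ = +-identityʳ _
  tail-total (suc u) X u<T = begin
    energyBelow (T ∸ suc u) X + (e + tail u X)  ≈⟨ +-assoc _ _ _ ⟨
    energyBelow (T ∸ suc u) X + e + tail u X    ≈⟨ +-congʳ (⅀-suc (T ∸ suc u)) ⟨
    energyBelow (suc (T ∸ suc u)) X + tail u X  ≈⟨ +-congʳ (≈-reflexive (cong (λ t → energyBelow t X) (∸-suc u<T))) ⟨
    energyBelow (T ∸ u) X + tail u X            ≈⟨ tail-total u X (ℕ.<⇒≤ u<T) ⟩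
    energyBelow T X                             ∎
    where e = X (v (T ∸ suc u)) * F (T ∸ suc u) X

  Spins : ℕ → (ℕ → Carrier) → Set ℓ
  Spins t X = ∀ s → s ℕ.< t → IsSpin (X (v s))

  module _ (W X₀ : ℕ → Carrier) (layer₀ : ∀ s → s ℕ.< P → W s ≈ 0#) (layers : ∀ u → u ℕ.< T → Layer W X₀ u) where

    -- The table entry is at most the option belonging to the spin that `X` itself gives to the next
    -- site, and induction bounds what follows. Thus the table undercuts every continuation.
    lower-bound : ∀ u → u ℕ.≤ T → ∀ X β → Agree X X₀ → Spins T X → Matches (T ∸ u) β X →
      W (u ℕ.* P ℕ.+ code b β) ≤ tail u X
    lower-bound zero    _   X β agr sp mt = ≤-reflexive (layer₀ _ (code<2^ b β))
    lower-bound (suc u) u<T X β agr sp mt = go (fromSpin (sp t t<T))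
      where
      t = T ∸ suc u
      t<T : t ℕ.< T
      t<T = subst (ℕ._≤ T) (∸-suc u<T) (ℕ.m∸n≤m T u)
      f = F t X
      min = layers u u<T β X agr mt
      ≤option : ∀ x → W (suc u ℕ.* P ℕ.+ code b β) ≤ option W u β f x
      ≤option true  = ≤ʳ min
      ≤option false = ≤ˡ min
      go : (∃ λ x → X (v t) ≈ spinᵇ x) → W (suc u ℕ.* P ℕ.+ code b β) ≤ X (v t) * f + tail u X
      go (x , e) = ≤-trans (≤option x) (≤-respʳ-≈ (≈-trans (+-comm _ _) (+-congʳ (≈-sym (≈-trans (*-congʳ e) (spinᵇ-* x f)))))
        (+-monoˡ-≤ (signed x f) (subst (λ n → W (u ℕ.* P ℕ.+ n) ≤ tail u X) (code-push b′ x β)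
          (lower-bound u (ℕ.<⇒≤ u<T) X (push x β) agr sp
            (subst (λ n → Matches n (push x β) X) (sym (∸-suc u<T)) (Matches-push t β X x mt e))))))

    -- `greedy` says that the energy spent plus the promised remainder never exceeds the root entry.
    -- One inequality is enough, since `lower-bound` places the root entry below every competitor.
    record Forward (t s : ℕ) (X : ℕ → Carrier) : Set (a ⊔ ℓ) where
      field
        digits  : ℕ → Bool
        coded   : code b digits ≡ s
        matches : Matches t digits X
        agree   : Agree X X₀
        spins   : Spins t X
        greedy  : energyBelow t X + W ((T ∸ t) ℕ.* P ℕ.+ s) ≤ W (T ℕ.* P ℕ.+ 0)

    forward-start : Forward 0 0 X₀
    forward-start = record
      -- Before the first site no digit of the window is constrained, so the root can be read at
      -- code 0.
      { digits = λ _ → false ; coded = code-false b ; matches = λ _ _ () ; agree = λ _ _ → ≈-refl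
      ; spins = λ _ () ; greedy = ≤-reflexive (≈-trans (+-congʳ ⅀-0) (+-identityˡ _)) }
      where
      code-false : ∀ n → code n (λ _ → false) ≡ 0
      code-false zero    = refl
      code-false (suc n) = trans (ℕ.+-identityʳ _) (code-false n)

    forward-end : ∀ s X → Forward T s X → Spins T X × (∀ Z → Agree Z X₀ → Spins T Z → energyBelow T X ≤ energyBelow T Z)
    forward-end s X fw = spins , λ Z agr sp → ≤-trans upper (≤-respʳ-≈ (total-tail Z)
        (subst (λ n → W (T ℕ.* P ℕ.+ n) ≤ tail T Z) (Forward.coded forward-start)
          (lower-bound T ℕ.≤-refl Z (λ _ → false) agr sp (subst (λ n → Matches n (λ _ → false) Z) (sym (ℕ.n∸n≡0 T)) (λ _ _ ())))))
      where
      open Forward fw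
      upper : energyBelow T X ≤ W (T ℕ.* P ℕ.+ 0)
      upper = ≤-respˡ-≈ (≈-trans (+-congˡ (≈-trans (≈-reflexive (cong (λ n → W (n ℕ.* P ℕ.+ s)) (ℕ.n∸n≡0 T)))
        (layer₀ s (subst (ℕ._< P) coded (code<2^ b digits))))) (+-identityʳ _)) greedy
      total-tail : ∀ Z → tail T Z ≈ energyBelow T Z
      total-tail Z = ≈-trans (≈-sym (≈-trans (+-congʳ (≈-trans (≈-reflexive (cong (λ n → energyBelow n Z) (ℕ.n∸n≡0 T))) ⅀-0)) (+-identityˡ _)))
        (tail-total T Z ℕ.≤-refl)

    module _ (inj : ∀ {s t} → s ℕ.< T → t ℕ.< T → v s ≡ v t → s ≡ t)
             (above : ∀ {t} → t ℕ.< T → lo ℕ.≤ v t)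
             (local : ∀ {t} → t ℕ.< T → ∀ X Y → Agree X Y →
                      (∀ s → s ℕ.< t → t ℕ.≤ s ℕ.+ b → X (v s) ≈ Y (v s)) → F t X ≈ F t Y) where

      module _ {t} (t<T : t ℕ.< T) (X X′ : ℕ → Carrier) (same : ∀ z → z ≢ v t → X′ z ≈ X z) where

        private
          before : ∀ s → s ℕ.< t → X′ (v s) ≈ X (v s)
          before s s<t = same (v s) (λ e → ℕ.<⇒≢ s<t (inj (ℕ.<-trans s<t t<T) t<T e))

          outer : Agree X′ X
          outer z z<lo = same z (ℕ.<⇒≢ (ℕ.≤-trans z<lo (above t<T)))

        -- Fields read frozen addresses and strictly earlier sites only. Writing site `t` therefore
        -- preserves its own field and all earlier ones, and the energy already summed up stays
        -- valid.
        field-unchanged : ∀ s → s ℕ.≤ t → F s X′ ≈ F s X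
        field-unchanged s s≤t = local (ℕ.≤-<-trans s≤t t<T) X′ X outer (λ q q<s _ → before q (ℕ.<-≤-trans q<s s≤t))

        energyBelow-step : ∀ {x} → X′ (v t) ≈ spinᵇ x →
          energyBelow (suc t) X′ ≈ energyBelow t X + signed x (F t X)
        energyBelow-step {x} e = ≈-trans (⅀-suc t) (+-cong
          (⅀-cong t (λ s s<t → *-cong (before s s<t) (field-unchanged s (ℕ.<⇒≤ s<t))))
          (≈-trans (*-cong e (field-unchanged t ℕ.≤-refl)) (spinᵇ-* x _)))

        forward-step : ∀ {s x} (fw : Forward t s X) → X′ (v t) ≈ spinᵇ x →
          (∀ y → option W (T ∸ suc t) (Forward.digits fw) (F t X) x ≤ option W (T ∸ suc t) (Forward.digits fw) (F t X) y) →
          Forward (suc t) (next (Forward.digits fw) ℕ.+ weight x 1) X′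
        forward-step {s} {x} fw e best = record
          { digits  = push x digits
          ; coded   = code-push b′ x digits
          ; matches = Matches-push t digits X′ x matches′ e
          ; agree   = λ z z<lo → ≈-trans (outer z z<lo) (agree z z<lo)
          ; spins   = spins′
          ; greedy  = ≤-trans (≤-respˡ-≈ (≈-sym (≈-trans (+-congʳ (energyBelow-step {x} e)) (≈-trans (+-assoc _ _ _) (+-congˡ (+-comm _ _)))))
                        (+-mono-≤ ≤-refl chosen)) greedy
          }
          where
          open Forward fw
          u = T ∸ suc t
          f = F t X
          matches′ : Matches t digits X′
          matches′ m m<b m<t = ≈-trans (before _ (ℕ.∸-monoʳ-< {t} {suc m} {0} (s≤s z≤n) m<t)) (matches m m<b m<t)
          spins′ : Spins (suc t) X′
          spins′ q q<st with q ℕ.≟ t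
          ... | yes refl = IsSpin-resp (≈-sym e) (spinᵇ-IsSpin x)
          ... | no q≢t = let q<t = ℕ.≤∧≢⇒< (s≤s⁻¹ q<st) q≢t in IsSpin-resp (≈-sym (before q q<t)) (spins q q<t)
          u<T : u ℕ.< T
          u<T = subst (ℕ._≤ T) (∸-suc t<T) (ℕ.m∸n≤m T t)
          min : IsMin (W ((T ∸ t) ℕ.* P ℕ.+ s)) (option W u digits f false) (option W u digits f true)
          min = subst₂ (λ n n′ → IsMin (W (n ℕ.* P ℕ.+ n′)) (option W u digits f false) (option W u digits f true))
            (sym (∸-suc t<T)) coded
            (subst (λ n → IsMin (W (suc u ℕ.* P ℕ.+ code b digits)) (option W u digits (F n X) false) (option W u digits (F n X) true)) (∸-∸ t<T)
              (layers u u<T digits X agree (subst (λ n → Matches n digits X) (sym (∸-∸ t<T)) matches)))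
          chosen : option W u digits f x ≤ W ((T ∸ t) ℕ.* P ℕ.+ s)
          chosen with ≥ min
          ... | inj₁ le = ≤-trans (best false) le
          ... | inj₂ le = ≤-trans (best true) le

-- The program and its correctness

infix 3 _≔_ _≔ᴿ_

var : ℕ → NExp
var x = N x [ lit 0 ]

varᴿ : ℕ → RExp
varᴿ x = R x [ lit 0 ]

_≔_ : ℕ → NExp → Program
x ≔ e = N x [ lit 0 ]≔ e

_≔ᴿ_ : ℕ → RExp → Program
x ≔ᴿ e = R x [ lit 0 ]≔ e

doubled : NExp → NExp
doubled e = e ⊕ e

-- Arrays used as scalars hold their value in cell 0.
#r #out #L #o #i₀ #h #b #pow #T #base #g #j #i #k #V #N₀ #N₁ #N₂ #N₃ #N₄ #t #u #s #y #m #n #off #z #N : ℕ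
#r = 0 ; #out = 1 ; #L = 2 ; #o = 3 ; #i₀ = 4 ; #h = 5 ; #b = 6 ; #pow = 7 ; #T = 8 ; #base = 9 ; #g = 10
#j = 11 ; #i = 12 ; #k = 13 ; #V = 14 ; #N₀ = 15 ; #N₁ = 16 ; #N₂ = 17 ; #N₃ = 18 ; #N₄ = 19 ; #t = 20
#u = 21 ; #s = 22 ; #y = 23 ; #m = 24 ; #n = 25 ; #off = 26 ; #z = 27 ; #N = 28

#ε #d #c₀ #c₁ #c₀₁ #X #W #val #best #F #D #C₀ #C₁ #C₂ #C₃ #C₄ #sp #w₀ #w₁ #sum : ℕ
#ε = 0 ; #d = 1 ; #c₀ = 2 ; #c₁ = 3 ; #c₀₁ = 4 ; #X = 5 ; #W = 6 ; #val = 7 ; #best = 8 ; #F = 9 ; #D = 10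
#C₀ = 11 ; #C₁ = 12 ; #C₂ = 13 ; #C₃ = 14 ; #C₄ = 15 ; #sp = 16 ; #w₀ = 17 ; #w₁ = 18 ; #sum = 19

by-computation : ∀ {m n} {_ : T (m ℕ.≤ᵇ n)} → m ℕ.≤ n
by-computation {m} {n} {p} = ℕ.≤ᵇ⇒≤ m n p

test-true : ∀ {p} {P : Set p} (d : Dec P) → ⌊ d ⌋ ≡ true → P
test-true (yes p) _ = p

test-false : ∀ {p} {P : Set p} (d : Dec P) → ⌊ d ⌋ ≡ false → ¬ P
test-false (no n) _ = n

-- Writes the window `#y` into `#X`, so that fields can be evaluated on `#X` directly. The most
-- significant digit, which belongs to the oldest site, comes first; digits that would precede site
-- 0 are skipped.
decode : Program
decode = for #n (var #b) (
  (#m ≔ var #b ⊖ (var #n ⊕ lit 1)) ⨾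
  (if N #pow [ var #m ] ≤ᴺ var #y
   then ((#y ≔ var #y ⊖ N #pow [ var #m ]) ⨾ (#sp ≔ᴿ 𝟏))
   else (#sp ≔ᴿ 𝟎 ⊟ 𝟏)) ⨾
  (if var #m ⊕ lit 1 ≤ᴺ var #t
   then (R #X [ N #V [ var #t ⊖ (var #m ⊕ lit 1) ] ]≔ varᴿ #sp)
   else skip))

module Assign {a ℓ} (ℝ : Reals a ℓ) where
  open Reals ℝ
  open Semantics ℝ
  open Logic ℝ

  withN : State → ℕ → ℕ → ℕ → State
  withN σ x i v = ⟪ write (nats σ) x i v , reals σ ⟫

  withR : State → ℕ → ℕ → Carrier → State
  withR σ x i v = ⟪ nats σ , write (reals σ) x i v ⟫

  private variable
    q : Level
    x i : ℕ
    e f : NExp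
    g : RExp
    σ : State
    P : Program
    B : ℕ

  assignN : ∀ {v} {Q : State → Set q} → ⟦ e ⟧ᴺ σ ≡ i → ⟦ f ⟧ᴺ σ ≡ v → Q (withN σ x i v) →
    Runs (N x [ e ]≔ f) σ (1 ℕ.+ costᴺ e ℕ.+ costᴺ f) Q
  assignN refl refl = runs-N≔

  assignR : ∀ {v} {Q : State → Set q} → ⟦ e ⟧ᴺ σ ≡ i → ⟦ g ⟧ᴿ σ ≡ v → Q (withR σ x i v) →
    Runs (R x [ e ]≔ g) σ (1 ℕ.+ costᴺ e ℕ.+ costᴿ g) Q
  assignR refl refl = runs-R≔

  assignN⨾ : ∀ {v} {Q : State → Set q} → ⟦ e ⟧ᴺ σ ≡ i → ⟦ f ⟧ᴺ σ ≡ v → Runs P (withN σ x i v) B Q →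
    Runs ((N x [ e ]≔ f) ⨾ P) σ ((1 ℕ.+ costᴺ e ℕ.+ costᴺ f) ℕ.+ B) Q
  assignN⨾ refl refl = N≔⨾

  assignR⨾ : ∀ {v} {Q : State → Set q} → ⟦ e ⟧ᴺ σ ≡ i → ⟦ g ⟧ᴿ σ ≡ v → Runs P (withR σ x i v) B Q →
    Runs ((R x [ e ]≔ g) ⨾ P) σ ((1 ℕ.+ costᴺ e ℕ.+ costᴿ g) ℕ.+ B) Q
  assignR⨾ refl refl = R≔⨾

module Decoding {a ℓ} (ℝ : Reals a ℓ) where
  open Reals ℝ
  open Semantics ℝ
  open Logic ℝ
  open For ℝ
  open Assign ℝ
  open OrderedField ℝ

  0-1≈-1 : 0# - 1# ≈ - 1#
  0-1≈-1 = +-identityˡ _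

  -- The body is bounded by 60. With `costᴺ (var #b)` equal to 2, `forBound` adds 13 per round and
  -- 10 once.
  decodeTime : ℕ → ℕ
  decodeTime b = b ℕ.* 73 ℕ.+ 10

  Powers : State → ℕ → Set
  Powers σ b = ∀ m → m ℕ.≤ b → nats σ #pow m ≡ 2 ℕ.^ m

  module _ (T b′ lo : ℕ) (v : ℕ → ℕ) (F : ℕ → (ℕ → Carrier) → Carrier) where
    open Window ℝ T b′ lo v F

    module _ (inj : ∀ {s t} → s ℕ.< T → t ℕ.< T → v s ≡ v t → s ≡ t)
             (above : ∀ {t} → t ℕ.< T → lo ℕ.≤ v t) where

      runs-decode : ∀ σ t β → nats σ #b 0 ≡ b → Powers σ b → (∀ s → nats σ #V s ≡ v s) → nats σ #t 0 ≡ t → t ℕ.≤ T →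
        nats σ #y 0 ≡ code b β →
        Runs decode σ (decodeTime b) (λ τ → Matches t β (reals τ #X) × Agree (reals τ #X) (reals σ #X))
      runs-decode σ t β b≡ pow v≡ t≡ t≤T y≡ = runs-⇒
        (runs-for #n (var #b) _ Inv b 60 σ refl (λ τ fr → trans (natsKept fr #b refl 0) b≡) step start)
        ℕ.≤-refl
        (λ { τ fr (_ , m≡ , agr) → (λ m m<b m<t → m≡ m (ℕ.≤-trans (ℕ.≤-reflexive (ℕ.n∸n≡0 b)) z≤n) m<b m<t) , agr })
        where
        Inv : ℕ → State → Set ℓ
        Inv k τ = (nats τ #y 0 ≡ code (b ∸ k) β)
          × (∀ m → b ∸ k ℕ.≤ m → m ℕ.< b → m ℕ.< t → reals τ #X (v (t ∸ suc m)) ≈ spinᵇ (β m))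
          × Agree (reals τ #X) (reals σ #X)

        start : Inv 0 (setN σ #n 0)
        start = y≡ , (λ m b≤m m<b _ → ⊥-elim (ℕ.<⇒≱ m<b b≤m)) , (λ _ _ → ≈-refl)

        step : ∀ k σ′ → k ℕ.< b → nats σ′ #n 0 ≡ k → Frame decode σ σ′ → Inv k σ′ →
          Runs _ σ′ 60 (λ τ → Inv (suc k) (setN τ #n (suc k)))
        step k σ′ k<b k≡ fr (y≡′ , done , agr) = runs-≤
          (assignN⨾ refl (trans (cong₂ _∸_ (trans (natsKept fr #b refl 0) b≡) (trans (cong (ℕ._+ 1) k≡) (ℕ.+-comm k 1))) refl)
          (digit ⨟ λ { τ fr′ (yτ , spτ) → store τ fr′ yτ spτ }))
          by-computation
          where
          M = b ∸ suc k
          σ₁ = withN σ′ #m 0 M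
          M<b : M ℕ.< b
          M<b = ℕ.∸-monoʳ-< {b} {suc k} {0} (s≤s z≤n) k<b
          powM : nats σ′ #pow M ≡ 2 ℕ.^ M
          powM = trans (natsKept fr #pow refl M) (pow M (ℕ.<⇒≤ M<b))
          yM : nats σ′ #y 0 ≡ code (suc M) β
          yM = trans y≡′ (cong (λ n → code n β) (∸-suc k<b))

          Digit : State → Set _
          Digit τ = (nats τ #y 0 ≡ code M β) × (reals τ #sp 0 ≈ spinᵇ (β M))

          digit : Runs _ σ₁ _ Digit
          digit = runs-if {B₀ = 12}
            (λ e → let p = code-top-true M β (subst₂ ℕ._≤_ powM yM (test-true (_ ℕ.≤? _) e)) in
              runs-≤ (assignN⨾ refl (trans (cong₂ _∸_ yM powM) (proj₂ p))
                (assignR refl refl (refl , ≈-reflexive (cong spinᵇ (sym (proj₁ p)))))) by-computation)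
            (λ e → let p = code-top-false M β (λ le → test-false (_ ℕ.≤? _) e (subst₂ ℕ._≤_ (sym powM) (sym yM) le)) in
              runs-≤ (assignR refl refl (trans yM (proj₂ p) , ≈-trans 0-1≈-1 (≈-reflexive (cong spinᵇ (sym (proj₁ p)))))) by-computation)

          store : ∀ τ → Frame _ σ₁ τ → nats τ #y 0 ≡ code M β → reals τ #sp 0 ≈ spinᵇ (β M) →
            Runs _ τ _ (λ τ → Inv (suc k) (setN τ #n (suc k)))
          store τ fr′ yτ spτ = runs-if {B₀ = 11}
            (λ e → write-spin (subst₂ ℕ._≤_ (trans (cong (ℕ._+ 1) mτ) (ℕ.+-comm M 1)) tτ (test-true (_ ℕ.≤? _) e)))
            (λ e → no-site (λ M<t → test-false (_ ℕ.≤? _) e (subst₂ ℕ._≤_ (sym (trans (cong (ℕ._+ 1) mτ) (ℕ.+-comm M 1))) (sym tτ) M<t)))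
            where
            mτ : nats τ #m 0 ≡ M
            mτ = natsKept fr′ #m refl 0
            tτ : nats τ #t 0 ≡ t
            tτ = trans (natsKept fr′ #t refl 0) (trans (natsKept fr #t refl 0) t≡)
            Xτ : ∀ z → reals τ #X z ≡ reals σ′ #X z
            Xτ = realsKept fr′ #X refl
            Vτ : ∀ s → nats τ #V s ≡ v s
            Vτ s = trans (natsKept fr′ #V refl s) (trans (natsKept fr #V refl s) (v≡ s))

            no-site : ¬ (M ℕ.< t) → Runs skip τ 11 (λ τ → Inv (suc k) (setN τ #n (suc k)))
            no-site M≮t = runs-≤ (runs-skip (yτ , done′ , λ z z<lo → ≈-trans (≈-reflexive (Xτ z)) (agr z z<lo))) by-computation
              where
              done′ : ∀ m → M ℕ.≤ m → m ℕ.< b → m ℕ.< t → reals τ #X (v (t ∸ suc m)) ≈ spinᵇ (β m)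
              done′ m M≤m m<b m<t = ⊥-elim (M≮t (ℕ.≤-<-trans M≤m m<t))

            write-spin : M ℕ.< t → Runs (R #X [ N #V [ var #t ⊖ (var #m ⊕ lit 1) ] ]≔ varᴿ #sp) τ 11 (λ τ → Inv (suc k) (setN τ #n (suc k)))
            write-spin M<t = runs-≤ (assignR idx refl
              (yτ , done′ , λ z z<lo → ≈-trans (≈-reflexive (trans (write-other (reals τ) #X _ (λ e → ℕ.<⇒≱ z<lo (subst (lo ℕ.≤_) e (above s<T)))) (Xτ z))) (agr z z<lo)))
              by-computation
              where
              s₀ = t ∸ suc M
              s<T : s₀ ℕ.< T
              s<T = ℕ.<-≤-trans (ℕ.∸-monoʳ-< {t} {suc M} {0} (s≤s z≤n) M<t) t≤T
              idx : nats τ #V (nats τ #t 0 ∸ (nats τ #m 0 ℕ.+ 1)) ≡ v s₀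
              idx = trans (cong (nats τ #V) (cong₂ _∸_ tτ (trans (cong (ℕ._+ 1) mτ) (ℕ.+-comm M 1)))) (Vτ s₀)
              done′ : ∀ m → M ℕ.≤ m → m ℕ.< b → m ℕ.< t →
                write (reals τ) #X (v s₀) (reals τ #sp 0) #X (v (t ∸ suc m)) ≈ spinᵇ (β m)
              done′ m M≤m m<b m<t with m ℕ.≟ M
              ... | yes refl = ≈-trans (≈-reflexive (write-same (reals τ) #X {v s₀} _ refl)) spτ
              ... | no m≢M = ≈-trans (≈-reflexive (trans (write-other (reals τ) #X _ distinct) (Xτ _)))
                    (done m (subst (ℕ._≤ m) (sym (∸-suc k<b)) M<m) m<b m<t)
                where
                M<m : M ℕ.< m
                M<m = ℕ.≤∧≢⇒< M≤m (λ e → m≢M (sym e))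
                sm<T : t ∸ suc m ℕ.< T
                sm<T = ℕ.<-≤-trans (ℕ.∸-monoʳ-< {t} {suc m} {0} (s≤s z≤n) m<t) t≤T
                distinct : v s₀ ≢ v (t ∸ suc m)
                distinct e = ℕ.<⇒≢ (ℕ.∸-monoʳ-< {t} {suc m} {suc M} (s≤s M<m) m<t) (sym (inj s<T sm<T e))

-- A vertex has at most five earlier neighbours: four in its cell and one to the left, or only one
-- above. Absent neighbours get coefficient 0, whatever their stored index, so one straight-line
-- expression serves all sites.
siteFieldExp : RExp
siteFieldExp = R #D [ var #t ] ⊞ (nb #C₀ #N₀ ⊞ (nb #C₁ #N₁ ⊞ (nb #C₂ #N₂ ⊞ (nb #C₃ #N₃ ⊞ nb #C₄ #N₄))))
  where
  nb : ℕ → ℕ → RExp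
  nb c n = R c [ var #t ] ⊠ R #X [ N n [ var #t ] ]

-- Sets F to the field at site t, and w₀, w₁ to the costs of continuing with spin -1, +1 from the window s.
options : Program
options =
  (#F ≔ᴿ siteFieldExp) ⨾
  -- Removes the oldest spin, the top digit of `#s`. The doubling that follows makes room for the
  -- new spin.
  (if N #pow [ var #b ⊖ lit 1 ] ≤ᴺ var #s
   then (#y ≔ var #s ⊖ N #pow [ var #b ⊖ lit 1 ])
   else (#y ≔ var #s)) ⨾
  (#y ≔ doubled (var #y)) ⨾
  (#w₀ ≔ᴿ R #W [ var #off ⊕ (var #y ⊕ lit 0) ] ⊟ varᴿ #F) ⨾
  (#w₁ ≔ᴿ R #W [ var #off ⊕ (var #y ⊕ lit 1) ] ⊞ varᴿ #F)

tableEntry : Program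
tableEntry =
  (#y ≔ var #s) ⨾
  decode ⨾
  options ⨾
  (if varᴿ #w₁ ≤ᴿ varᴿ #w₀
   then (R #W [ N #pow [ var #b ] ⊕ var #off ⊕ var #s ]≔ varᴿ #w₁)
   else (R #W [ N #pow [ var #b ] ⊕ var #off ⊕ var #s ]≔ varᴿ #w₀))

-- `#off` carries the offset `u * P` of the current table row. It is kept up by addition because
-- indices cannot be multiplied.
tableLayer : Program
tableLayer =
  (#t ≔ var #T ⊖ (var #u ⊕ lit 1)) ⨾
  for #s (N #pow [ var #b ]) tableEntry ⨾
  (#off ≔ N #pow [ var #b ] ⊕ var #off)

table : Program
table =
  for #s (N #pow [ var #b ]) (R #W [ var #s ]≔ 𝟎) ⨾
  (#off ≔ lit 0) ⨾
  for #u (var #T) tableLayer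

-- The choice is recomputed from the table instead of being stored with it. Since `#X` has meanwhile
-- served as scratch space for decoding, each site is rewritten before a later field reads it.
forwardStep : Program
forwardStep =
  (#off ≔ var #off ⊖ N #pow [ var #b ]) ⨾
  options ⨾
  (if varᴿ #w₁ ≤ᴿ varᴿ #w₀
   then ((R #X [ N #V [ var #t ] ]≔ 𝟏) ⨾ (#val ≔ᴿ varᴿ #val ⊞ varᴿ #F) ⨾ (#s ≔ var #y ⊕ lit 1))
   else ((R #X [ N #V [ var #t ] ]≔ 𝟎 ⊟ 𝟏) ⨾ (#val ≔ᴿ varᴿ #val ⊟ varᴿ #F) ⨾ (#s ≔ var #y ⊕ lit 0)))

forward : Program
forward = (#s ≔ lit 0) ⨾ for #t (var #T) forwardStep

touchesSites : Program → Bool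
touchesSites P =
  writesN P #b ∨ (writesN P #T ∨ (writesN P #pow ∨ (writesN P #V ∨ (writesR P #D ∨
  (writesR P #C₀ ∨ (writesR P #C₁ ∨ (writesR P #C₂ ∨ (writesR P #C₃ ∨ (writesR P #C₄ ∨
  (writesN P #N₀ ∨ (writesN P #N₁ ∨ (writesN P #N₂ ∨ (writesN P #N₃ ∨ writesN P #N₄)))))))))))))

module SiteField {a ℓ} (ℝ : Reals a ℓ) where
  open Reals ℝ
  open Semantics ℝ
  open Logic ℝ
  open Decoding ℝ using (Powers)

  siteField : State → ℕ → (ℕ → Carrier) → Carrier
  siteField σ t X = reals σ #D t +
    (reals σ #C₀ t * X (nats σ #N₀ t) + (reals σ #C₁ t * X (nats σ #N₁ t) + (reals σ #C₂ t * X (nats σ #N₂ t) +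
    (reals σ #C₃ t * X (nats σ #N₃ t) + reals σ #C₄ t * X (nats σ #N₄ t)))))

  module _ (T b : ℕ) (v : ℕ → ℕ) (F : ℕ → (ℕ → Carrier) → Carrier) where

    SitesIn : State → Set a
    SitesIn σ = (nats σ #b 0 ≡ b) × (nats σ #T 0 ≡ T) × Powers σ b × (∀ s → nats σ #V s ≡ v s)
              × (∀ t X → siteField σ t X ≡ F t X)

    SitesIn-kept : ∀ P {σ τ} → touchesSites P ≡ false → Frame P σ τ → SitesIn σ → SitesIn τ
    SitesIn-kept P {σ} {τ} w fr (b≡ , T≡ , pow , v≡ , F≡) =
        trans (natsKept fr #b w-b 0) b≡
      , trans (natsKept fr #T w-T 0) T≡
      , (λ m m≤b → trans (natsKept fr #pow w-pow m) (pow m m≤b))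
      , (λ s → trans (natsKept fr #V w-V s) (v≡ s))
      , (λ t X → trans (cong₂ _+_ (realsKept fr #D w-D t)
          (cong₂ _+_ (nb X (realsKept fr #C₀ w-C₀ t) (natsKept fr #N₀ w-N₀ t))
          (cong₂ _+_ (nb X (realsKept fr #C₁ w-C₁ t) (natsKept fr #N₁ w-N₁ t))
          (cong₂ _+_ (nb X (realsKept fr #C₂ w-C₂ t) (natsKept fr #N₂ w-N₂ t))
          (cong₂ _+_ (nb X (realsKept fr #C₃ w-C₃ t) (natsKept fr #N₃ w-N₃ t))
                       (nb X (realsKept fr #C₄ w-C₄ t) (natsKept fr #N₄ w-N₄ t))))))) (F≡ t X))
      where
      nb : ∀ X {c c′ n n′} → c ≡ c′ → n ≡ n′ → c * X n ≡ c′ * X n′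
      nb X refl refl = refl
      w-b = ∨-falseˡ {writesN P #b} w
      w₁ = ∨-falseʳ {writesN P #b} w
      w-T = ∨-falseˡ {writesN P #T} w₁
      w₂ = ∨-falseʳ {writesN P #T} w₁
      w-pow = ∨-falseˡ {writesN P #pow} w₂
      w₃ = ∨-falseʳ {writesN P #pow} w₂
      w-V = ∨-falseˡ {writesN P #V} w₃
      w₄ = ∨-falseʳ {writesN P #V} w₃
      w-D = ∨-falseˡ {writesR P #D} w₄
      w₅ = ∨-falseʳ {writesR P #D} w₄
      w-C₀ = ∨-falseˡ {writesR P #C₀} w₅
      w₆ = ∨-falseʳ {writesR P #C₀} w₅
      w-C₁ = ∨-falseˡ {writesR P #C₁} w₆
      w₇ = ∨-falseʳ {writesR P #C₁} w₆
      w-C₂ = ∨-falseˡ {writesR P #C₂} w₇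
      w₈ = ∨-falseʳ {writesR P #C₂} w₇
      w-C₃ = ∨-falseˡ {writesR P #C₃} w₈
      w₉ = ∨-falseʳ {writesR P #C₃} w₈
      w-C₄ = ∨-falseˡ {writesR P #C₄} w₉
      w₁₀ = ∨-falseʳ {writesR P #C₄} w₉
      w-N₀ = ∨-falseˡ {writesN P #N₀} w₁₀
      w₁₁ = ∨-falseʳ {writesN P #N₀} w₁₀
      w-N₁ = ∨-falseˡ {writesN P #N₁} w₁₁
      w₁₂ = ∨-falseʳ {writesN P #N₁} w₁₁
      w-N₂ = ∨-falseˡ {writesN P #N₂} w₁₂
      w₁₃ = ∨-falseʳ {writesN P #N₂} w₁₂
      w-N₃ = ∨-falseˡ {writesN P #N₃} w₁₃
      w-N₄ = ∨-falseʳ {writesN P #N₃} w₁₃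

module WindowProgram {a ℓ} (ℝ : Reals a ℓ) (T b′ lo : ℕ) (v : ℕ → ℕ)
    (F : ℕ → (ℕ → Reals.Carrier ℝ) → Reals.Carrier ℝ) where
  open Reals ℝ
  open Semantics ℝ
  open Logic ℝ
  open For ℝ
  open Assign ℝ
  open OrderedField ℝ
  open SiteField ℝ
  open Decoding ℝ
  open Window ℝ T b′ lo v F

  Sites : State → Set a
  Sites = SitesIn T b v F

  module _ (inj : ∀ {s t} → s ℕ.< T → t ℕ.< T → v s ≡ v t → s ≡ t)
           (above : ∀ {t} → t ℕ.< T → lo ℕ.≤ v t)
           (local : ∀ {t} → t ℕ.< T → ∀ X Y → Agree X Y →
                    (∀ s → s ℕ.< t → t ℕ.≤ s ℕ.+ b → X (v s) ≈ Y (v s)) → F t X ≈ F t Y) where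

    runs-options : ∀ σ t u β → Sites σ → nats σ #t 0 ≡ t → nats σ #s 0 ≡ code b β → nats σ #off 0 ≡ u ℕ.* P →
      Runs options σ 110 (λ τ → (reals τ #F 0 ≡ F t (reals σ #X)) × (nats τ #y 0 ≡ next β)
        × (reals τ #w₀ 0 ≡ option (reals σ #W) u β (F t (reals σ #X)) false)
        × (reals τ #w₁ 0 ≡ option (reals σ #W) u β (F t (reals σ #X)) true))
    runs-options σ t u β (b≡ , _ , pow , _ , F≡) t≡ s≡ off≡ = runs-≤
      (assignR⨾ {e = lit 0} refl f≡
        (drop ⨟ λ τ fr y≡ →
          assignN⨾ refl (cong dbl y≡)
          (assignR⨾ refl (cong₂ (λ w x → w - x) (W≡ τ fr y≡ 0) (realsKept fr #F refl 0))
          (assignR refl (cong₂ _+_ (W≡ τ fr y≡ 1) (realsKept fr #F refl 0))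
            (realsKept fr #F refl 0 , refl , refl , refl)))))
      by-computation
      where
      f = F t (reals σ #X)
      f≡ : siteField σ (nats σ #t 0) (reals σ #X) ≡ f
      f≡ = trans (F≡ (nats σ #t 0) (reals σ #X)) (cong (λ n → F n (reals σ #X)) t≡)
      σ₁ = withR σ #F 0 f
      pow≡ : nats σ #pow (nats σ #b 0 ∸ 1) ≡ 2 ℕ.^ b′
      pow≡ = trans (cong (λ n → nats σ #pow (n ∸ 1)) b≡) (pow b′ (ℕ.n≤1+n b′))
      drop : Runs _ σ₁ _ (λ τ → nats τ #y 0 ≡ code b′ β)
      drop = runs-if {B₀ = 12}
        (λ e → runs-≤ (assignN refl (cong₂ _∸_ s≡ pow≡)
          (proj₂ (code-top-true b′ β (subst₂ ℕ._≤_ pow≡ s≡ (test-true (_ ℕ.≤? _) e))))) by-computation)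
        (λ e → runs-≤ (assignN refl s≡
          (proj₂ (code-top-false b′ β (λ le → test-false (_ ℕ.≤? _) e (subst₂ ℕ._≤_ (sym pow≡) (sym s≡) le))))) by-computation)
      W≡ : ∀ τ → Frame _ σ₁ τ → nats τ #y 0 ≡ code b′ β → ∀ x →
        reals τ #W (nats τ #off 0 ℕ.+ (next β ℕ.+ x)) ≡ reals σ #W (u ℕ.* P ℕ.+ (next β ℕ.+ x))
      W≡ τ fr y≡ x = trans (realsKept fr #W refl _)
        (cong (λ n → reals σ #W (n ℕ.+ (next β ℕ.+ x))) (trans (natsKept fr #off refl 0) off≡))

    option-cong : ∀ (W W′ : ℕ → Carrier) u β {f f′} x → W (u ℕ.* P ℕ.+ (next β ℕ.+ weight x 1)) ≈ W′ (u ℕ.* P ℕ.+ (next β ℕ.+ weight x 1)) →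
      f ≈ f′ → option W u β f x ≈ option W′ u β f′ x
    option-cong W W′ u β true  e e′ = +-cong e e′
    option-cong W W′ u β false e e′ = +-cong e (-‿cong e′)

    IsMin-resp : ∀ {w w′ x x′ y y′} → w ≈ w′ → x ≈ x′ → y ≈ y′ → IsMin w x y → IsMin w′ x′ y′
    IsMin-resp {w} {w′} {x} {x′} {y} {y′} e ex ey m = record
      { ≤ˡ = ≤-resp₂ e ex (≤ˡ m) ; ≤ʳ = ≤-resp₂ e ey (≤ʳ m) ; ≥ = resp (≥ m) }
      where
      resp : (x ≤ w) ⊎ (y ≤ w) → (x′ ≤ w′) ⊎ (y′ ≤ w′)
      resp (inj₁ le) = inj₁ (≤-resp₂ ex e le)
      resp (inj₂ le) = inj₂ (≤-resp₂ ey e le)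

    Matches-field : ∀ {t} → t ℕ.< T → ∀ {β} X Y → Agree X Y → Matches t β X → Matches t β Y → F t X ≈ F t Y
    Matches-field {t} t<T {β} X Y agr mX mY = local t<T X Y agr λ s s<t t≤s+b →
      let m = t ∸ suc s
          m<t : m ℕ.< t
          m<t = ℕ.∸-monoʳ-< {t} {suc s} {0} (s≤s z≤n) s<t
          m<b : m ℕ.< b
          m<b = s≤s (ℕ.≤-trans (ℕ.∸-monoˡ-≤ (suc s) t≤s+b) (ℕ.≤-reflexive (trans (cong (_∸ suc s) (ℕ.+-suc s b′)) (ℕ.m+n∸m≡n (suc s) b′))))
      in subst (λ q → X (v q) ≈ Y (v q)) (∸-∸ s<t) (≈-trans (mX m m<b m<t) (≈-sym (mY m m<b m<t)))

    entryTime : ℕ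
    entryTime = b ℕ.* 73 ℕ.+ 160

    runs-tableEntry : ∀ σ t u β X₀ → Sites σ → t ℕ.< T → nats σ #t 0 ≡ t → nats σ #s 0 ≡ code b β → nats σ #off 0 ≡ u ℕ.* P →
      Agree (reals σ #X) X₀ →
      Runs tableEntry σ entryTime (λ τ → Agree (reals τ #X) X₀
        × (∀ z → suc u ℕ.* P ℕ.+ code b β ≢ z → reals τ #W z ≡ reals σ #W z)
        × (∀ X → Agree X X₀ → Matches t β X →
            IsMin (reals τ #W (suc u ℕ.* P ℕ.+ code b β)) (option (reals σ #W) u β (F t X) false) (option (reals σ #W) u β (F t X) true)))
    runs-tableEntry σ t u β X₀ sites@(b≡ , T≡ , pow , v≡ , F≡) t<T t≡ s≡ off≡ agr = runs-≤
      (assignN⨾ refl s≡ (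
        runs-decode T b′ lo v F inj above (withN σ #y 0 (code b β)) t β b≡ pow v≡ t≡ (ℕ.<⇒≤ t<T) refl ⨟ λ { τ fr (mt , agr′) →
        let sitesτ = SitesIn-kept T b v F decode refl fr sites
            agrτ : Agree (reals τ #X) X₀
            agrτ z z<lo = ≈-trans (agr′ z z<lo) (agr z z<lo)
        in
        runs-options τ t u β sitesτ (trans (natsKept fr #t refl 0) t≡) (trans (natsKept fr #s refl 0) s≡) (trans (natsKept fr #off refl 0) off≡) ⨟ λ { ρ fr′ (F≡′ , y≡ , w₀≡ , w₁≡) →
        let sitesρ = SitesIn-kept T b v F options refl fr′ sitesτ
            idx : nats ρ #pow (nats ρ #b 0) ℕ.+ nats ρ #off 0 ℕ.+ nats ρ #s 0 ≡ suc u ℕ.* P ℕ.+ code b β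
            idx = cong₂ ℕ._+_ (cong₂ ℕ._+_ (trans (cong (nats ρ #pow) (proj₁ sitesρ)) (proj₁ (proj₂ (proj₂ sitesρ)) b ℕ.≤-refl))
                    (trans (natsKept fr′ #off refl 0) (trans (natsKept fr #off refl 0) off≡)))
                    (trans (natsKept fr′ #s refl 0) (trans (natsKept fr #s refl 0) s≡))
            Wρ : ∀ z → reals ρ #W z ≡ reals σ #W z
            Wρ z = trans (realsKept fr′ #W refl z) (realsKept fr #W refl z)
            Xρ : ∀ z → reals ρ #X z ≡ reals τ #X z
            Xρ = realsKept fr′ #X refl
            wopt : ∀ X → Agree X X₀ → Matches t β X → ∀ x →
              option (reals τ #W) u β (F t (reals τ #X)) x ≈ option (reals σ #W) u β (F t X) x
            wopt X agrX mX x = option-cong (reals τ #W) (reals σ #W) u β x (≈-reflexive (realsKept fr #W refl _))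
              (Matches-field t<T {β} (reals τ #X) X (λ z z<lo → ≈-trans (agrτ z z<lo) (≈-sym (agrX z z<lo))) mt mX)
            finish : ∀ {w} → IsMin w (reals ρ #w₀ 0) (reals ρ #w₁ 0) →
              Agree (reals ρ #X) X₀
              × (∀ z → suc u ℕ.* P ℕ.+ code b β ≢ z → write (reals ρ) #W (suc u ℕ.* P ℕ.+ code b β) w #W z ≡ reals σ #W z)
              × (∀ X → Agree X X₀ → Matches t β X →
                  IsMin (write (reals ρ) #W (suc u ℕ.* P ℕ.+ code b β) w #W (suc u ℕ.* P ℕ.+ code b β)) (option (reals σ #W) u β (F t X) false) (option (reals σ #W) u β (F t X) true))
            finish {w} m = (λ z z<lo → ≈-trans (≈-reflexive (Xρ z)) (agrτ z z<lo))
              , (λ z ne → trans (write-other (reals ρ) #W w ne) (Wρ z))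
              , (λ X agrX mX → IsMin-resp (≈-reflexive (sym (write-same (reals ρ) #W {suc u ℕ.* P ℕ.+ code b β} w refl)))
                  (≈-trans (≈-reflexive w₀≡) (wopt X agrX mX false)) (≈-trans (≈-reflexive w₁≡) (wopt X agrX mX true)) m)
        in
        runs-if {B₀ = 20}
          (λ e → let le = test-true (_ ≤? _) e in
            runs-≤ (assignR idx refl (finish record { ≤ˡ = le ; ≤ʳ = ≤-refl ; ≥ = inj₂ ≤-refl })) by-computation)
          (λ e → let le = ≰⇒≥ (test-false (_ ≤? _) e) in
            runs-≤ (assignR idx refl (finish record { ≤ˡ = ≤-refl ; ≤ʳ = le ; ≥ = inj₁ ≤-refl })) by-computation) } }))
      (time (b ℕ.* 73))
      where
      time : ∀ x → 4 ℕ.+ (x ℕ.+ 10 ℕ.+ (110 ℕ.+ (5 ℕ.+ 20))) ℕ.≤ x ℕ.+ 160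
      time x = ℕ.≤-trans (ℕ.≤-reflexive (trans (ℕ.+-comm 4 _) (trans (cong (ℕ._+ 4) (ℕ.+-assoc x 10 135)) (ℕ.+-assoc x 145 4))))
        (ℕ.+-monoʳ-≤ x by-computation)

    -- The options for table row `suc u` are looked up in row `u`, so filling the former does not
    -- disturb them.
    option-index< : ∀ u β x → u ℕ.* P ℕ.+ (next β ℕ.+ weight x 1) ℕ.< suc u ℕ.* P
    option-index< u β x = subst₂ ℕ._<_ (cong (u ℕ.* P ℕ.+_) (code-push b′ x β)) (ℕ.+-comm (u ℕ.* P) P)
      (ℕ.+-monoʳ-< (u ℕ.* P) (code<2^ b (push x β)))

    powP : ∀ τ → Sites τ → nats τ #pow (nats τ #b 0) ≡ P
    powP τ (b≡ , _ , pow , _) = trans (cong (nats τ #pow) b≡) (pow b ℕ.≤-refl)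

    layerTime : ℕ
    layerTime = P ℕ.* (entryTime ℕ.+ 14) ℕ.+ 31

    runs-tableLayer : ∀ σ u X₀ → Sites σ → u ℕ.< T → nats σ #u 0 ≡ u → nats σ #off 0 ≡ u ℕ.* P → Agree (reals σ #X) X₀ →
      Runs tableLayer σ layerTime (λ τ → (nats τ #off 0 ≡ suc u ℕ.* P) × Agree (reals τ #X) X₀
        × (∀ z → z ℕ.< suc u ℕ.* P → reals τ #W z ≡ reals σ #W z) × Layer (reals τ #W) X₀ u)
    runs-tableLayer σ u X₀ sites u<T u≡ off≡ agr = runs-≤
      (assignN⨾ refl (cong₂ _∸_ (proj₁ (proj₂ sites)) (trans (cong (ℕ._+ 1) u≡) (ℕ.+-comm u 1)))
        (runs-for #s (N #pow [ var #b ]) tableEntry Inv P entryTime σ₁ refl bound step start ⨟ λ { τ fr (agrτ , Wτ , mins) →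
          let sitesτ = SitesIn-kept T b v F loop refl fr sites
          in assignN refl (cong₂ ℕ._+_ (powP τ sitesτ) (trans (natsKept fr #off refl 0) off≡))
               (refl , agrτ , Wτ , λ β X agrX mX → IsMin-resp ≈-refl (opt Wτ β X false) (opt Wτ β X true) (mins β (code<2^ b β) X agrX mX)) }))
      (time (P ℕ.* (entryTime ℕ.+ 14)))
      where
      t = T ∸ suc u
      t<T : t ℕ.< T
      t<T = subst (ℕ._≤ T) (∸-suc u<T) (ℕ.m∸n≤m T u)
      σ₁ = withN σ #t 0 t
      loop = for #s (N #pow [ var #b ]) tableEntry

      bound : ∀ τ → Frame loop σ₁ τ → nats τ #pow (nats τ #b 0) ≡ P
      bound τ fr = powP τ (SitesIn-kept T b v F loop refl fr sites)

      opt : ∀ {W : ℕ → Carrier} → (∀ z → z ℕ.< suc u ℕ.* P → W z ≡ reals σ #W z) → ∀ β X x →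
        option (reals σ #W) u β (F t X) x ≈ option W u β (F t X) x
      opt {W} W≡ β X x = option-cong (reals σ #W) W u β x (≈-reflexive (sym (W≡ _ (option-index< u β x)))) ≈-refl

      Inv : ℕ → State → Set (a ⊔ ℓ)
      Inv s τ = Agree (reals τ #X) X₀ × (∀ z → z ℕ.< suc u ℕ.* P → reals τ #W z ≡ reals σ #W z)
        × (∀ β → code b β ℕ.< s → ∀ X → Agree X X₀ → Matches t β X →
            IsMin (reals τ #W (suc u ℕ.* P ℕ.+ code b β)) (option (reals σ #W) u β (F t X) false) (option (reals σ #W) u β (F t X) true))

      start : Inv 0 (setN σ₁ #s 0)
      start = agr , (λ _ _ → refl) , λ _ ()

      step : ∀ s σ′ → s ℕ.< P → nats σ′ #s 0 ≡ s → Frame loop σ₁ σ′ → Inv s σ′ →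
        Runs tableEntry σ′ entryTime (λ τ → Inv (suc s) (setN τ #s (suc s)))
      -- The loop counter is a bare number, while correctness is stated for digit functions;
      -- surjectivity supplies one with this code.
      step s σ′ s<P s≡ fr (agr′ , W′ , mins) with code-surjective b s s<P
      ... | β₀ , refl = runs-map
        (runs-tableEntry σ′ t u β₀ X₀ (SitesIn-kept T b v F loop refl fr sites) t<T (natsKept fr #t refl 0) s≡
          (trans (natsKept fr #off refl 0) off≡) agr′)
        λ { τ _ (agrτ , others , min) → agrτ
          , (λ z z< → trans (others z (λ e → ℕ.<⇒≱ z< (subst (suc u ℕ.* P ℕ.≤_) e (ℕ.m≤m+n _ _)))) (W′ z z<))
          , λ β β<s X agrX mX → new τ others min β β<s X agrX mX }
        where
        new : ∀ τ → (∀ z → suc u ℕ.* P ℕ.+ code b β₀ ≢ z → reals τ #W z ≡ reals σ′ #W z) →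
          (∀ X → Agree X X₀ → Matches t β₀ X → IsMin (reals τ #W (suc u ℕ.* P ℕ.+ code b β₀))
            (option (reals σ′ #W) u β₀ (F t X) false) (option (reals σ′ #W) u β₀ (F t X) true)) →
          ∀ β → code b β ℕ.< suc (code b β₀) → ∀ X → Agree X X₀ → Matches t β X →
          IsMin (reals τ #W (suc u ℕ.* P ℕ.+ code b β)) (option (reals σ #W) u β (F t X) false) (option (reals σ #W) u β (F t X) true)
        new τ others min β β≤ X agrX mX with code b β ℕ.≟ code b β₀
        ... | no ne = IsMin-resp (≈-reflexive (sym (others _ (λ e → ne (sym (ℕ.+-cancelˡ-≡ (suc u ℕ.* P) _ _ e))))))
              ≈-refl ≈-refl (mins β (ℕ.≤∧≢⇒< (s≤s⁻¹ β≤) ne) X agrX mX)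
        -- `β` need not be the digit function `β₀` chosen for this cell, but by injectivity the two
        -- agree on all `b` digits of the window.
        ... | yes e = IsMin-resp (≈-reflexive (cong (λ n → reals τ #W (suc u ℕ.* P ℕ.+ n)) (sym e))) (opt′ false) (opt′ true)
              (min X agrX (λ m m<b m<t → ≈-trans (mX m m<b m<t) (≈-reflexive (cong spinᵇ (same m m<b)))))
          where
          same : ∀ m → m ℕ.< b → β m ≡ β₀ m
          same = code-injective b β β₀ e
          next≡ : next β₀ ≡ next β
          next≡ = cong dbl (code-cong b′ β₀ β (λ m m<b′ → sym (same m (ℕ.m<n⇒m<1+n m<b′))))
          opt′ : ∀ x → option (reals σ′ #W) u β₀ (F t X) x ≈ option (reals σ #W) u β (F t X) x
          opt′ x = ≈-trans (+-congʳ (≈-reflexive (cong (λ n → reals σ′ #W (u ℕ.* P ℕ.+ (n ℕ.+ weight x 1))) next≡)))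
            (≈-sym (opt W′ β X x))

      time : ∀ x → 9 ℕ.+ (x ℕ.+ 11 ℕ.+ 8) ℕ.≤ x ℕ.+ 31
      time x = ℕ.≤-trans (ℕ.≤-reflexive (trans (ℕ.+-comm 9 _) (trans (cong (ℕ._+ 9) (ℕ.+-assoc x 11 8)) (ℕ.+-assoc x 19 9))))
        (ℕ.+-monoʳ-≤ x by-computation)

    Layer-resp : ∀ {W W′ : ℕ → Carrier} X₀ u → (∀ z → z ℕ.< suc (suc u) ℕ.* P → W′ z ≡ W z) → Layer W X₀ u → Layer W′ X₀ u
    Layer-resp {W} {W′} X₀ u same ly β X agr mt = IsMin-resp (≈-reflexive (sym (same _ index<)))
      (opt false) (opt true) (ly β X agr mt)
      where
      index< : suc u ℕ.* P ℕ.+ code b β ℕ.< suc (suc u) ℕ.* P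
      index< = subst (suc u ℕ.* P ℕ.+ code b β ℕ.<_) (ℕ.+-comm (suc u ℕ.* P) P) (ℕ.+-monoʳ-< (suc u ℕ.* P) (code<2^ b β))
      opt : ∀ x → option W u β (F (T ∸ suc u) X) x ≈ option W′ u β (F (T ∸ suc u) X) x
      opt x = option-cong W W′ u β x (≈-reflexive (sym (same _ (ℕ.<-≤-trans (option-index< u β x) (ℕ.m≤n+m (suc u ℕ.* P) P))))) ≈-refl

    tableTime : ℕ
    tableTime = (P ℕ.* 18 ℕ.+ 11) ℕ.+ (3 ℕ.+ (T ℕ.* (layerTime ℕ.+ 13) ℕ.+ 10))

    runs-table : ∀ σ → Sites σ →
      Runs table σ tableTime (λ τ → (nats τ #off 0 ≡ T ℕ.* P) × Agree (reals τ #X) (reals σ #X)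
        × (∀ z → z ℕ.< P → reals τ #W z ≈ 0#) × (∀ u → u ℕ.< T → Layer (reals τ #W) (reals σ #X) u))
    runs-table σ sites =
      runs-for #s (N #pow [ var #b ]) _ Zeroed P 4 σ refl
        (λ τ fr → powP τ (SitesIn-kept T b v F zeroLoop refl fr sites))
        (λ s σ′ s<P s≡ fr zeroed → assignR s≡ refl (λ z z<ss → clear s σ′ zeroed z z<ss))
        (λ z ())
      ⨟ λ τ fr zeroed → assignN⨾ refl refl
        (runs-map (runs-for #u (var #T) tableLayer Inv T layerTime (withN τ #off 0 0) refl
          (λ ρ fr′ → trans (natsKept fr′ #T refl 0) (trans (natsKept fr #T refl 0) (proj₁ (proj₂ sites))))
          (step τ (SitesIn-kept T b v F zeroLoop refl fr sites))
          (refl , (λ z _ → ≈-reflexive (realsKept fr #X refl z)) , zeroed , λ _ ()))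
        λ ρ _ inv → inv)
      where
      zeroLoop = for #s (N #pow [ var #b ]) (R #W [ var #s ]≔ 𝟎)
      layerLoop = for #u (var #T) tableLayer

      Zeroed : ℕ → State → Set ℓ
      Zeroed s τ = ∀ z → z ℕ.< s → reals τ #W z ≈ 0#

      clear : ∀ s σ′ → Zeroed s σ′ → ∀ z → z ℕ.< suc s → write (reals σ′) #W s 0# #W z ≈ 0#
      clear s σ′ zeroed z z<ss with z ℕ.≟ s
      ... | yes refl = ≈-reflexive (write-same (reals σ′) #W {s} 0# refl)
      ... | no z≢s = ≈-trans (≈-reflexive (write-other (reals σ′) #W 0# (λ e → z≢s (sym e)))) (zeroed z (ℕ.≤∧≢⇒< (s≤s⁻¹ z<ss) z≢s))

      Inv : ℕ → State → Set (a ⊔ ℓ)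
      Inv u τ = (nats τ #off 0 ≡ u ℕ.* P) × Agree (reals τ #X) (reals σ #X)
        × (∀ z → z ℕ.< P → reals τ #W z ≈ 0#) × (∀ u′ → u′ ℕ.< u → Layer (reals τ #W) (reals σ #X) u′)

      step : ∀ τ → Sites τ → ∀ u σ′ → u ℕ.< T → nats σ′ #u 0 ≡ u → Frame layerLoop (withN τ #off 0 0) σ′ → Inv u σ′ →
        Runs tableLayer σ′ layerTime (λ ρ → Inv (suc u) (setN ρ #u (suc u)))
      step τ sitesτ u σ′ u<T u≡ fr (off≡ , agr , zeroed , lys) = runs-map
        (runs-tableLayer σ′ u (reals σ #X) (SitesIn-kept T b v F layerLoop refl fr sitesτ) u<T u≡ off≡ agr)
        λ { ρ _ (off′ , agr′ , W≡ , ly) → off′ , agr′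
          , (λ z z<P → ≈-trans (≈-reflexive (W≡ z (ℕ.<-≤-trans z<P (ℕ.m≤m+n P (u ℕ.* P))))) (zeroed z z<P))
          , λ u′ u′<su → all ρ W≡ ly u′ u′<su }
        where
        all : ∀ ρ → (∀ z → z ℕ.< suc u ℕ.* P → reals ρ #W z ≡ reals σ′ #W z) → Layer (reals ρ #W) (reals σ #X) u →
          ∀ u′ → u′ ℕ.< suc u → Layer (reals ρ #W) (reals σ #X) u′
        all ρ W≡ ly u′ u′<su with u′ ℕ.≟ u
        ... | yes refl = ly
        ... | no ne = let u′<u = ℕ.≤∧≢⇒< (s≤s⁻¹ u′<su) ne in
          Layer-resp {reals σ′ #W} {reals ρ #W} (reals σ #X) u′ (λ z z< → W≡ z (ℕ.<-≤-trans z< (ℕ.*-monoˡ-≤ P (s≤s u′<u)))) (lys u′ u′<u)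

    forwardTime : ℕ
    forwardTime = 3 ℕ.+ (T ℕ.* 213 ℕ.+ 10)

    runs-forward : ∀ σ X₀ → Sites σ → nats σ #off 0 ≡ T ℕ.* P → Agree (reals σ #X) X₀ →
      (∀ z → z ℕ.< P → reals σ #W z ≈ 0#) → (∀ u → u ℕ.< T → Layer (reals σ #W) X₀ u) →
      Runs forward σ forwardTime (λ τ → Agree (reals τ #X) X₀ × Spins T (reals τ #X)
        × (reals τ #val 0 ≈ reals σ #val 0 + energyBelow T (reals τ #X))
        × (∀ Z → Agree Z X₀ → Spins T Z → energyBelow T (reals τ #X) ≤ energyBelow T Z))
    runs-forward σ X₀ sites off≡ agr zeroed layers =
      assignN⨾ refl refl
        (runs-map (runs-for #t (var #T) forwardStep Inv T 200 (withN σ #s 0 0) refl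
          (λ ρ fr → trans (natsKept fr #T refl 0) (proj₁ (proj₂ sites))) step
          (off≡ , start , ≈-sym (≈-trans (+-congˡ ⅀-0) (+-identityʳ _))))
        λ { ρ _ (_ , fw , val≡) → let sp , opt = forward-end W X₀ zeroed layers _ _ fw in Forward.agree fw , sp , val≡ , opt })
      where
      W = reals σ #W
      loop = for #t (var #T) forwardStep

      Inv : ℕ → State → Set (a ⊔ ℓ)
      Inv t τ = (nats τ #off 0 ≡ (T ∸ t) ℕ.* P) × Forward W X₀ zeroed layers t (nats τ #s 0) (reals τ #X)
        × (reals τ #val 0 ≈ reals σ #val 0 + energyBelow t (reals τ #X))

      start : Forward W X₀ zeroed layers 0 0 (reals σ #X)
      start = record { Forward (forward-start W X₀ zeroed layers) ; matches = λ _ _ () ; agree = agr ; spins = λ _ ()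
                     ; greedy = ≤-reflexive (≈-trans (+-congʳ ⅀-0) (+-identityˡ _)) }

      step : ∀ t σ′ → t ℕ.< T → nats σ′ #t 0 ≡ t → Frame loop (withN σ #s 0 0) σ′ → Inv t σ′ →
        Runs forwardStep σ′ 200 (λ ρ → Inv (suc t) (setN ρ #t (suc t)))
      step t σ′ t<T t≡ fr (off′ , fw , val′) = runs-≤
        (assignN⨾ refl off≡′
          (runs-options (withN σ′ #off 0 (u ℕ.* P)) t u digits sites′ t≡ (sym coded) refl ⨟ λ { τ fr′ (F≡ , y≡ , w₀≡ , w₁≡) →
            let val≡ : reals τ #val 0 ≈ reals σ #val 0 + energyBelow t X
                val≡ = ≈-trans (≈-reflexive (realsKept fr′ #val refl 0)) val′
                site≡ : nats τ #V (nats τ #t 0) ≡ v t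
                site≡ = trans (cong (nats τ #V) (trans (natsKept fr′ #t refl 0) t≡))
                          (trans (natsKept fr′ #V refl t) (proj₁ (proj₂ (proj₂ (proj₂ sites′))) t))
                off″ : nats τ #off 0 ≡ u ℕ.* P
                off″ = natsKept fr′ #off refl 0
                w₀≈ = ≈-trans (≈-reflexive w₀≡) (opt false)
                w₁≈ = ≈-trans (≈-reflexive w₁≡) (opt true)
            in
            runs-if {B₀ = 25}
              (λ e → let fw′ , en = advance (reals τ) (realsKept fr′ #X refl) true 1# ≈-refl
                                      (λ { true → ≤-refl ; false → ≤-resp₂ w₁≈ w₀≈ (test-true (_ ≤? _) e) }) in
                runs-≤ (assignR⨾ site≡ refl (assignR⨾ refl (cong (reals τ #val 0 +_) F≡)
                  (assignN refl (cong (ℕ._+ 1) y≡)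
                    (off″ , fw′ , ≈-trans (+-congʳ val≡) (≈-trans (+-assoc _ _ _) (+-congˡ (≈-sym en))))))) by-computation)
              (λ e → let fw′ , en = advance (reals τ) (realsKept fr′ #X refl) false (0# - 1#) 0-1≈-1
                                      (λ { true → ≤-resp₂ w₀≈ w₁≈ (≰⇒≥ (test-false (_ ≤? _) e)) ; false → ≤-refl }) in
                runs-≤ (assignR⨾ site≡ refl (assignR⨾ refl (cong (λ f → reals τ #val 0 - f) F≡)
                  (assignN refl (cong (ℕ._+ 0) y≡)
                    (off″ , fw′ , ≈-trans (+-congʳ val≡) (≈-trans (+-assoc _ _ _) (+-congˡ (≈-sym en))))))) by-computation) }))
        by-computation
        where
        open Forward fw
        u = T ∸ suc t
        X = reals σ′ #X
        f = F t X
        sites′ : Sites σ′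
        sites′ = SitesIn-kept T b v F loop refl fr sites
        off≡′ : nats σ′ #off 0 ∸ nats σ′ #pow (nats σ′ #b 0) ≡ u ℕ.* P
        off≡′ = trans (cong₂ _∸_ (trans off′ (cong (ℕ._* P) (∸-suc t<T))) (powP σ′ sites′)) (ℕ.m+n∸m≡n P (u ℕ.* P))
        opt : ∀ x → option (reals σ′ #W) u digits f x ≈ option W u digits f x
        opt x = option-cong (reals σ′ #W) W u digits x (≈-reflexive (realsKept fr #W refl _)) ≈-refl
        advance : ∀ (M : Memory Carrier) → (∀ z → M #X z ≡ X z) → ∀ x s → s ≈ spinᵇ x →
          (∀ y → option W u digits f x ≤ option W u digits f y) →
          Forward W X₀ zeroed layers (suc t) (next digits ℕ.+ weight x 1) (write M #X (v t) s #X)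
          × (energyBelow (suc t) (write M #X (v t) s #X) ≈ energyBelow t X + signed x f)
        advance M M≡ x s s≈ best =
            forward-step W X₀ zeroed layers inj above local t<T X _ same fw at-t best
          , energyBelow-step W X₀ zeroed layers inj above local t<T X _ same {x} at-t
          where
          same : ∀ z → z ≢ v t → write M #X (v t) s #X z ≈ X z
          same z ne = ≈-reflexive (trans (write-other M #X s (λ e → ne (sym e))) (M≡ z))
          at-t : write M #X (v t) s #X (v t) ≈ spinᵇ x
          at-t = ≈-trans (≈-reflexive (write-same M #X {v t} s refl)) s≈

-- Powers of two and the list of sites of a strip

powers : Program
powers = (N #pow [ lit 0 ]≔ lit 1) ⨾ for #n (var #b) (N #pow [ var #n ⊕ lit 1 ]≔ doubled (N #pow [ var #n ]))

edgeExp vertexExp : NExp → NExp → NExp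
edgeExp g k = doubled (doubled g) ⊕ k
vertexExp g k = doubled (edgeExp g k)

-- In row 0 the truncated index `#g ⊖ #r` points to no neighbour; the zero coefficient makes the
-- term vanish. `site₁` treats column 0 in the same way.
site₀ : Program
site₀ =
  (if lit 1 ≤ᴺ var #i₀ ⊕ var #i
   then (R #C₀ [ var #T ]≔ R #c₀ [ edgeExp (var #g ⊖ var #r) (var #k) ])
   else (R #C₀ [ var #T ]≔ 𝟎)) ⨾
  (N #N₀ [ var #T ]≔ vertexExp (var #g ⊖ var #r) (var #k) ⊕ lit 0) ⨾
  (N #V [ var #T ]≔ vertexExp (var #g) (var #k) ⊕ lit 0) ⨾
  (R #D [ var #T ]≔ R #d [ vertexExp (var #g) (var #k) ⊕ lit 0 ]) ⨾
  (R #C₁ [ var #T ]≔ 𝟎) ⨾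
  (R #C₂ [ var #T ]≔ 𝟎) ⨾
  (R #C₃ [ var #T ]≔ 𝟎) ⨾
  (R #C₄ [ var #T ]≔ 𝟎) ⨾
  (#T ≔ var #T ⊕ lit 1)

site₁ : Program
site₁ =
  (if lit 1 ≤ᴺ var #j
   then (R #C₀ [ var #T ]≔ R #c₁ [ edgeExp (var #g ⊖ lit 1) (var #k) ])
   else (R #C₀ [ var #T ]≔ 𝟎)) ⨾
  (N #N₀ [ var #T ]≔ vertexExp (var #g ⊖ lit 1) (var #k) ⊕ lit 1) ⨾
  (N #V [ var #T ]≔ vertexExp (var #g) (var #k) ⊕ lit 1) ⨾
  (R #D [ var #T ]≔ R #d [ vertexExp (var #g) (var #k) ⊕ lit 1 ]) ⨾
  (R #C₁ [ var #T ]≔ coupling 0) ⨾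
  (R #C₂ [ var #T ]≔ coupling 1) ⨾
  (R #C₃ [ var #T ]≔ coupling 2) ⨾
  (R #C₄ [ var #T ]≔ coupling 3) ⨾
  (N #N₁ [ var #T ]≔ vertexExp (var #g) (lit 0) ⊕ lit 0) ⨾
  (N #N₂ [ var #T ]≔ vertexExp (var #g) (lit 1) ⊕ lit 0) ⨾
  (N #N₃ [ var #T ]≔ vertexExp (var #g) (lit 2) ⊕ lit 0) ⨾
  (N #N₄ [ var #T ]≔ vertexExp (var #g) (lit 3) ⊕ lit 0) ⨾
  (#T ≔ var #T ⊕ lit 1)
  where
  coupling : ℕ → RExp
  coupling k₀ = R #c₀₁ [ edgeExp (edgeExp (var #g) (lit k₀)) (var #k) ]

buildCell : Program
buildCell =
  for #k (lit 4) site₀ ⨾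
  for #k (lit 4) site₁ ⨾
  (#g ≔ var #g ⊕ var #r)

buildColumn : Program
buildColumn = (#g ≔ var #base ⊕ var #j) ⨾ for #i (var #h) buildCell

build : Program
build =
  (#T ≔ lit 0) ⨾
  (#base ≔ lit 0) ⨾
  for #n (var #i₀) (#base ≔ var #base ⊕ var #r) ⨾
  for #j (var #r) buildColumn

module Building {a ℓ} (ℝ : Reals a ℓ) where
  open Reals ℝ
  open Semantics ℝ
  open Logic ℝ
  open For ℝ
  open Assign ℝ
  open OrderedField ℝ
  open SiteField ℝ
  open Decoding ℝ using (Powers)

  powersTime : ℕ → ℕ
  powersTime b = b ℕ.* 40 ℕ.+ 20

  runs-powers : ∀ σ b → nats σ #b 0 ≡ b → Runs powers σ (powersTime b) (λ τ → Powers τ b)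
  runs-powers σ b b≡ = runs-≤ (N≔⨾ (runs-map (runs-for #n (var #b) _ (λ k τ → ∀ m → m ℕ.≤ k → nats τ #pow m ≡ 2 ℕ.^ m) b 17 _ refl
      (λ τ fr → trans (natsKept fr #b refl 0) b≡)
      (λ k σ′ k<b k≡ fr inv → runs-≤ (assignN (trans (cong (ℕ._+ 1) k≡) (ℕ.+-comm k 1)) refl (λ m m≤ → step k σ′ k≡ inv m m≤)) by-computation)
      (λ { zero z≤n → refl }))
      (λ _ _ p → p)))
    (subst (ℕ._≤ powersTime b) (ℕ.+-comm _ 3) (subst₂ ℕ._≤_ (sym (ℕ.+-assoc (b ℕ.* 30) 10 3)) refl
      (ℕ.+-mono-≤ (ℕ.*-monoʳ-≤ b (by-computation {30} {40})) by-computation)))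
    where
    step : ∀ k σ′ → nats σ′ #n 0 ≡ k → (∀ m → m ℕ.≤ k → nats σ′ #pow m ≡ 2 ℕ.^ m) → ∀ m → m ℕ.≤ suc k →
      write (nats σ′) #pow (suc k) (nats σ′ #pow (nats σ′ #n 0) ℕ.+ nats σ′ #pow (nats σ′ #n 0)) #pow m ≡ 2 ℕ.^ m
    step k σ′ k≡ inv m m≤ with m ℕ.≟ suc k
    ... | yes refl = trans (write-same (nats σ′) #pow {suc k} _ refl)
          (trans (cong dbl (trans (cong (nats σ′ #pow) k≡) (inv k ℕ.≤-refl))) (dbl≡2* (2 ℕ.^ k)))
    ... | no ne = trans (write-other (nats σ′) #pow _ (λ e → ne (sym e))) (inv m (s≤s⁻¹ (ℕ.≤∧≢⇒< m≤ ne)))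

  SiteAt : State → ℕ → ℕ → ((ℕ → Carrier) → Carrier) → Set (a ⊔ ℓ)
  SiteAt σ t v f = (nats σ #V t ≡ v) × (∀ X → siteField σ t X ≈ f X)

  module _ (r : ℕ) (dd up lf cc : ℕ → Carrier) where
    open Address r
    open Energy ℝ r dd up lf cc

    Inputs : State → Set a
    Inputs σ = (nats σ #r 0 ≡ r) × (∀ z → reals σ #d z ≡ dd z) × (∀ z → reals σ #c₀ z ≡ up z)
             × (∀ z → reals σ #c₁ z ≡ lf z) × (∀ z → reals σ #c₀₁ z ≡ cc z)

    touchesInputs : Program → Bool
    touchesInputs P = writesN P #r ∨ (writesR P #d ∨ (writesR P #c₀ ∨ (writesR P #c₁ ∨ writesR P #c₀₁)))

    Inputs-kept : ∀ P {σ τ} → touchesInputs P ≡ false → Frame P σ τ → Inputs σ → Inputs τ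
    Inputs-kept P w fr (r≡ , d≡ , c₀≡ , c₁≡ , c₀₁≡) =
        trans (natsKept fr #r (∨-falseˡ {writesN P #r} w) 0) r≡
      , (λ z → trans (realsKept fr #d (∨-falseˡ {writesR P #d} w₁) z) (d≡ z))
      , (λ z → trans (realsKept fr #c₀ (∨-falseˡ {writesR P #c₀} w₂) z) (c₀≡ z))
      , (λ z → trans (realsKept fr #c₁ (∨-falseˡ {writesR P #c₁} w₃) z) (c₁≡ z))
      , (λ z → trans (realsKept fr #c₀₁ (∨-falseʳ {writesR P #c₁} w₃) z) (c₀₁≡ z))
      where
      w₁ = ∨-falseʳ {writesN P #r} w
      w₂ = ∨-falseʳ {writesR P #d} w₁
      w₃ = ∨-falseʳ {writesR P #c₀} w₂

    up-cell : ∀ i j → suc i ℕ.* r ℕ.+ j ∸ r ≡ i ℕ.* r ℕ.+ j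
    up-cell i j = trans (cong (_∸ r) (ℕ.+-assoc r (i ℕ.* r) j)) (ℕ.m+n∸m≡n r (i ℕ.* r ℕ.+ j))

    left-cell : ∀ i j → i ℕ.* r ℕ.+ suc j ∸ 1 ≡ i ℕ.* r ℕ.+ j
    left-cell i j = cong (_∸ 1) (ℕ.+-suc (i ℕ.* r) j)

    vertexAddr : ℕ → ℕ → ℕ
    vertexAddr g k = dbl (dbl (dbl g) ℕ.+ k)

    upTerm-program : ∀ i j k c → (i ≡ 0 → c ≡ 0#) → (∀ i′ → i ≡ suc i′ → c ≡ up (edgeAddr i′ j k)) →
      ∀ X → c * X (vertexAddr (i ℕ.* r ℕ.+ j ∸ r) k ℕ.+ 0) ≈ upTerm i j k X
    upTerm-program zero    j k c c₀ _ X = ≈-trans (*-congʳ (≈-reflexive (c₀ refl))) (zeroˡ _)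
    upTerm-program (suc i) j k c _ c₁ X = *-cong (≈-reflexive (c₁ i refl))
      (≈-reflexive (cong (λ g → X (vertexAddr g k ℕ.+ 0)) (up-cell i j)))

    leftTerm-program : ∀ i j k c → (j ≡ 0 → c ≡ 0#) → (∀ j′ → j ≡ suc j′ → c ≡ lf (edgeAddr i j′ k)) →
      ∀ X → c * X (vertexAddr (i ℕ.* r ℕ.+ j ∸ 1) k ℕ.+ 1) ≈ leftTerm i j k X
    leftTerm-program i zero    k c c₀ _ X = ≈-trans (*-congʳ (≈-reflexive (c₀ refl))) (zeroˡ _)
    leftTerm-program i (suc j) k c _ c₁ X = *-cong (≈-reflexive (c₁ j refl))
      (≈-reflexive (cong (λ g → X (vertexAddr g k ℕ.+ 1)) (left-cell i j)))

    module _ (σ : State) (t i₀ i j k : ℕ) (inputs : Inputs σ) (t≡ : nats σ #T 0 ≡ t)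
      (i₀≡ : nats σ #i₀ 0 ≡ i₀) (i≡ : nats σ #i 0 ≡ i) (j≡ : nats σ #j 0 ≡ j) (k≡ : nats σ #k 0 ≡ k)
      (g≡ : nats σ #g 0 ≡ (i₀ ℕ.+ i) ℕ.* r ℕ.+ j) where

      Appended : ℕ → State → Set (a ⊔ ℓ)
      Appended l τ = (nats τ #T 0 ≡ suc t) × SiteAt τ t (addr (i₀ ℕ.+ i) j k l) (field′ (i₀ ℕ.+ i) j k l)
        × (∀ s → s ℕ.< t → ∀ v f → SiteAt σ s v f → SiteAt τ s v f)

      private
        q = i₀ ℕ.+ i
        G = q ℕ.* r ℕ.+ j

      runs-site₀ : Runs site₀ σ 200 (Appended 0)
      runs-site₀ = runs-≤ (coefficient ⨟ λ { τ fr (c , others) →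
          let kept : ∀ x → writesN upCoupling x ≡ false → nats τ x 0 ≡ nats σ x 0
              kept x w = natsKept fr x w 0
              t≡τ = trans (kept #T refl) t≡
              k≡τ = trans (kept #k refl) k≡
              g≡τ = trans (kept #g refl) g≡
              r≡τ = trans (kept #r refl) (proj₁ inputs)
              vertex≡ = cong (ℕ._+ 0) (cong₂ vertexAddr g≡τ k≡τ)
          in
          assignN⨾ t≡τ (cong (ℕ._+ 0) (cong₂ vertexAddr (cong₂ _∸_ g≡τ r≡τ) k≡τ)) (
          assignN⨾ t≡τ vertex≡ (
          assignR⨾ t≡τ (trans (realsKept fr #d refl _) (trans (proj₁ (proj₂ inputs) _) (cong dd vertex≡))) (
          assignR⨾ t≡τ refl (assignR⨾ t≡τ refl (assignR⨾ t≡τ refl (assignR⨾ t≡τ refl (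
          assignN refl (trans (cong (ℕ._+ 1) t≡τ) (ℕ.+-comm t 1)) (
            refl
          , (write-same _ #V {t} _ refl
            , λ X → ≈-trans (+-cong (≈-reflexive (write-same _ #D {t} _ refl))
                (+-cong (≈-reflexive (cong (λ n → reals τ #C₀ t * X n) (write-same _ #N₀ {t} _ refl)))
                (+-cong (zero-term X #C₁ _) (+-cong (zero-term X #C₂ _) (+-cong (zero-term X #C₃ _) (zero-term X #C₄ _))))))
                (+-congˡ (≈-trans (+-congˡ zeros) (≈-trans (+-identityʳ _) (c X)))))
          , λ s s<t v f (v≡ , f≈) →
              let ne : t ≢ s
                  ne = λ e → ℕ.<-irrefl (sym e) s<t
              in trans (write-other _ #V _ ne) (trans (natsKept fr #V refl s) v≡)
               , λ X → ≈-trans (≈-reflexive (cong₂ _+_ (trans (write-other _ #D _ ne) (realsKept fr #D refl s))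
                   (cong₂ _+_ (cong₂ (λ c n → c * X n) (others s ne) (trans (write-other _ #N₀ _ ne) (natsKept fr #N₀ refl s)))
                   (cong₂ _+_ (cong₂ (λ c n → c * X n) (trans (write-other _ #C₁ _ ne) (realsKept fr #C₁ refl s)) (natsKept fr #N₁ refl s))
                   (cong₂ _+_ (cong₂ (λ c n → c * X n) (trans (write-other _ #C₂ _ ne) (realsKept fr #C₂ refl s)) (natsKept fr #N₂ refl s))
                   (cong₂ _+_ (cong₂ (λ c n → c * X n) (trans (write-other _ #C₃ _ ne) (realsKept fr #C₃ refl s)) (natsKept fr #N₃ refl s))
                                (cong₂ (λ c n → c * X n) (trans (write-other _ #C₄ _ ne) (realsKept fr #C₄ refl s)) (natsKept fr #N₄ refl s))))))))
                   (f≈ X))))))))) }) by-computation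
        where
        upCoupling = if lit 1 ≤ᴺ var #i₀ ⊕ var #i
          then (R #C₀ [ var #T ]≔ R #c₀ [ edgeExp (var #g ⊖ var #r) (var #k) ])
          else (R #C₀ [ var #T ]≔ 𝟎)

        zeros : 0# + (0# + (0# + 0#)) ≈ 0#
        zeros = ≈-trans (+-identityˡ _) (≈-trans (+-identityˡ _) (+-identityˡ _))

        zero-term : ∀ (X : ℕ → Carrier) x (M : Memory Carrier) {n} → write M x t 0# x t * X n ≈ 0#
        zero-term X x M = ≈-trans (*-congʳ (≈-reflexive (write-same M x {t} 0# refl))) (zeroˡ _)

        coefficient : Runs upCoupling σ _ (λ τ → (∀ X → reals τ #C₀ t * X (vertexAddr (G ∸ r) k ℕ.+ 0) ≈ upTerm q j k X)
          × (∀ s → t ≢ s → reals τ #C₀ s ≡ reals σ #C₀ s))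
        coefficient = runs-if {B₀ = 40}
          (λ e → let 1≤q : 1 ℕ.≤ q
                     1≤q = subst (1 ℕ.≤_) (cong₂ ℕ._+_ i₀≡ i≡) (test-true (_ ℕ.≤? _) e) in
            runs-≤ (assignR t≡ refl
              ( upTerm-program q j k _ (λ q≡0 → ⊥-elim (ℕ.n≮0 (subst (1 ℕ.≤_) q≡0 1≤q)))
                  (λ q′ q≡ → trans (write-same (reals σ) #C₀ {t} _ refl) (trans (proj₁ (proj₂ (proj₂ inputs)) _)
                     (cong up (cong₂ (λ g k → dbl (dbl g) ℕ.+ k) (trans (cong₂ _∸_ (trans g≡ (cong (λ n → n ℕ.* r ℕ.+ j) q≡)) (proj₁ inputs)) (up-cell q′ j)) k≡))))
              , λ s ne → write-other (reals σ) #C₀ _ ne)) by-computation)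
          (λ e → runs-≤ (assignR t≡ refl
              ( upTerm-program q j k _ (λ _ → write-same (reals σ) #C₀ {t} _ refl)
                  (λ q′ q≡ → ⊥-elim (test-false (_ ℕ.≤? _) e (subst (1 ℕ.≤_) (sym (trans (cong₂ ℕ._+_ i₀≡ i≡) q≡)) (s≤s z≤n))))
              , λ s ne → write-other (reals σ) #C₀ _ ne)) by-computation)

      ⅀-4 : ∀ f → ⅀ 4 f ≈ f 0 + (f 1 + (f 2 + f 3))
      ⅀-4 f = ≈-trans (⅀-cons 3 f) (+-congˡ (≈-trans (⅀-cons 2 (λ k → f (suc k))) (+-congˡ (≈-trans (⅀-cons 1 (λ k → f (suc (suc k))))
        (+-congˡ (≈-trans (⅀-cons 0 (λ k → f (suc (suc (suc k))))) (≈-trans (+-congˡ ⅀-0) (+-identityʳ _))))))))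

      runs-site₁ : Runs site₁ σ 700 (Appended 1)
      runs-site₁ = runs-≤ (coefficient ⨟ λ { τ fr (c , others) →
          let kept : ∀ x → writesN leftCoupling x ≡ false → nats τ x 0 ≡ nats σ x 0
              kept x w = natsKept fr x w 0
              t≡τ = trans (kept #T refl) t≡
              k≡τ = trans (kept #k refl) k≡
              g≡τ = trans (kept #g refl) g≡
              vertex≡ = cong (ℕ._+ 1) (cong₂ vertexAddr g≡τ k≡τ)
              coupling≡ : ∀ k₀ → reals τ #c₀₁ (dbl (dbl (dbl (dbl (nats τ #g 0)) ℕ.+ k₀)) ℕ.+ nats τ #k 0) ≡ cc (cellAddr q j k₀ k)
              coupling≡ k₀ = trans (realsKept fr #c₀₁ refl _) (trans (proj₂ (proj₂ (proj₂ (proj₂ inputs))) _)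
                (cong cc (cong₂ (λ g k → dbl (dbl (dbl (dbl g) ℕ.+ k₀)) ℕ.+ k) g≡τ k≡τ)))
              neighbour≡ : ∀ k₀ → vertexAddr (nats τ #g 0) k₀ ℕ.+ 0 ≡ addr q j k₀ 0
              neighbour≡ k₀ = cong (λ g → vertexAddr g k₀ ℕ.+ 0) g≡τ
          in
          assignN⨾ t≡τ (cong (ℕ._+ 1) (cong₂ vertexAddr (cong (_∸ 1) g≡τ) k≡τ)) (
          assignN⨾ t≡τ vertex≡ (
          assignR⨾ t≡τ (trans (realsKept fr #d refl _) (trans (proj₁ (proj₂ inputs) _) (cong dd vertex≡))) (
          assignR⨾ t≡τ (coupling≡ 0) (assignR⨾ t≡τ (coupling≡ 1) (assignR⨾ t≡τ (coupling≡ 2) (assignR⨾ t≡τ (coupling≡ 3) (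
          assignN⨾ t≡τ (neighbour≡ 0) (assignN⨾ t≡τ (neighbour≡ 1) (assignN⨾ t≡τ (neighbour≡ 2) (assignN⨾ t≡τ (neighbour≡ 3) (
          assignN refl (trans (cong (ℕ._+ 1) t≡τ) (ℕ.+-comm t 1)) (
            refl
          , (write-same _ #V {t} _ refl
            , λ X → ≈-trans (≈-reflexive (cong₂ _+_ (write-same _ #D {t} _ refl)
                (cong₂ _+_ (cong (λ n → reals τ #C₀ t * X n) (write-same _ #N₀ {t} _ refl))
                (cong₂ _+_ (cong₂ (λ c n → c * X n) (write-same _ #C₁ {t} _ refl) (write-same _ #N₁ {t} _ refl))
                (cong₂ _+_ (cong₂ (λ c n → c * X n) (write-same _ #C₂ {t} _ refl) (write-same _ #N₂ {t} _ refl))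
                (cong₂ _+_ (cong₂ (λ c n → c * X n) (write-same _ #C₃ {t} _ refl) (write-same _ #N₃ {t} _ refl))
                             (cong₂ (λ c n → c * X n) (write-same _ #C₄ {t} _ refl) (write-same _ #N₄ {t} _ refl))))))))
                (+-congˡ (+-cong (c X) (≈-sym (⅀-4 (λ k₀ → cc (cellAddr q j k₀ k) * X (addr q j k₀ 0)))))))
          , λ s s<t v f (v≡ , f≈) →
              let ne : t ≢ s
                  ne = λ e → ℕ.<-irrefl (sym e) s<t
              in trans (write-other _ #V _ ne) (trans (natsKept fr #V refl s) v≡)
               , λ X → ≈-trans (≈-reflexive (cong₂ _+_ (trans (write-other _ #D _ ne) (realsKept fr #D refl s))
                   (cong₂ _+_ (cong₂ (λ c n → c * X n) (others s ne) (trans (write-other _ #N₀ _ ne) (natsKept fr #N₀ refl s)))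
                   (cong₂ _+_ (cong₂ (λ c n → c * X n) (trans (write-other _ #C₁ _ ne) (realsKept fr #C₁ refl s)) (trans (write-other _ #N₁ _ ne) (natsKept fr #N₁ refl s)))
                   (cong₂ _+_ (cong₂ (λ c n → c * X n) (trans (write-other _ #C₂ _ ne) (realsKept fr #C₂ refl s)) (trans (write-other _ #N₂ _ ne) (natsKept fr #N₂ refl s)))
                   (cong₂ _+_ (cong₂ (λ c n → c * X n) (trans (write-other _ #C₃ _ ne) (realsKept fr #C₃ refl s)) (trans (write-other _ #N₃ _ ne) (natsKept fr #N₃ refl s)))
                                (cong₂ (λ c n → c * X n) (trans (write-other _ #C₄ _ ne) (realsKept fr #C₄ refl s)) (trans (write-other _ #N₄ _ ne) (natsKept fr #N₄ refl s)))))))))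
                   (f≈ X))))))))))))) }) by-computation
        where
        leftCoupling = if lit 1 ≤ᴺ var #j
          then (R #C₀ [ var #T ]≔ R #c₁ [ edgeExp (var #g ⊖ lit 1) (var #k) ])
          else (R #C₀ [ var #T ]≔ 𝟎)

        coefficient : Runs leftCoupling σ _ (λ τ → (∀ X → reals τ #C₀ t * X (vertexAddr (G ∸ 1) k ℕ.+ 1) ≈ leftTerm q j k X)
          × (∀ s → t ≢ s → reals τ #C₀ s ≡ reals σ #C₀ s))
        coefficient = runs-if {B₀ = 40}
          (λ e → let 1≤j : 1 ℕ.≤ j
                     1≤j = subst (1 ℕ.≤_) j≡ (test-true (_ ℕ.≤? _) e) in
            runs-≤ (assignR t≡ refl
              ( leftTerm-program q j k _ (λ j≡0 → ⊥-elim (ℕ.n≮0 (subst (1 ℕ.≤_) j≡0 1≤j)))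
                  (λ j′ j≡s → trans (write-same (reals σ) #C₀ {t} _ refl) (trans (proj₁ (proj₂ (proj₂ (proj₂ inputs))) _)
                     (cong lf (cong₂ (λ g k → dbl (dbl g) ℕ.+ k) (trans (cong (_∸ 1) (trans g≡ (cong (q ℕ.* r ℕ.+_) j≡s))) (left-cell q j′)) k≡))))
              , λ s ne → write-other (reals σ) #C₀ _ ne)) by-computation)
          (λ e → runs-≤ (assignR t≡ refl
              ( leftTerm-program q j k _ (λ _ → write-same (reals σ) #C₀ {t} _ refl)
                  (λ j′ j≡s → ⊥-elim (test-false (_ ℕ.≤? _) e (subst (1 ℕ.≤_) (sym (trans j≡ j≡s)) (s≤s z≤n))))
              , λ s ne → write-other (reals σ) #C₀ _ ne)) by-computation)

    module _ (i₀ h : ℕ) where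

      -- The number of a site in column order. Within a cell `l = 0` precedes `l = 1`, so a field
      -- with `l = 1` finds its four cell neighbours already placed.
      pos : ℕ → ℕ → ℕ → ℕ → ℕ
      pos j i l k = ((j ℕ.* h ℕ.+ i) ℕ.* 2 ℕ.+ l) ℕ.* 4 ℕ.+ k

      pos-injective : ∀ {j j′ i i′ l l′ k k′} → i ℕ.< h → i′ ℕ.< h → l ℕ.< 2 → l′ ℕ.< 2 → k ℕ.< 4 → k′ ℕ.< 4 →
        pos j i l k ≡ pos j′ i′ l′ k′ → (j ≡ j′) × (i ≡ i′) × (l ≡ l′) × (k ≡ k′)
      pos-injective i< i′< l< l′< k< k′< e with digits-injective 4 k< k′< e
      ... | eˡ , k≡ with digits-injective 2 l< l′< eˡ
      ... | eⁱ , l≡ with digits-injective h i< i′< eⁱ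
      ... | j≡ , i≡ = j≡ , i≡ , l≡ , k≡

      Built : ℕ → State → Set (a ⊔ ℓ)
      Built t τ = ∀ j i l k → j ℕ.< r → i ℕ.< h → l ℕ.< 2 → k ℕ.< 4 → pos j i l k ℕ.< t →
        SiteAt τ (pos j i l k) (addr (i₀ ℕ.+ i) j k l) (field′ (i₀ ℕ.+ i) j k l)

      BuiltTo : ℕ → State → Set (a ⊔ ℓ)
      BuiltTo t τ = (nats τ #T 0 ≡ t) × Built t τ

      append : ∀ {σ τ} j i l k → i ℕ.< h → l ℕ.< 2 → k ℕ.< 4 → Built (pos j i l k) σ →
        SiteAt τ (pos j i l k) (addr (i₀ ℕ.+ i) j k l) (field′ (i₀ ℕ.+ i) j k l) →
        (∀ s → s ℕ.< pos j i l k → ∀ v f → SiteAt σ s v f → SiteAt τ s v f) → Built (suc (pos j i l k)) τ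
      append j i l k i< l< k< built new keep j′ i′ l′ k′ j′< i′< l′< k′< p< with pos j′ i′ l′ k′ ℕ.≟ pos j i l k
      ... | no ne = let p<′ = ℕ.≤∧≢⇒< (s≤s⁻¹ p<) ne in keep _ p<′ _ _ (built j′ i′ l′ k′ j′< i′< l′< k′< p<′)
      ... | yes e with pos-injective {j′} {j} i′< i< l′< l< k′< k< e
      ... | refl , refl , refl , refl = new

      -- Rounded up from 857 and 2857 for the two loops and 7 for the final assignment.
      cellTime : ℕ
      cellTime = 4000

      runs-buildCell : ∀ σ i j → Inputs σ → nats σ #i₀ 0 ≡ i₀ → nats σ #i 0 ≡ i → nats σ #j 0 ≡ j → i ℕ.< h → j ℕ.< r →
        nats σ #g 0 ≡ (i₀ ℕ.+ i) ℕ.* r ℕ.+ j → BuiltTo (pos j i 0 0) σ →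
        Runs buildCell σ cellTime (λ τ → BuiltTo (pos j (suc i) 0 0) τ × (nats τ #g 0 ≡ (i₀ ℕ.+ suc i) ℕ.* r ℕ.+ j))
      runs-buildCell σ i j inputs i₀≡ i≡ j≡ i<h j<r g≡ built = runs-≤
        (runs-for #k (lit 4) site₀ (λ k τ → BuiltTo (pos j i 0 k) τ) 4 200 σ refl (λ _ _ → refl)
          (λ k σ′ k<4 k≡ fr (t≡ , built′) → runs-map
            (runs-site₀ σ′ (pos j i 0 k) i₀ i j k (Inputs-kept loop₀ refl fr inputs) t≡
              (trans (natsKept fr #i₀ refl 0) i₀≡) (trans (natsKept fr #i refl 0) i≡) (trans (natsKept fr #j refl 0) j≡) k≡
              (trans (natsKept fr #g refl 0) g≡))
            λ { τ _ (t≡′ , new , keep) → BuiltTo-suc j i 0 k τ (t≡′ , append {σ′} {τ} j i 0 k i<h (s≤s z≤n) k<4 built′ new keep) })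
          built
        ⨟ λ τ fr built₀ →
        runs-for #k (lit 4) site₁ (λ k τ → BuiltTo (pos j i 1 k) τ) 4 700 τ refl (λ _ _ → refl)
          (λ k σ′ k<4 k≡ fr′ (t≡ , built′) → runs-map
            (runs-site₁ σ′ (pos j i 1 k) i₀ i j k (Inputs-kept loop₁ refl fr′ (Inputs-kept loop₀ refl fr inputs)) t≡
              (trans (natsKept fr′ #i₀ refl 0) (trans (natsKept fr #i₀ refl 0) i₀≡))
              (trans (natsKept fr′ #i refl 0) (trans (natsKept fr #i refl 0) i≡))
              (trans (natsKept fr′ #j refl 0) (trans (natsKept fr #j refl 0) j≡)) k≡
              (trans (natsKept fr′ #g refl 0) (trans (natsKept fr #g refl 0) g≡)))
            λ { τ _ (t≡′ , new , keep) → BuiltTo-suc j i 1 k τ (t≡′ , append {σ′} {τ} j i 1 k i<h (s≤s (s≤s z≤n)) k<4 built′ new keep) })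
          (subst (λ t → BuiltTo t τ) (half₀ (j ℕ.* h ℕ.+ i)) built₀)
        ⨟ λ ρ fr′ built₁ →
        assignN refl (trans (cong₂ ℕ._+_ (trans (natsKept fr′ #g refl 0) (trans (natsKept fr #g refl 0) g≡))
                          (proj₁ (Inputs-kept loop₁ refl fr′ (Inputs-kept loop₀ refl fr inputs)))) (next-row i₀ i r j))
          (subst (λ t → BuiltTo t ρ) (half₁ (j ℕ.* h) i) built₁ , refl))
        by-computation
        where
        loop₀ = for #k (lit 4) site₀
        loop₁ = for #k (lit 4) site₁

        BuiltTo-suc : ∀ j i l k τ → BuiltTo (suc (pos j i l k)) τ → BuiltTo (pos j i l (suc k)) τ
        BuiltTo-suc j i l k τ = subst (λ t → BuiltTo t τ) (sym (ℕ.+-suc (((j ℕ.* h ℕ.+ i) ℕ.* 2 ℕ.+ l) ℕ.* 4) k))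

        half₀ : ∀ c → (c ℕ.* 2 ℕ.+ 0) ℕ.* 4 ℕ.+ 4 ≡ (c ℕ.* 2 ℕ.+ 1) ℕ.* 4 ℕ.+ 0
        half₀ = solve-∀
        half₁ : ∀ c i → ((c ℕ.+ i) ℕ.* 2 ℕ.+ 1) ℕ.* 4 ℕ.+ 4 ≡ ((c ℕ.+ suc i) ℕ.* 2 ℕ.+ 0) ℕ.* 4 ℕ.+ 0
        half₁ = solve-∀
        next-row : ∀ i₀ i r j → (i₀ ℕ.+ i) ℕ.* r ℕ.+ j ℕ.+ r ≡ (i₀ ℕ.+ suc i) ℕ.* r ℕ.+ j
        next-row = solve-∀

      columnTime : ℕ
      columnTime = 7 ℕ.+ (h ℕ.* 4013 ℕ.+ 10)

      runs-buildColumn : ∀ σ j → Inputs σ → nats σ #i₀ 0 ≡ i₀ → nats σ #h 0 ≡ h → nats σ #base 0 ≡ i₀ ℕ.* r → nats σ #j 0 ≡ j → j ℕ.< r →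
        BuiltTo (pos j 0 0 0) σ → Runs buildColumn σ columnTime (BuiltTo (pos (suc j) 0 0 0))
      runs-buildColumn σ j inputs i₀≡ h≡ base≡ j≡ j<r built =
        assignN⨾ refl (trans (cong₂ ℕ._+_ base≡ j≡) (cong (λ n → n ℕ.* r ℕ.+ j) (sym (ℕ.+-identityʳ i₀))))
        (runs-map (runs-for #i (var #h) buildCell Inv h cellTime (withN σ #g 0 ((i₀ ℕ.+ 0) ℕ.* r ℕ.+ j)) refl
          (λ τ fr → trans (natsKept fr #h refl 0) h≡)
          (λ i σ′ i<h i≡ fr (built′ , g≡) → runs-map
            (runs-buildCell σ′ i j (Inputs-kept loop refl fr inputs) (trans (natsKept fr #i₀ refl 0) i₀≡) i≡
              (trans (natsKept fr #j refl 0) j≡) i<h j<r g≡ built′)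
            (λ _ _ post → post))
          (built , refl))
          λ τ _ (built′ , _) → subst (λ t → BuiltTo t τ) (column j h) built′)
        where
        loop = for #i (var #h) buildCell
        Inv : ℕ → State → Set (a ⊔ ℓ)
        Inv i τ = BuiltTo (pos j i 0 0) τ × (nats τ #g 0 ≡ (i₀ ℕ.+ i) ℕ.* r ℕ.+ j)
        column : ∀ j h → ((j ℕ.* h ℕ.+ h) ℕ.* 2 ℕ.+ 0) ℕ.* 4 ℕ.+ 0 ≡ ((suc j ℕ.* h ℕ.+ 0) ℕ.* 2 ℕ.+ 0) ℕ.* 4 ℕ.+ 0
        column = solve-∀

      buildTime : ℕ
      buildTime = 3 ℕ.+ (3 ℕ.+ ((i₀ ℕ.* 20 ℕ.+ 10) ℕ.+ (r ℕ.* (columnTime ℕ.+ 13) ℕ.+ 10)))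

      runs-build : ∀ σ → Inputs σ → nats σ #i₀ 0 ≡ i₀ → nats σ #h 0 ≡ h → Runs build σ buildTime (BuiltTo (pos r 0 0 0))
      runs-build σ inputs i₀≡ h≡ =
        assignN⨾ refl refl (assignN⨾ refl refl (
          runs-for #n (var #i₀) _ (λ n τ → nats τ #base 0 ≡ n ℕ.* r) i₀ 7 _ refl
            (λ τ fr → trans (natsKept fr #i₀ refl 0) i₀≡)
            (λ n σ′ n< n≡ fr base≡ → assignN refl
              (trans (cong₂ ℕ._+_ base≡ (trans (natsKept fr #r refl 0) (proj₁ inputs))) (ℕ.+-comm (n ℕ.* r) r)) refl)
            refl
          ⨟ λ τ fr base≡ →
          runs-for #j (var #r) buildColumn (λ j ρ → BuiltTo (pos j 0 0 0) ρ) r columnTime τ refl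
            (λ ρ fr′ → trans (natsKept fr′ #r refl 0) (trans (natsKept fr #r refl 0) (proj₁ inputs)))
            (λ j σ′ j<r j≡ fr′ built → runs-map
              (runs-buildColumn σ′ j (Inputs-kept loop refl fr′ (Inputs-kept baseLoop refl fr inputs))
                (trans (natsKept fr′ #i₀ refl 0) (trans (natsKept fr #i₀ refl 0) i₀≡))
                (trans (natsKept fr′ #h refl 0) (trans (natsKept fr #h refl 0) h≡))
                (trans (natsKept fr′ #base refl 0) base≡) j≡ j<r built)
              (λ _ _ post → post))
            (natsKept fr #T refl 0 , λ _ _ _ _ _ _ _ _ ())))
        where
        loop = for #j (var #r) buildColumn
        baseLoop = for #n (var #i₀) (#base ≔ var #base ⊕ var #r)

-- Solving one strip exactly

solveStrip : Program
solveStrip =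
  (#b ≔ doubled (doubled (doubled (var #h)))) ⨾
  powers ⨾
  build ⨾
  table ⨾
  forward

module StripSites {a ℓ} (ℝ : Reals a ℓ) (r : ℕ) .{{r≢0 : NonZero r}} (dd up lf cc : ℕ → Reals.Carrier ℝ) (i₀ h′ : ℕ) where
  open Reals ℝ
  open Semantics ℝ
  open Logic ℝ
  open OrderedField ℝ
  open SiteField ℝ
  open Building ℝ
  open Address r
  open Energy ℝ r dd up lf cc
  open Rounding ℝ r dd up lf cc

  -- The window length `suc b₀` is `8 h`, the number of sites in one column of the strip; the
  -- predecessor is named because `Window` takes a positive length in that form.
  h T₀ b₀ lo : ℕ
  h = suc h′
  T₀ = r ℕ.* h ℕ.* 2 ℕ.* 4
  b₀ = ℕ.pred (dbl (dbl (dbl h)))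
  lo = rowStart i₀

  private
    pos′ = pos r dd up lf cc i₀ h

  T₀-pos : pos′ r 0 0 0 ≡ T₀
  T₀-pos = lemma (r ℕ.* h)
    where
    lemma : ∀ x → ((x ℕ.+ 0) ℕ.* 2 ℕ.+ 0) ℕ.* 4 ℕ.+ 0 ≡ x ℕ.* 2 ℕ.* 4
    lemma = solve-∀

  record Coordinates (t : ℕ) : Set where
    constructor coordinates
    field
      {j i l k} : ℕ
      j< : j ℕ.< r
      i< : i ℕ.< h
      l< : l ℕ.< 2
      k< : k ℕ.< 4
      t≡ : t ≡ pos′ j i l k

  locate : ∀ {t} → t ℕ.< T₀ → Coordinates t
  locate {t} t< with digits-surjective (r ℕ.* h ℕ.* 2) 4 t t<
  ... | x , k , x< , k< , refl with digits-surjective (r ℕ.* h) 2 x x<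
  ... | y , l , y< , l< , refl with digits-surjective r h y y<
  ... | j , i , j< , i< , refl = coordinates j< i< l< k< refl

  pos<T₀ : ∀ {j i l k} → j ℕ.< r → i ℕ.< h → l ℕ.< 2 → k ℕ.< 4 → pos′ j i l k ℕ.< T₀
  pos<T₀ j< i< l< k< = digits< (digits< (digits< j< i<) l<) k<

  module _ (σ : State) (built : Built r dd up lf cc i₀ h T₀ σ) where

    v : ℕ → ℕ
    v = nats σ #V

    F : ℕ → (ℕ → Carrier) → Carrier
    F = siteField σ

    open Window ℝ T₀ b₀ lo v F

    siteAt : ∀ {j i l k} → j ℕ.< r → i ℕ.< h → l ℕ.< 2 → k ℕ.< 4 →
      SiteAt σ (pos′ j i l k) (addr (i₀ ℕ.+ i) j k l) (field′ (i₀ ℕ.+ i) j k l)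
    siteAt j< i< l< k< = built _ _ _ _ j< i< l< k< (pos<T₀ j< i< l< k<)

    sites-injective : ∀ {s t} → s ℕ.< T₀ → t ℕ.< T₀ → v s ≡ v t → s ≡ t
    sites-injective s< t< e with locate s< | locate t<
    ... | coordinates {i = i} j< i< l< k< refl | coordinates {i = i′} j′< i′< l′< k′< refl
      with addr-injective {i₀ ℕ.+ i} {i₀ ℕ.+ i′} j< j′< k< k′< l< l′<
             (trans (sym (proj₁ (siteAt j< i< l< k<))) (trans e (proj₁ (siteAt j′< i′< l′< k′<))))
    ... | i≡ , refl , refl , refl with ℕ.+-cancelˡ-≡ i₀ i i′ i≡
    ... | refl = refl

    site-range : ∀ {t} → t ℕ.< T₀ → (lo ℕ.≤ v t) × (v t ℕ.< rowStart (i₀ ℕ.+ h))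
    site-range t< with locate t<
    ... | coordinates {j} {i} {l} {k} j< i< l< k< refl = subst (λ z → (lo ℕ.≤ z) × (z ℕ.< rowStart (i₀ ℕ.+ h)))
      (sym (proj₁ (siteAt j< i< l< k<)))
      ( ℕ.≤-trans (rowStart-mono (ℕ.m≤m+n i₀ i)) (rowStart≤addr (i₀ ℕ.+ i) j k l)
      , ℕ.<-≤-trans (addr<rowStart (i₀ ℕ.+ i) j< k< l<)
          (rowStart-mono (ℕ.≤-trans (ℕ.≤-reflexive (sym (ℕ.+-suc i₀ i))) (ℕ.+-monoʳ-≤ i₀ i<))))

    -- In column order the upper neighbour is 8 sites back, the left neighbour `8 h`, and neighbours
    -- in the cell at most 7. In the first row of the strip the upper neighbour lies below `lo`
    -- instead and is frozen.
    field-local : ∀ {t} → t ℕ.< T₀ → ∀ X Y → Agree X Y →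
      (∀ s → s ℕ.< t → t ℕ.≤ s ℕ.+ b → X (v s) ≈ Y (v s)) → F t X ≈ F t Y
    field-local t< X Y agr window with locate t<
    ... | coordinates {j} {i} {l} {k} j< i< l< k< refl =
      ≈-trans (proj₂ (siteAt j< i< l< k<) X) (≈-trans (field-cong (i₀ ℕ.+ i) j k l< λ z rd → agreeOn refl refl rd) (≈-sym (proj₂ (siteAt j< i< l< k<) Y)))
      where
      near : ∀ {j′ i′ l′ k′ l₁} → l₁ ≡ l → j′ ℕ.< r → i′ ℕ.< h → l′ ℕ.< 2 → k′ ℕ.< 4 →
        pos′ j′ i′ l′ k′ ℕ.< pos′ j i l₁ k → pos′ j i l₁ k ℕ.≤ pos′ j′ i′ l′ k′ ℕ.+ b → X (addr (i₀ ℕ.+ i′) j′ k′ l′) ≈ Y (addr (i₀ ℕ.+ i′) j′ k′ l′)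
      near refl j′< i′< l′< k′< p< p≤ = subst (λ z → X z ≈ Y z) (proj₁ (siteAt j′< i′< l′< k′<)) (window _ p< p≤)

      8≤b : 8 ℕ.≤ b
      8≤b = subst (8 ℕ.≤_) (eight h′) (ℕ.m≤m+n 8 (8 ℕ.* h′))
        where
        eight : ∀ n → 8 ℕ.+ 8 ℕ.* n ≡ ((suc n ℕ.+ suc n) ℕ.+ (suc n ℕ.+ suc n)) ℕ.+ ((suc n ℕ.+ suc n) ℕ.+ (suc n ℕ.+ suc n))
        eight = solve-∀

      only-1 : ∀ {n} → suc n ≡ l → 1 ≡ l
      only-1 refl = cong suc (sym (ℕ.n<1⇒n≡0 (s≤s⁻¹ l<)))

      agreeOn : ∀ {q l′ z} → q ≡ i₀ ℕ.+ i → l′ ≡ l → Reads q j k l′ z → X z ≈ Y z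
      agreeOn q≡ l≡ (reads-up {i⁻}) = up-case i refl
        where
        up-case : ∀ i′ → i′ ≡ i → X (addr i⁻ j k 0) ≈ Y (addr i⁻ j k 0)
        up-case zero refl = agr _ (subst (addr i⁻ j k 0 ℕ.<_) (cong rowStart (trans q≡ (ℕ.+-identityʳ i₀))) (addr<rowStart i⁻ j< k< (s≤s z≤n)))
        up-case (suc i′) refl = subst (λ n → X (addr n j k 0) ≈ Y (addr n j k 0)) (ℕ.suc-injective (trans (sym (ℕ.+-suc i₀ i′)) (sym q≡)))
          (near l≡ j< (ℕ.<-trans (ℕ.n<1+n i′) i<) (s≤s z≤n) k<
            (subst (pos′ j i′ 0 k ℕ.<_) (sym (shift (j ℕ.* h) i′ k)) (ℕ.m<m+n _ (s≤s z≤n)))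
            (ℕ.≤-trans (ℕ.≤-reflexive (shift (j ℕ.* h) i′ k)) (ℕ.+-monoʳ-≤ _ 8≤b)))
          where
          shift : ∀ c i k → ((c ℕ.+ suc i) ℕ.* 2 ℕ.+ 0) ℕ.* 4 ℕ.+ k ≡ ((c ℕ.+ i) ℕ.* 2 ℕ.+ 0) ℕ.* 4 ℕ.+ k ℕ.+ 8
          shift = solve-∀
      agreeOn refl l≡ (reads-left {j = j⁻}) = near (only-1 l≡) (ℕ.<-trans (ℕ.n<1+n j⁻) j<) i< (s≤s (s≤s z≤n)) k<
            (subst (pos′ j⁻ i 1 k ℕ.<_) (sym (shift j⁻ h′ i k)) (ℕ.m<m+n _ (s≤s z≤n)))
            (ℕ.≤-reflexive (shift j⁻ h′ i k))
        where
        shift : ∀ j h′ i k → ((suc j ℕ.* suc h′ ℕ.+ i) ℕ.* 2 ℕ.+ 1) ℕ.* 4 ℕ.+ k ≡ ((j ℕ.* suc h′ ℕ.+ i) ℕ.* 2 ℕ.+ 1) ℕ.* 4 ℕ.+ k ℕ.+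
          (((suc h′ ℕ.+ suc h′) ℕ.+ (suc h′ ℕ.+ suc h′)) ℕ.+ ((suc h′ ℕ.+ suc h′) ℕ.+ (suc h′ ℕ.+ suc h′)))
        shift = solve-∀
      agreeOn refl l≡ (reads-cell {k₀ = k₀} k₀<) = near (only-1 l≡) j< i< (s≤s z≤n) k₀<
            (ℕ.<-≤-trans (ℕ.+-monoʳ-< ((c ℕ.* 2 ℕ.+ 0) ℕ.* 4) k₀<) (ℕ.≤-trans (ℕ.≤-reflexive (shift c)) (ℕ.m≤m+n _ k)))
            (ℕ.≤-trans (ℕ.+-monoʳ-≤ ((c ℕ.* 2 ℕ.+ 1) ℕ.* 4) (ℕ.<⇒≤ k<)) (ℕ.≤-trans (ℕ.≤-reflexive (shift′ c))
              (ℕ.+-mono-≤ (ℕ.m≤m+n ((c ℕ.* 2 ℕ.+ 0) ℕ.* 4) k₀) 8≤b)))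
        where
        c = j ℕ.* h ℕ.+ i
        shift : ∀ c → (c ℕ.* 2 ℕ.+ 0) ℕ.* 4 ℕ.+ 4 ≡ (c ℕ.* 2 ℕ.+ 1) ℕ.* 4
        shift = solve-∀
        shift′ : ∀ c → (c ℕ.* 2 ℕ.+ 1) ℕ.* 4 ℕ.+ 4 ≡ (c ℕ.* 2 ℕ.+ 0) ℕ.* 4 ℕ.+ 8
        shift′ = solve-∀

    energy-strip : ∀ X → energyBelow T₀ X ≈ strip i₀ h X
    energy-strip X =
      ≈-trans (⅀-* (r ℕ.* h ℕ.* 2) 4 f) (≈-trans (⅀-* (r ℕ.* h) 2 (λ x → ⅀ 4 λ k → f (x ℕ.* 4 ℕ.+ k)))
        (≈-trans (⅀-* r h (λ y → ⅀ 2 λ l → ⅀ 4 λ k → f ((y ℕ.* 2 ℕ.+ l) ℕ.* 4 ℕ.+ k)))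
        (≈-trans (⅀-swap r h (λ j i → ⅀ 2 λ l → ⅀ 4 λ k → f (pos′ j i l k)))
          (⅀-cong h λ i i< → ⅀-cong r λ j j< → ⅀-cong 2 λ l l< → ⅀-cong 4 λ k k< →
            *-cong (≈-reflexive (cong X (proj₁ (siteAt j< i< l< k<)))) (proj₂ (siteAt j< i< l< k<) X)))))
      where
      f : ℕ → Carrier
      f t = X (v t) * F t X

module StripProgram {a ℓ} (ℝ : Reals a ℓ) (r : ℕ) .{{r≢0 : NonZero r}} (dd up lf cc : ℕ → Reals.Carrier ℝ) (i₀ h′ : ℕ) where
  open Reals ℝ
  open Semantics ℝ
  open Logic ℝ
  open Assign ℝ
  open OrderedField ℝ
  open SiteField ℝ
  open Building ℝ
  open Address r
  open Energy ℝ r dd up lf cc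
  open Rounding ℝ r dd up lf cc
  open StripSites ℝ r dd up lf cc i₀ h′

  P₀ stripTime : ℕ
  P₀ = 2 ℕ.^ suc b₀
  stripTime = 25 ℕ.+ (powersTime (suc b₀) ℕ.+ (buildTime r dd up lf cc i₀ h ℕ.+
    (((P₀ ℕ.* 18 ℕ.+ 11) ℕ.+ (3 ℕ.+ (T₀ ℕ.* (P₀ ℕ.* (suc b₀ ℕ.* 73 ℕ.+ 160 ℕ.+ 14) ℕ.+ 31 ℕ.+ 13) ℕ.+ 10))) ℕ.+
     (3 ℕ.+ (T₀ ℕ.* 213 ℕ.+ 10)))))

  StripSolved : (X Y : ℕ → Carrier) → Set (a ⊔ ℓ)
  StripSolved X Y = (∀ z → z ℕ.< lo → Y z ≈ X z)
    × (∀ i j k l → i ℕ.< h → j ℕ.< r → k ℕ.< 4 → l ℕ.< 2 → IsSpin (Y (addr (i₀ ℕ.+ i) j k l)))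
    × (∀ Z → (∀ z → z ℕ.< lo → Z z ≈ Y z) → SpinsBetween i₀ (i₀ ℕ.+ h) Z → strip i₀ h Y ≤ strip i₀ h Z)

  runs-solveStrip : ∀ σ → Inputs r dd up lf cc σ → nats σ #i₀ 0 ≡ i₀ → nats σ #h 0 ≡ h →
    Runs solveStrip σ stripTime (λ τ → StripSolved (reals σ #X) (reals τ #X)
      × (reals τ #val 0 ≈ reals σ #val 0 + strip i₀ h (reals τ #X)))
  runs-solveStrip σ inputs i₀≡ h≡ =
    assignN⨾ refl (cong (λ n → dbl (dbl (dbl n))) h≡) (
    runs-powers (withN σ #b 0 (suc b₀)) (suc b₀) refl ⨟ λ τ₁ fr₁ pow →
    runs-build r dd up lf cc i₀ h τ₁ (Inputs-kept r dd up lf cc powers refl fr₁ inputs)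
      (trans (natsKept fr₁ #i₀ refl 0) i₀≡) (trans (natsKept fr₁ #h refl 0) h≡) ⨟ λ { τ₂ fr₂ (T≡ , built′) →
    let built : Built r dd up lf cc i₀ h T₀ τ₂
        built = subst (λ t → Built r dd up lf cc i₀ h t τ₂) T₀-pos built′
        sites : SitesIn T₀ (suc b₀) (v τ₂ built) (F τ₂ built) τ₂
        sites = trans (natsKept fr₂ #b refl 0) (natsKept fr₁ #b refl 0)
              , trans T≡ T₀-pos
              , (λ m m≤ → trans (natsKept fr₂ #pow refl m) (pow m m≤))
              -- The abstract addresses and fields are taken to be whatever `build` left in memory;
              -- `Built` relates them to the grid.
              , (λ _ → refl) , (λ _ _ → refl)
        X₂ : ∀ z → reals τ₂ #X z ≡ reals σ #X z
        X₂ z = trans (realsKept fr₂ #X refl z) (realsKept fr₁ #X refl z)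
    in rest τ₂ built sites X₂ (trans (realsKept fr₂ #val refl 0) (realsKept fr₁ #val refl 0)) })
    where
    module _ (τ₂ : State) (built : Built r dd up lf cc i₀ h T₀ τ₂) where
      open Window ℝ T₀ b₀ lo (v τ₂ built) (F τ₂ built)
      open WindowProgram ℝ T₀ b₀ lo (v τ₂ built) (F τ₂ built)

      rest : SitesIn T₀ (suc b₀) (v τ₂ built) (F τ₂ built) τ₂ → (∀ z → reals τ₂ #X z ≡ reals σ #X z) → reals τ₂ #val 0 ≡ reals σ #val 0 →
        Runs (table ⨾ forward) τ₂ _ (λ τ → StripSolved (reals σ #X) (reals τ #X)
          × (reals τ #val 0 ≈ reals σ #val 0 + strip i₀ h (reals τ #X)))
      rest sites X₂ val₂ =
        runs-table inj above loc τ₂ sites ⨟ λ { τ₃ fr₃ (off≡ , agr₃ , zeroed , layers) →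
        runs-map (runs-forward inj above loc τ₃ (reals τ₂ #X) (SitesIn-kept T₀ (suc b₀) _ _ table refl fr₃ sites) off≡ agr₃ zeroed layers)
          λ { τ₄ fr₄ (agr , spins , val , opt) →
            ( (λ z z< → ≈-trans (agr z z<) (≈-reflexive (X₂ z)))
            , (λ i j k l i< j< k< l< → subst (λ z → IsSpin (reals τ₄ #X z)) (proj₁ (siteAt τ₂ built j< i< l< k<)) (spins _ (pos<T₀ j< i< l< k<)))
            , λ Z low sp → ≤-resp₂ (energy-strip τ₂ built _) (energy-strip τ₂ built Z)
                (opt Z (λ z z< → ≈-trans (low z z<) (agr z z<)) (λ s s< → let p , q = site-range τ₂ built s< in sp _ p q)))
            , ≈-trans val (+-cong (≈-reflexive (trans (realsKept fr₃ #val refl 0) val₂)) (energy-strip τ₂ built _)) } }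
        where
        inj : ∀ {s t} → s ℕ.< T₀ → t ℕ.< T₀ → v τ₂ built s ≡ v τ₂ built t → s ≡ t
        inj = sites-injective τ₂ built
        above : ∀ {t} → t ℕ.< T₀ → lo ℕ.≤ v τ₂ built t
        above t< = proj₁ (site-range τ₂ built t<)
        loc : ∀ {t} → t ℕ.< T₀ → ∀ X Y → Agree X Y →
          (∀ s → s ℕ.< t → t ℕ.≤ s ℕ.+ b → X (v τ₂ built s) ≈ Y (v τ₂ built s)) → F τ₂ built t X ≈ F τ₂ built t Y
        loc = field-local τ₂ built

-- Monomial bound on the time for one strip

module StripTime where
  open import Data.Nat.Base using (_+_; _*_; _^_; _≤_)
  open import Data.Nat.Properties

  stripTime-expand : ∀ r i₀ h P →
    25 + ((((h + h) + (h + h)) + ((h + h) + (h + h))) * 40 + 20 + (3 + (3 + ((i₀ * 20 + 10) + (r * (7 + (h * 4013 + 10) + 13) + 10))) +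
      (((P * 18 + 11) + (3 + (r * h * 2 * 4 * (P * ((((h + h) + (h + h)) + ((h + h) + (h + h))) * 73 + 160 + 14) + 31 + 13) + 10))) +
       (3 + (r * h * 2 * 4 * 213 + 10)))))
    ≡ 108 * 1 + (320 * h + (20 * i₀ + (30 * r + (6069 * (r * h) + (18 * P + (4672 * (r * h * (P * h)) + 1392 * (r * h * P)))))))
  stripTime-expand = solve-∀

  -- Each monomial is at most `h * (r * (L * P))`, since all factors are at least 1, and 12629 is
  -- the sum of the coefficients. The factor `h` is retained so that the bounds for successive
  -- strips add up through their heights.
  stripTime-bound : ∀ {r i₀ h L P₀ P} → 1 ≤ h → h ≤ L → 1 ≤ r → i₀ ≤ r → P₀ ≤ P → 1 ≤ P →
    108 * 1 + (320 * h + (20 * i₀ + (30 * r + (6069 * (r * h) + (18 * P₀ + (4672 * (r * h * (P₀ * h)) + 1392 * (r * h * P₀)))))))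
      ≤ 12629 * (h * (r * (L * P)))
  stripTime-bound {r} {i₀} {h} {L} {P₀} {P} 1≤h h≤L 1≤r i₀≤r P₀≤P 1≤P = ≤-trans
    (+-mono-≤ (*-monoʳ-≤ 108 1≤Y) (+-mono-≤ (*-monoʳ-≤ 320 h≤Y) (+-mono-≤ (*-monoʳ-≤ 20 (≤-trans i₀≤r r≤Y)) (+-mono-≤ (*-monoʳ-≤ 30 r≤Y)
      (+-mono-≤ (*-monoʳ-≤ 6069 rh≤Y) (+-mono-≤ (*-monoʳ-≤ 18 P₀≤Y) (+-mono-≤ (*-monoʳ-≤ 4672 rhPh≤Y) (*-monoʳ-≤ 1392 rhP≤Y))))))))
    (≤-reflexive (collect Y))
    where
    Y = h * (r * (L * P))
    1≤L : 1 ≤ L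
    1≤L = ≤-trans 1≤h h≤L
    1≤LP : 1 ≤ L * P
    1≤LP = *-mono-≤ 1≤L 1≤P
    scale : ∀ {m n} → 1 ≤ n → m ≤ m * n
    scale {m} {n} 1≤n = ≤-trans (≤-reflexive (sym (*-identityʳ m))) (*-monoʳ-≤ m 1≤n)
    scaleˡ : ∀ {m n} → 1 ≤ n → m ≤ n * m
    scaleˡ {m} {n} 1≤n = ≤-trans (≤-reflexive (sym (*-identityˡ m))) (*-monoˡ-≤ m 1≤n)
    h≤Y : h ≤ Y
    h≤Y = scale (*-mono-≤ 1≤r 1≤LP)
    1≤Y : 1 ≤ Y
    1≤Y = ≤-trans 1≤h h≤Y
    r≤Y : r ≤ Y
    r≤Y = ≤-trans (scale 1≤LP) (scaleˡ 1≤h)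
    rh≤Y : r * h ≤ Y
    rh≤Y = ≤-trans (≤-reflexive (*-comm r h)) (*-monoʳ-≤ h (scale 1≤LP))
    P₀≤Y : P₀ ≤ Y
    P₀≤Y = ≤-trans P₀≤P (≤-trans (scaleˡ 1≤L) (≤-trans (scaleˡ 1≤r) (scaleˡ 1≤h)))
    rhPh≤Y : r * h * (P₀ * h) ≤ Y
    rhPh≤Y = ≤-trans (*-monoʳ-≤ (r * h) (≤-trans (*-mono-≤ P₀≤P h≤L) (≤-reflexive (*-comm P L))))
      (≤-reflexive (trans (cong (_* (L * P)) (*-comm r h)) (*-assoc h r (L * P))))
    rhP≤Y : r * h * P₀ ≤ Y
    rhP≤Y = ≤-trans (*-monoʳ-≤ (r * h) (≤-trans P₀≤P (scaleˡ 1≤L)))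
      (≤-reflexive (trans (cong (_* (L * P)) (*-comm r h)) (*-assoc h r (L * P))))
    collect : ∀ Y → 108 * Y + (320 * Y + (20 * Y + (30 * Y + (6069 * Y + (18 * Y + (4672 * Y + 1392 * Y)))))) ≡ 12629 * Y
    collect = solve-∀

  opaque
    -- Opaque so that products with it are not unfolded into sums.
    stripConstant : ℕ
    stripConstant = 12629

    stripConstant≡ : stripConstant ≡ 12629
    stripConstant≡ = refl

  module _ {a ℓ} (ℝ : Reals a ℓ) (r : ℕ) .{{r≢0 : NonZero r}} (dd up lf cc : ℕ → Reals.Carrier ℝ) (i₀ h′ : ℕ) where
    open StripProgram ℝ r dd up lf cc i₀ h′

    stripTime≤ : ∀ {L P} → suc h′ ≤ L → i₀ ≤ r → 2 ^ dbl (dbl (dbl (suc h′))) ≤ P → 1 ≤ P →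
      stripTime ≤ stripConstant * (suc h′ * (r * (L * P)))
    stripTime≤ {L} {P} h≤L i₀≤r P₀≤P 1≤P = subst (λ c → stripTime ≤ c * (suc h′ * (r * (L * P)))) (sym stripConstant≡) (≤-trans (≤-reflexive (stripTime-expand r i₀ (suc h′) (2 ^ dbl (dbl (dbl (suc h′))))))
      (stripTime-bound (s≤s z≤n) h≤L (ℕ.>-nonZero⁻¹ r) i₀≤r P₀≤P 1≤P))

open StripTime

-- Solving all strips for one offset

clipHeight : Program
clipHeight = if var #r ⊖ var #i₀ ≤ᴺ var #h then (#h ≔ var #r ⊖ var #i₀) else skip

stripsStep : Program
stripsStep =
  clipHeight ⨾
  solveStrip ⨾
  (#i₀ ≔ var #i₀ ⊕ var #h) ⨾
  (#h ≔ var #L)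

-- Cuts the rows above every row i with i ≡ o modulo L and solves the strips from top to bottom.
solveStrips : Program
solveStrips =
  (#i₀ ≔ lit 0) ⨾
  (#val ≔ᴿ 𝟎) ⨾
  -- For offset 0 the first cut below the top is at row `L`, not at row 0, so that the first strip
  -- is nonempty.
  (if lit 1 ≤ᴺ var #o then (#h ≔ var #o) else (#h ≔ var #L)) ⨾
  (while var #i₀ ⊕ lit 1 ≤ᴺ var #r loop stripsStep)

module Strips {a ℓ} (ℝ : Reals a ℓ) (r : ℕ) .{{r≢0 : NonZero r}} (dd up lf cc : ℕ → Reals.Carrier ℝ) where
  open Reals ℝ
  open Semantics ℝ
  open Logic ℝ
  open Assign ℝ
  open OrderedField ℝ
  open Building ℝ
  open Address r
  open Energy ℝ r dd up lf cc
  open Rounding ℝ r dd up lf cc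
  open Averaging ℝ r dd up lf cc using (energy)

  unaddr : ∀ n z → z ℕ.< rowStart n → ∃ λ i → ∃ λ j → ∃ λ k → ∃ λ l →
    (j ℕ.< r) × (k ℕ.< 4) × (l ℕ.< 2) × (z ≡ addr i j k l)
  unaddr n z z< with digits-surjective (n ℕ.* r ℕ.* 4) 2 z (subst (z ℕ.<_) (lemma n r) z<)
    where
    lemma : ∀ n r → n ℕ.* (r ℕ.* 8) ≡ n ℕ.* r ℕ.* 4 ℕ.* 2
    lemma = solve-∀
  ... | x , l , x< , l< , refl with digits-surjective (n ℕ.* r) 4 x x<
  ... | y , k , y< , k< , refl with digits-surjective n r y y<
  ... | i , j , i< , j< , refl = i , j , k , l , j< , k< , l< , sym (addr-digits i j k l)

  spins-between : ∀ i₀ h (X : ℕ → Carrier) →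
    (∀ i j k l → i ℕ.< h → j ℕ.< r → k ℕ.< 4 → l ℕ.< 2 → IsSpin (X (addr (i₀ ℕ.+ i) j k l))) →
    SpinsBetween i₀ (i₀ ℕ.+ h) X
  spins-between i₀ h X sp z z≥ z< with unaddr (i₀ ℕ.+ h) z z<
  ... | i , j , k , l , j< , k< , l< , refl = subst (λ n → IsSpin (X (addr n j k l))) (ℕ.m+[n∸m]≡n i₀≤i)
    (sp (i ∸ i₀) j k l (ℕ.+-cancelˡ-< i₀ (i ∸ i₀) h (subst (ℕ._< i₀ ℕ.+ h) (sym (ℕ.m+[n∸m]≡n i₀≤i)) i<)) j< k< l<)
    where
    i₀≤i : i₀ ℕ.≤ i
    i₀≤i = ℕ.≮⇒≥ λ i<i₀ → ℕ.<⇒≱ (ℕ.<-≤-trans (addr<rowStart i j< k< l<) (rowStart-mono i<i₀)) z≥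
    i< : i ℕ.< i₀ ℕ.+ h
    i< = ℕ.≰⇒> λ le → ℕ.<⇒≱ z< (ℕ.≤-trans (rowStart-mono le) (rowStart≤addr i j k l))

  -- `stepCost` is a price per row: a strip of height h is allowed h times as much, and the loop
  -- potential is the number of remaining rows times this price. The 33 covers test, clipping and
  -- bookkeeping.
  stepCost stripsTime : ℕ → ℕ
  stepCost L = stripConstant ℕ.* (r ℕ.* (L ℕ.* 2 ℕ.^ dbl (dbl (dbl L)))) ℕ.+ 33
  stripsTime L = r ℕ.* stepCost L ℕ.+ 30

  module _ (L o : ℕ) .{{_ : NonZero L}} where

    private
      P K : ℕ
      P = 2 ℕ.^ dbl (dbl (dbl L))
      K = stepCost L

    -- The competitors against which the strip-by-strip solution is optimal.
    Admissible : Config → Set ℓ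
    Admissible M = (∀ z → IsTrit (M z)) × (∀ i → i ℕ.< r → 0 ℕ.< i → i % L ≡ o → VanishesOnRow M i)

    record Solved (i₀ : ℕ) (X : Config) (val : Carrier) : Set (a ⊔ ℓ) where
      field
        value   : val ≈ strip 0 i₀ X
        spins   : SpinsBetween 0 i₀ X
        optimal : ∀ M → Admissible M → strip 0 i₀ X ≤ strip 0 i₀ M

    -- Here `h` is the height before clipping at the bottom: the strip starts at the top or at a cut
    -- row and would end just above a cut row. Once a strip has been clipped the grid is exhausted,
    -- which is the first alternative.
    Cut : ℕ → ℕ → Set
    Cut i₀ h = (i₀ ≡ r) ⊎ ((1 ℕ.≤ h) × (h ℕ.≤ L) × ((i₀ ≡ 0) ⊎ (i₀ % L ≡ o)) × ((i₀ ℕ.+ h) % L ≡ o))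

    solved-nothing : ∀ X → Solved 0 X 0#
    solved-nothing X = record
      { value = ≈-sym ⅀-0 ; spins = λ _ _ () ; optimal = λ M _ → ≤-reflexive (≈-trans ⅀-0 (≈-sym ⅀-0)) }

    -- Both energies split at the cut. The earlier strips are left untouched, and `strip-bound`
    -- compares the new one with every admissible `M` regardless of the spins above, so optimality
    -- adds up.
    solved-strip : ∀ {i₀ h′ X val Y val′} → i₀ ℕ.< r → (i₀ ≡ 0) ⊎ (i₀ % L ≡ o) → Solved i₀ X val →
      StripProgram.StripSolved ℝ r dd up lf cc i₀ h′ X Y → val′ ≈ val + strip i₀ (suc h′) Y → Solved (i₀ ℕ.+ suc h′) Y val′
    solved-strip {i₀} {h′} {X} {val} {Y} {val′} i₀<r cut solved (same , sp , opt) val≈ = record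
      { value = ≈-trans val≈ (≈-trans (+-congʳ (≈-trans value (≈-sym old))) (≈-sym (split Y)))
      ; spins = spins′
      ; optimal = λ M adm → ≤-resp₂ (≈-sym (≈-trans (split Y) (+-congʳ old))) (≈-sym (split M))
          (+-mono-≤ (optimal M adm) (strip-bound i₀ h Y M (proj₁ adm) (vanish M adm cut) opt))
      }
      where
      open Solved solved
      h = suc h′
      old : strip 0 i₀ Y ≈ strip 0 i₀ X
      old = strip-cong 0 i₀ same
      split : ∀ Z → strip 0 (i₀ ℕ.+ h) Z ≈ strip 0 i₀ Z + strip i₀ h Z
      split Z = subst (λ n → strip 0 n Z ≈ strip 0 i₀ Z + strip i₀ h Z) (ℕ.+-comm h i₀) (strip-+ i₀ h Z)
      spins′ : SpinsBetween 0 (i₀ ℕ.+ h) Y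
      spins′ z z≥ z< with z ℕ.<? rowStart i₀
      ... | yes z<lo = IsSpin-resp (≈-sym (same z z<lo)) (spins z z≥ z<lo)
      ... | no z≮lo = spins-between i₀ h Y sp z (ℕ.≮⇒≥ z≮lo) z<
      vanish : ∀ M → Admissible M → (i₀ ≡ 0) ⊎ (i₀ % L ≡ o) → (i₀ ≡ 0) ⊎ VanishesOnRow M i₀
      vanish M adm (inj₁ e) = inj₁ e
      vanish M adm (inj₂ e) with i₀ ℕ.≟ 0
      ... | yes z = inj₁ z
      ... | no nz = inj₂ (proj₂ adm i₀ i₀<r (ℕ.n≢0⇒n>0 nz) e)

    Inv : State → Set (a ⊔ ℓ)
    Inv τ = Inputs r dd up lf cc τ × (nats τ #L 0 ≡ L) × (nats τ #i₀ 0 ℕ.≤ r)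
      × Cut (nats τ #i₀ 0) (nats τ #h 0) × Solved (nats τ #i₀ 0) (reals τ #X) (reals τ #val 0)

    Φ : State → ℕ
    Φ τ = (r ∸ nats τ #i₀ 0) ℕ.* K

    pay : ∀ i₀ h s → i₀ ℕ.+ h ℕ.≤ r → 1 ℕ.≤ h → s ℕ.≤ stripConstant ℕ.* (h ℕ.* (r ℕ.* (L ℕ.* P))) →
      7 ℕ.+ (15 ℕ.+ (s ℕ.+ (7 ℕ.+ 4))) ℕ.+ (r ∸ (i₀ ℕ.+ h)) ℕ.* K ℕ.≤ (r ∸ i₀) ℕ.* K
    pay i₀ h s le 1≤h s≤ = subst (λ n → 7 ℕ.+ (15 ℕ.+ (s ℕ.+ (7 ℕ.+ 4))) ℕ.+ x ℕ.* K ℕ.≤ n ℕ.* K) (sym rest)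
      (ℕ.≤-trans (ℕ.+-monoˡ-≤ (x ℕ.* K) (ℕ.≤-trans (ℕ.≤-reflexive (shuffle s))
        (ℕ.≤-trans (ℕ.+-mono-≤ s≤ (subst (33 ℕ.≤_) (ℕ.*-comm 33 h) (ℕ.*-monoʳ-≤ 33 1≤h))) (ℕ.≤-reflexive (factor stripConstant h (r ℕ.* (L ℕ.* P)))))))
        (ℕ.≤-reflexive (sym (ℕ.*-distribʳ-+ K h x))))
      where
      x = r ∸ (i₀ ℕ.+ h)
      rest : r ∸ i₀ ≡ h ℕ.+ x
      rest = trans (cong (_∸ i₀) (sym (ℕ.m+[n∸m]≡n le))) (trans (cong (_∸ i₀) (ℕ.+-assoc i₀ h x)) (ℕ.m+n∸m≡n i₀ (h ℕ.+ x)))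
      shuffle : ∀ s → 7 ℕ.+ (15 ℕ.+ (s ℕ.+ (7 ℕ.+ 4))) ≡ s ℕ.+ 33
      shuffle = solve-∀
      factor : ∀ c h y → c ℕ.* (h ℕ.* y) ℕ.+ h ℕ.* 33 ≡ h ℕ.* (c ℕ.* y ℕ.+ 33)
      factor = solve-∀

    runs-stripsStep : ∀ σ → Inv σ → nats σ #i₀ 0 ℕ.< r →
      ∃ λ B → Runs stripsStep σ B (λ τ → Inv τ × 7 ℕ.+ B ℕ.+ Φ τ ℕ.≤ Φ σ)
    runs-stripsStep σ (inputs , L≡ , i₀≤r , inj₁ i₀≡r , solved) i₀<r = ⊥-elim (ℕ.<⇒≢ i₀<r i₀≡r)
    runs-stripsStep σ (inputs , L≡ , i₀≤r , inj₂ (1≤h , h≤L , cut , end) , solved) i₀<r = go h refl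
      where
      i₀ = nats σ #i₀ 0
      h = (r ∸ i₀) ⊓ nats σ #h 0

      r≡ : nats σ #r 0 ≡ r
      r≡ = proj₁ inputs

      clip : Runs clipHeight σ 15 (λ τ → nats τ #h 0 ≡ h)
      clip = runs-if {B₀ = 7}
        (λ e → assignN refl (cong (_∸ i₀) r≡)
          (sym (ℕ.m≤n⇒m⊓n≡m (subst (λ n → n ∸ i₀ ℕ.≤ nats σ #h 0) r≡ (test-true (_ ℕ.≤? _) e)))))
        (λ e → runs-≤ (runs-skip (sym (ℕ.m≥n⇒m⊓n≡n (ℕ.<⇒≤ (ℕ.≰⇒> (λ le → test-false (_ ℕ.≤? _) e (subst (λ n → n ∸ i₀ ℕ.≤ nats σ #h 0) (sym r≡) le)))))))
                 by-computation)

      1≤r∸i₀ : 1 ℕ.≤ r ∸ i₀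
      1≤r∸i₀ = ℕ.m<n⇒0<n∸m i₀<r

      go : ∀ h₁ → h₁ ≡ (r ∸ i₀) ⊓ nats σ #h 0 → ∃ λ B → Runs stripsStep σ B (λ τ → Inv τ × 7 ℕ.+ B ℕ.+ Φ τ ℕ.≤ Φ σ)
      go zero    e = ⊥-elim (ℕ.<⇒≢ (ℕ.⊓-pres-m< 1≤r∸i₀ 1≤h) e)
      go (suc h′) e = 15 ℕ.+ (stripTime ℕ.+ (7 ℕ.+ 4)) ,
        (clip ⨟ λ τ₁ fr₁ h≡ →
        runs-solveStrip τ₁ (Inputs-kept r dd up lf cc clipHeight refl fr₁ inputs) (natsKept fr₁ #i₀ refl 0) (trans h≡ (sym e)) ⨟ λ { τ₂ fr₂ (stripSolved , val≈) →
        assignN⨾ refl (cong₂ ℕ._+_ (trans (natsKept fr₂ #i₀ refl 0) (natsKept fr₁ #i₀ refl 0))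
                          (trans (natsKept fr₂ #h refl 0) (trans h≡ (sym e))))
        (assignN refl (trans (natsKept fr₂ #L refl 0) (trans (natsKept fr₁ #L refl 0) L≡))
          (( Inputs-kept r dd up lf cc solveStrip refl fr₂ (Inputs-kept r dd up lf cc clipHeight refl fr₁ inputs)
           , trans (natsKept fr₂ #L refl 0) (trans (natsKept fr₁ #L refl 0) L≡)
           , i₁≤r , nextCut
           , solved-strip i₀<r cut solved
               ( (λ z z< → ≈-trans (proj₁ stripSolved z z<) (≈-reflexive (realsKept fr₁ #X refl z))) , proj₁ (proj₂ stripSolved) , proj₂ (proj₂ stripSolved))
               (≈-trans val≈ (+-congʳ (≈-reflexive (realsKept fr₁ #val refl 0)))))
          , pay i₀ (suc h′) stripTime i₁≤r (s≤s z≤n) (stripTime≤ ℝ r dd up lf cc i₀ h′ {L} {P} h₁≤L i₀≤r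
              (ℕ.^-monoʳ-≤ 2 (dbl-mono (dbl-mono (dbl-mono h₁≤L)))) (ℕ.m^n>0 2 (dbl (dbl (dbl L)))))))})
        where
        open StripProgram ℝ r dd up lf cc i₀ h′
        dbl-mono : ∀ {m n} → m ℕ.≤ n → dbl m ℕ.≤ dbl n
        dbl-mono le = ℕ.+-mono-≤ le le
        h₁≤L : suc h′ ℕ.≤ L
        h₁≤L = subst (ℕ._≤ L) (sym e) (ℕ.≤-trans (ℕ.m⊓n≤n (r ∸ i₀) (nats σ #h 0)) h≤L)
        i₁≤r : i₀ ℕ.+ suc h′ ℕ.≤ r
        i₁≤r = ℕ.≤-trans (ℕ.+-monoʳ-≤ i₀ (subst (ℕ._≤ r ∸ i₀) (sym e) (ℕ.m⊓n≤m (r ∸ i₀) (nats σ #h 0)))) (ℕ.≤-reflexive (ℕ.m+[n∸m]≡n i₀≤r))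
        nextCut : Cut (i₀ ℕ.+ suc h′) L
        nextCut with ℕ.≤-total (r ∸ i₀) (nats σ #h 0)
        ... | inj₁ le = inj₁ (trans (cong (i₀ ℕ.+_) (trans e (ℕ.m≤n⇒m⊓n≡m le))) (ℕ.m+[n∸m]≡n i₀≤r))
        ... | inj₂ ge = inj₂ (ℕ.>-nonZero⁻¹ L , ℕ.≤-refl , inj₂ end′ , trans ([m+n]%n≡m%n (i₀ ℕ.+ suc h′) L) end′)
          where
          end′ : (i₀ ℕ.+ suc h′) % L ≡ o
          end′ = trans (cong (λ n → (i₀ ℕ.+ n) % L) (trans e (ℕ.m≥n⇒m⊓n≡n ge))) end

    runs-solveStrips : ∀ σ → o ℕ.< L → Inputs r dd up lf cc σ → nats σ #L 0 ≡ L → nats σ #o 0 ≡ o →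
      Runs solveStrips σ (stripsTime L) (λ τ → Solved r (reals τ #X) (reals τ #val 0))
    runs-solveStrips σ o<L inputs L≡ o≡ = runs-≤
      (assignN⨾ refl refl (assignR⨾ refl refl (firstCut ⨟ λ { τ fr (cut) →
        runs-⇒
          (runs-while Inv Φ τ
            (λ σ′ inv e → runs-stripsStep σ′ inv (subst₂ ℕ._≤_ (ℕ.+-comm (nats σ′ #i₀ 0) 1) (proj₁ (proj₁ inv)) (test-true (_ ℕ.≤? _) e)))
            (start τ fr cut))
          (ℕ.+-monoˡ-≤ 7 (ℕ.*-monoˡ-≤ K (ℕ.m∸n≤m r (nats τ #i₀ 0))))
          (λ ρ _ (inv , e) → finish ρ inv e) })))
      (ℕ.≤-trans (ℕ.≤-reflexive (shuffle (r ℕ.* K))) (ℕ.+-monoʳ-≤ (r ℕ.* K) by-computation))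
      where
      shuffle : ∀ x → 3 ℕ.+ (3 ℕ.+ (8 ℕ.+ (x ℕ.+ 7))) ≡ x ℕ.+ 21
      shuffle = solve-∀
      σ₁ = withR (withN σ #i₀ 0 0) #val 0 0#
      first = if lit 1 ≤ᴺ var #o then (#h ≔ var #o) else (#h ≔ var #L)

      firstCut : Runs first σ₁ 8 (λ τ → Cut 0 (nats τ #h 0))
      firstCut = runs-if {B₀ = 4}
        (λ e → assignN refl o≡ (inj₂ (subst (1 ℕ.≤_) o≡ (test-true (_ ℕ.≤? _) e) , ℕ.<⇒≤ o<L , inj₁ refl , m<n⇒m%n≡m o<L)))
        (λ e → assignN refl L≡ (inj₂ (ℕ.>-nonZero⁻¹ L , ℕ.≤-refl , inj₁ refl ,
          trans (n%n≡0 L) (sym (ℕ.n<1⇒n≡0 (ℕ.≰⇒> (λ le → test-false (_ ℕ.≤? _) e (subst (1 ℕ.≤_) (sym o≡) le))))))))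

      start : ∀ τ → Frame first σ₁ τ → Cut 0 (nats τ #h 0) → Inv τ
      start τ fr cut = Inputs-kept r dd up lf cc first refl fr inputs , trans (natsKept fr #L refl 0) L≡
        , subst (ℕ._≤ r) (sym i≡0) z≤n , subst (λ n → Cut n (nats τ #h 0)) (sym i≡0) cut
        , subst₂ (λ n v → Solved n (reals τ #X) v) (sym i≡0) (sym (realsKept fr #val refl 0)) (solved-nothing (reals τ #X))
        where
        i≡0 : nats τ #i₀ 0 ≡ 0
        i≡0 = natsKept fr #i₀ refl 0

      finish : ∀ ρ → Inv ρ → _ → Solved r (reals ρ #X) (reals ρ #val 0)
      finish ρ (inputs , _ , i₀≤r , _ , solved) e = subst (λ n → Solved n (reals ρ #X) (reals ρ #val 0)) i≡r solved
        where
        i≡r : nats ρ #i₀ 0 ≡ r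
        i≡r = ℕ.≤-antisym i₀≤r (s≤s⁻¹ (ℕ.≰⇒> (λ le → test-false (nats ρ #i₀ 0 ℕ.+ 1 ℕ.≤? nats ρ #r 0) e
          (subst₂ ℕ._≤_ (ℕ.+-comm 1 (nats ρ #i₀ 0)) (sym (proj₁ inputs)) le))))

-- The whole program: strip height, search over offsets, output

-- The least L ≥ 2 with L ≥ r or L ε ≥ 2.
chooseHeight : Program
chooseHeight =
  (#L ≔ lit 2) ⨾
  (#sum ≔ᴿ varᴿ #ε ⊞ varᴿ #ε) ⨾
  (while (var #L ⊕ lit 1 ≤ᴺ var #r) ∧ᵀ notᵀ (𝟏 ⊞ 𝟏 ≤ᴿ varᴿ #sum) loop
    ((#L ≔ var #L ⊕ lit 1) ⨾ (#sum ≔ᴿ varᴿ #ε ⊞ varᴿ #sum)))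

countVertices : Program
countVertices = (#N ≔ lit 0) ⨾ for #n (var #r) (#N ≔ doubled (doubled (doubled (var #r))) ⊕ var #N)

copySpin : Program
copySpin = if 𝟎 ≤ᴿ R #X [ var #z ] then (N #out [ var #z ]≔ lit 1) else (N #out [ var #z ]≔ lit 0)

recordBest : Program
recordBest =
  if varᴿ #val ≤ᴿ varᴿ #best
  then ((#best ≔ᴿ varᴿ #val) ⨾ for #z (var #N) copySpin)
  else skip

afterHeight : Program
afterHeight =
  countVertices ⨾
  -- Zero is a safe start: the zero configuration is admissible for every offset, so the first
  -- solution has energy at most 0 and is certain to be recorded.
  (#best ≔ᴿ 𝟎) ⨾
  for #o (var #L) (solveStrips ⨾ recordBest)

approximate : Program
approximate = chooseHeight ⨾ afterHeight

∧-true : ∀ {x y} → x ∧ y ≡ true → (x ≡ true) × (y ≡ true)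
∧-true {true} {true} _ = refl , refl

∧-false : ∀ {x y} → x ∧ y ≡ false → (x ≡ false) ⊎ (y ≡ false)
∧-false {false} _ = inj₁ refl
∧-false {true}  e = inj₂ e

not-true : ∀ {x} → not x ≡ true → x ≡ false
not-true {false} _ = refl

not-false : ∀ {x} → not x ≡ false → x ≡ true
not-false {true} _ = refl

module Main {a ℓ} (ℝ : Reals a ℓ) (r : ℕ) .{{r≢0 : NonZero r}} (dd up lf cc : ℕ → Reals.Carrier ℝ) (ε : Reals.Carrier ℝ) where
  open Reals ℝ
  open Hamiltonian ℝ using (spin)
  open InputOutput ℝ using (toSign)
  open Semantics ℝ
  open Logic ℝ
  open For ℝ
  open Assign ℝ
  open OrderedField ℝ
  open Building ℝ
  open Address r
  open Energy ℝ r dd up lf cc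
  open Rounding ℝ r dd up lf cc
  open Averaging ℝ r dd up lf cc using (energy)
  open Strips ℝ r dd up lf cc using (Admissible; Solved; module Solved; stripsTime; runs-solveStrips)

  -- The three parts serve the averaging over offsets, the approximation ratio and the running time,
  -- respectively. The last one is the minimality of `L`.
  GoodHeight : ℕ → Set ℓ
  GoodHeight L = (2 ℕ.≤ L) × ((r ℕ.≤ L) ⊎ (1# + 1# ≤ L · ε)) × ((L ≡ 2) ⊎ ¬ (1# + 1# ≤ (L ∸ 1) · ε))

  heightTime : ℕ
  heightTime = r ℕ.* 30 ℕ.+ 30

  runs-chooseHeight : ∀ σ → nats σ #r 0 ≡ r → reals σ #ε 0 ≡ ε → Runs chooseHeight σ heightTime (λ τ → GoodHeight (nats τ #L 0))
  runs-chooseHeight σ r≡ ε≡ = runs-≤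
    (assignN⨾ refl refl (assignR⨾ refl refl (runs-⇒
      (runs-while Inv Φ _ step
        (r≡ , ε≡ , s≤s (s≤s z≤n) , ≈-trans (≈-reflexive (cong₂ _+_ ε≡ ε≡)) (+-congˡ (≈-sym (+-identityʳ ε))) , inj₁ refl))
      (ℕ.+-monoˡ-≤ 15 (ℕ.*-monoˡ-≤ 30 (ℕ.m∸n≤m r 2)))
      (λ { τ _ ((r≡ , _ , 2≤L , sum≈ , low) , e) → 2≤L , stop τ r≡ sum≈ (∧-false e) , low }))))
    (ℕ.≤-trans (ℕ.≤-reflexive (shuffle (r ℕ.* 30))) (ℕ.+-monoʳ-≤ (r ℕ.* 30) by-computation))
    where
    shuffle : ∀ x → 3 ℕ.+ (7 ℕ.+ (x ℕ.+ 15)) ≡ x ℕ.+ 25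
    shuffle = solve-∀

    Φ : State → ℕ
    Φ τ = (r ∸ nats τ #L 0) ℕ.* 30

    Inv : State → Set (a ⊔ ℓ)
    Inv τ = (nats τ #r 0 ≡ r) × (reals τ #ε 0 ≡ ε) × (2 ℕ.≤ nats τ #L 0) × (reals τ #sum 0 ≈ nats τ #L 0 · ε)
      × ((nats τ #L 0 ≡ 2) ⊎ ¬ (1# + 1# ≤ (nats τ #L 0 ∸ 1) · ε))

    stop : ∀ τ → nats τ #r 0 ≡ r → reals τ #sum 0 ≈ nats τ #L 0 · ε →
      (⟦ var #L ⊕ lit 1 ≤ᴺ var #r ⟧ᵀ τ ≡ false) ⊎ (⟦ notᵀ (𝟏 ⊞ 𝟏 ≤ᴿ varᴿ #sum) ⟧ᵀ τ ≡ false) →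
      (r ℕ.≤ nats τ #L 0) ⊎ (1# + 1# ≤ nats τ #L 0 · ε)
    stop τ r≡ sum≈ (inj₁ e) = inj₁ (subst (ℕ._≤ nats τ #L 0) r≡ (s≤s⁻¹ (subst (suc (nats τ #r 0) ℕ.≤_) (ℕ.+-comm _ 1) (ℕ.≰⇒> (test-false (_ ℕ.≤? _) e)))))
    stop τ r≡ sum≈ (inj₂ e) = inj₂ (≤-respʳ-≈ sum≈ (test-true (_ ≤? _) (not-false e)))

    test : Test
    test = (var #L ⊕ lit 1 ≤ᴺ var #r) ∧ᵀ notᵀ (𝟏 ⊞ 𝟏 ≤ᴿ varᴿ #sum)

    step : ∀ σ → Inv σ → ⟦ test ⟧ᵀ σ ≡ true →
      ∃ λ B → Runs ((#L ≔ var #L ⊕ lit 1) ⨾ (#sum ≔ᴿ varᴿ #ε ⊞ varᴿ #sum)) σ B (λ τ → Inv τ × 15 ℕ.+ B ℕ.+ Φ τ ℕ.≤ Φ σ)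
    step σ (r≡ , ε≡ , 2≤L , sum≈ , low) e = 13 , assignN⨾ refl (ℕ.+-comm (nats σ #L 0) 1) (assignR refl refl
      ((r≡ , ε≡ , ℕ.m≤n⇒m≤1+n 2≤L , +-cong (≈-reflexive ε≡) sum≈
       , inj₂ (λ le → test-false (_ ≤? _) (not-true (proj₂ (∧-true e))) (≤-respʳ-≈ (≈-sym sum≈) le)))
      , ℕ.≤-trans (ℕ.+-monoˡ-≤ ((r ∸ suc (nats σ #L 0)) ℕ.* 30) (by-computation {28} {30}))
          (ℕ.≤-reflexive (cong (ℕ._* 30) (sym (∸-suc (subst₂ ℕ._≤_ (ℕ.+-comm (nats σ #L 0) 1) r≡ (test-true (_ ℕ.≤? _) (proj₁ (∧-true e))))))))))

  runs-countVertices : ∀ σ → nats σ #r 0 ≡ r → Runs countVertices σ (3 ℕ.+ (r ℕ.* 41 ℕ.+ 10)) (λ τ → nats τ #N 0 ≡ rowStart r)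
  runs-countVertices σ r≡ = assignN⨾ refl refl (runs-map
    (runs-for #n (var #r) _ (λ n τ → nats τ #N 0 ≡ n ℕ.* dbl (dbl (dbl r))) r 28 _ refl
      (λ τ fr → trans (natsKept fr #r refl 0) r≡)
      (λ n σ′ _ _ fr N≡ → assignN refl (cong₂ (λ x y → dbl (dbl (dbl x)) ℕ.+ y) (trans (natsKept fr #r refl 0) r≡) N≡) refl)
      refl)
    λ τ _ N≡ → trans N≡ (cong (r ℕ.*_) (eight r)))
    where
    eight : ∀ r → ((r ℕ.+ r) ℕ.+ (r ℕ.+ r)) ℕ.+ ((r ℕ.+ r) ℕ.+ (r ℕ.+ r)) ≡ r ℕ.* 8
    eight = solve-∀

  0≤1 : 0# ≤ 1#
  0≤1 with 0# ≤? 1#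
  ... | yes p = p
  ... | no n = ≤-respʳ-≈ (≈-trans (-1*x≈-x (- 1#)) (-‿involutive 1#)) (*-nonNeg 0≤-1 0≤-1)
    where
    0≤-1 : 0# ≤ - 1#
    0≤-1 = ≤-respˡ-≈ -0#≈0# (neg-mono-≤ (≰⇒≥ n))

  0≰-1 : ¬ (0# ≤ - 1#)
  0≰-1 p = 0≉1 (antisym 0≤1 (≤-resp₂ (-‿involutive 1#) -0#≈0# (neg-mono-≤ p)))

  written : State → Config
  written τ z = spin (toSign (nats τ #out z))

  runs-copy : ∀ σ n → nats σ #N 0 ≡ n → (∀ z → z ℕ.< n → IsSpin (reals σ #X z)) →
    Runs (for #z (var #N) copySpin) σ (n ℕ.* 22 ℕ.+ 10) (λ τ → ∀ z → z ℕ.< n → written τ z ≈ reals σ #X z)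
  runs-copy σ n N≡ spins = runs-map (runs-for #z (var #N) copySpin (λ k τ → ∀ z → z ℕ.< k → written τ z ≈ reals σ #X z) n 9 σ refl
      (λ τ fr → trans (natsKept fr #N refl 0) N≡)
      (λ k σ′ k<n k≡ fr inv → runs-if {B₀ = 4}
        (λ e → assignN k≡ refl (extend σ′ inv 1 (≈-sym (positive (spins k k<n) (subst (0# ≤_) (trans (cong (reals σ′ #X) k≡) (realsKept fr #X refl k)) (test-true (_ ≤? _) e))))))
        (λ e → assignN k≡ refl (extend σ′ inv 0 (≈-sym (negative (spins k k<n) λ le → test-false (_ ≤? _) e (subst (0# ≤_) (sym (trans (cong (reals σ′ #X) k≡) (realsKept fr #X refl k))) le))))))
      (λ _ ()))
    (λ _ _ p → p)
    where
    positive : ∀ {x} → IsSpin x → 0# ≤ x → x ≈ 1#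
    positive (inj₁ e) _ = e
    positive (inj₂ e) p = ⊥-elim (0≰-1 (≤-respʳ-≈ e p))
    negative : ∀ {x} → IsSpin x → ¬ (0# ≤ x) → x ≈ - 1#
    negative (inj₁ e) n = ⊥-elim (n (≤-respʳ-≈ (≈-sym e) 0≤1))
    negative (inj₂ e) _ = e
    extend : ∀ {k} σ′ → (∀ z → z ℕ.< k → written σ′ z ≈ reals σ #X z) → ∀ v → spin (toSign v) ≈ reals σ #X k →
      ∀ z → z ℕ.< suc k → spin (toSign (write (nats σ′) #out k v #out z)) ≈ reals σ #X z
    extend {k} σ′ inv v e z z<sk with z ℕ.≟ k
    ... | yes refl = ≈-trans (≈-reflexive (cong (λ n → spin (toSign n)) (write-same (nats σ′) #out {k} v refl))) e
    ... | no ne = ≈-trans (≈-reflexive (cong (λ n → spin (toSign n)) (write-other (nats σ′) #out v (λ e → ne (sym e))))) (inv z (ℕ.≤∧≢⇒< (s≤s⁻¹ z<sk) ne))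

  energy-zero : energy (λ _ → 0#) ≈ 0#
  energy-zero = ⅀-≈0 r λ i _ → row-zero i λ _ _ _ → ≈-refl

  module _ (L : ℕ) .{{_ : NonZero L}} where

    bestTime searchTime restTime : ℕ
    bestTime = 5 ℕ.+ (4 ℕ.+ (rowStart r ℕ.* 22 ℕ.+ 10))
    searchTime = L ℕ.* ((stripsTime L ℕ.+ bestTime) ℕ.+ 13) ℕ.+ 10
    restTime = (3 ℕ.+ (r ℕ.* 41 ℕ.+ 10)) ℕ.+ (3 ℕ.+ searchTime)

    Beats : ℕ → Carrier → Set (a ⊔ ℓ)
    Beats o best = ∀ o′ → o′ ℕ.< o → ∀ M → Admissible L o′ M → best ≤ energy M

    Inv : ℕ → State → Set (a ⊔ ℓ)
    Inv o τ = Beats o (reals τ #best 0) × (((o ≡ 0) × (reals τ #best 0 ≈ 0#)) ⊎ (reals τ #best 0 ≈ energy (written τ)))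

    runs-round : ∀ σ o → o ℕ.< L → Inputs r dd up lf cc σ → nats σ #L 0 ≡ L → nats σ #o 0 ≡ o → nats σ #N 0 ≡ rowStart r → Inv o σ →
      Runs (solveStrips ⨾ recordBest) σ (stripsTime L ℕ.+ bestTime) (Inv (suc o))
    runs-round σ o o<L inputs L≡ o≡ N≡ (beats , status) =
      runs-solveStrips L o σ o<L inputs L≡ o≡ ⨟ λ τ fr solved →
      let open Solved solved
          X = reals τ #X
          best≡ : reals τ #best 0 ≡ reals σ #best 0
          best≡ = realsKept fr #best refl 0
          extend : ∀ {c} → c ≤ reals σ #best 0 → c ≤ reals τ #val 0 → Beats (suc o) c
          extend = beats-suc τ solved
      in
      runs-if {B₀ = 4 ℕ.+ (rowStart r ℕ.* 22 ℕ.+ 10)}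
        (λ e → let val≤best = test-true (_ ≤? _) e in
          assignR⨾ refl refl (runs-map (runs-copy (withR τ #best 0 (reals τ #val 0)) (rowStart r) (trans (natsKept fr #N refl 0) N≡) (λ z z< → spins z z≤n z<))
            λ ρ fr′ out≈ → (λ o′ o′< M adm → ≤-respˡ-≈ (≈-reflexive (sym (realsKept fr′ #best refl 0)))
                               (extend (≤-respʳ-≈ (≈-reflexive best≡) val≤best) ≤-refl o′ o′< M adm))
              , inj₂ (≈-trans (≈-reflexive (realsKept fr′ #best refl 0)) (≈-trans value (strip-cong 0 r λ z z< → ≈-sym (out≈ z z<))))))
        (λ e → let best≤val = ≰⇒≥ (test-false (_ ≤? _) e) in
          runs-≤ (runs-skip
            ( (λ o′ o′< M adm → ≤-respˡ-≈ (≈-reflexive (sym best≡)) (extend ≤-refl (≤-respˡ-≈ (≈-reflexive best≡) best≤val) o′ o′< M adm))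
            , inj₂ (≈-trans (≈-reflexive best≡) (≈-trans (already τ solved best≡ (test-false (_ ≤? _) e) status)
                (strip-cong 0 r λ z _ → ≈-reflexive (cong (λ n → spin (toSign n)) (sym (natsKept fr #out refl z))))))))
            (s≤s z≤n))
      where
      beats-suc : ∀ τ → Solved L o r (reals τ #X) (reals τ #val 0) → ∀ {c} → c ≤ reals σ #best 0 → c ≤ reals τ #val 0 → Beats (suc o) c
      beats-suc τ solved c≤best c≤val o′ o′<so M adm with o′ ℕ.≟ o
      ... | yes refl = ≤-trans c≤val (≤-respˡ-≈ (≈-sym (Solved.value solved)) (Solved.optimal solved M adm))
      ... | no ne = ≤-trans c≤best (beats o′ (ℕ.≤∧≢⇒< (s≤s⁻¹ o′<so) ne) M adm)

      already : ∀ τ → Solved L o r (reals τ #X) (reals τ #val 0) → reals τ #best 0 ≡ reals σ #best 0 → ¬ (reals τ #val 0 ≤ reals τ #best 0) →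
        ((o ≡ 0) × (reals σ #best 0 ≈ 0#)) ⊎ (reals σ #best 0 ≈ energy (written σ)) → reals σ #best 0 ≈ energy (written σ)
      already τ solved best≡ val≰best (inj₂ e) = e
      already τ solved best≡ val≰best (inj₁ (_ , best≈0)) = ⊥-elim (val≰best (≤-resp₂ (≈-sym (Solved.value solved))
        (≈-trans energy-zero (≈-sym (≈-trans (≈-reflexive best≡) best≈0)))
        (Solved.optimal solved (λ _ → 0#) ((λ _ → inj₂ ≈-refl) , λ _ _ _ _ _ _ _ → ≈-refl))))

    runs-rest : ∀ σ → Inputs r dd up lf cc σ → nats σ #L 0 ≡ L →
      Runs afterHeight σ restTime
        (λ τ → ∃ λ best → Beats L best × (best ≈ energy (written τ)))
    runs-rest σ inputs L≡ =
      runs-countVertices σ (proj₁ inputs) ⨟ λ τ fr N≡ →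
      assignR⨾ refl refl (runs-map
        (runs-for #o (var #L) (solveStrips ⨾ recordBest) Inv L (stripsTime L ℕ.+ bestTime) (withR τ #best 0 0#) refl
          (λ ρ fr′ → trans (natsKept fr′ #L refl 0) (trans (natsKept fr #L refl 0) L≡))
          (λ o σ′ o<L o≡ fr′ inv → runs-map
            (runs-round σ′ o o<L (Inputs-kept r dd up lf cc loop refl fr′ (Inputs-kept r dd up lf cc countVertices refl fr inputs))
              (trans (natsKept fr′ #L refl 0) (trans (natsKept fr #L refl 0) L≡)) o≡
              (trans (natsKept fr′ #N refl 0) N≡) inv)
            (λ _ _ p → p))
          ((λ _ ()) , inj₁ (refl , ≈-refl)))
        λ { ρ _ (beats , inj₂ e) → _ , beats , e
          ; ρ _ (beats , inj₁ (L≡0 , _)) → ⊥-elim (ℕ.<⇒≢ (ℕ.>-nonZero⁻¹ L) (sym L≡0)) })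
      where
      loop = for #o (var #L) (solveStrips ⨾ recordBest)

  runs-approximate : ∀ σ → Inputs r dd up lf cc σ → reals σ #ε 0 ≡ ε →
    ∃ λ L → GoodHeight (suc L) × Runs approximate σ (heightTime ℕ.+ restTime (suc L))
      (λ τ → ∃ λ best → Beats (suc L) (suc L) best × (best ≈ energy (written τ)))
  runs-approximate σ inputs ε≡ = go (runs-chooseHeight σ (proj₁ inputs) ε≡)
    where
    Result : ℕ → Set (a ⊔ ℓ)
    Result L = GoodHeight (suc L) × Runs approximate σ (heightTime ℕ.+ restTime (suc L))
      (λ τ → ∃ λ best → Beats (suc L) (suc L) best × (best ≈ energy (written τ)))

    go : Runs chooseHeight σ heightTime (λ τ → GoodHeight (nats τ #L 0)) → ∃ Result
    go (runs {τ} run b good) = by-height (nats τ #L 0) refl good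
      where
      prepend : ∀ {L} → GoodHeight (suc L) → Runs afterHeight τ (restTime (suc L))
        (λ τ → ∃ λ best → Beats (suc L) (suc L) best × (best ≈ energy (written τ))) → Result L
      prepend good (runs run′ b′ post) = good , runs (⨾⇓ run run′) (ℕ.+-mono-≤ b b′) post

      by-height : ∀ L → nats τ #L 0 ≡ L → GoodHeight L → ∃ Result
      by-height zero    _  (() , _)
      by-height (suc L) L≡ good =
        L , prepend {L} good (runs-rest (suc L) τ (Inputs-kept r dd up lf cc chooseHeight refl (⇓-frame run) inputs) L≡)

-- Running time and approximation ratio

module TimeBound where
  open import Data.Nat.Base using (_+_; _*_; _^_; _≤_)
  open import Data.Nat.Properties

  n≤2^n : ∀ n → n ≤ 2 ^ n
  n≤2^n zero    = z≤n
  n≤2^n (suc n) = ≤-trans (+-mono-≤ (m^n>0 2 n) (n≤2^n n)) (≤-reflexive (dbl≡2* (2 ^ n)))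

  total-expand : ∀ c r L y → (r * 30 + 30) + ((3 + (r * 41 + 10)) + (3 + (L * ((r * (c * (r * (L * y)) + 33) + 30 + (5 + (4 + (r * (r * 8) * 22 + 10)))) + 13) + 10)))
    ≡ 56 * 1 + (71 * r + (62 * L + (33 * (L * r) + (176 * (L * (r * r)) + c * (r * r * (L * (L * y)))))))
  total-expand = solve-∀

  -- All factors are at least 1, so every monomial is below the leading one; 398 is the sum of the
  -- lower coefficients.
  total-bound : ∀ c {k r L y} → 398 + c ≡ k → 1 ≤ r → 1 ≤ L → 1 ≤ y →
    56 * 1 + (71 * r + (62 * L + (33 * (L * r) + (176 * (L * (r * r)) + c * (r * r * (L * (L * y))))))) ≤ k * (r * r * (L * (L * y)))
  total-bound c {k} {r} {L} {y} k≡ 1≤r 1≤L 1≤y = ≤-trans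
    (+-mono-≤ (*-monoʳ-≤ 56 1≤Y) (+-mono-≤ (*-monoʳ-≤ 71 r≤Y) (+-mono-≤ (*-monoʳ-≤ 62 L≤Y) (+-mono-≤ (*-monoʳ-≤ 33 Lr≤Y)
      (+-mono-≤ (*-monoʳ-≤ 176 Lrr≤Y) (≤-refl {c * Y}))))))
    (≤-reflexive (trans (collect c Y) (cong (_* Y) k≡)))
    where
    Y = r * r * (L * (L * y))
    scale : ∀ {m n} → 1 ≤ n → m ≤ m * n
    scale {m} {n} 1≤n = ≤-trans (≤-reflexive (sym (*-identityʳ m))) (*-monoʳ-≤ m 1≤n)
    1≤LLy : 1 ≤ L * (L * y)
    1≤LLy = *-mono-≤ 1≤L (*-mono-≤ 1≤L 1≤y)
    Lrr≤Y : L * (r * r) ≤ Y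
    Lrr≤Y = ≤-trans (≤-reflexive (*-comm L (r * r))) (*-monoʳ-≤ (r * r) (scale (*-mono-≤ 1≤L 1≤y)))
    Lr≤Y : L * r ≤ Y
    Lr≤Y = ≤-trans (*-monoʳ-≤ L (scale 1≤r)) Lrr≤Y
    L≤Y : L ≤ Y
    L≤Y = ≤-trans (scale 1≤r) Lr≤Y
    r≤Y : r ≤ Y
    r≤Y = ≤-trans (scale 1≤r) (scale 1≤LLy)
    1≤Y : 1 ≤ Y
    1≤Y = ≤-trans 1≤r r≤Y
    collect : ∀ c Y → 56 * Y + (71 * Y + (62 * Y + (33 * Y + (176 * Y + c * Y)))) ≡ (398 + c) * Y
    collect = solve-∀

  opaque
    -- `shiftBits` is the 32 in 16 L = 32 + 16 (L - 2). Moving it into the constant makes the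
    -- exponent vanish at `L = 2`, where ε may be arbitrarily large.
    timeConstant shiftBits : ℕ
    timeConstant = 398 + stripConstant
    shiftBits = 32

    timeConstant≡ : 398 + stripConstant ≡ timeConstant
    timeConstant≡ = refl

    shiftBits≡ : 32 ≡ shiftBits
    shiftBits≡ = refl

  constant : ℕ
  constant = timeConstant * 2 ^ shiftBits

  -- One factor `L` counts the offsets, the other comes from the work per window. Absorbing both
  -- doubles the exponent from 8 L to 16 L, which is what 32/ε allows for `L` near 2/ε.
  square≤ : ∀ L → L * L ≤ 2 ^ dbl (dbl (dbl L))
  square≤ L = ≤-trans (*-mono-≤ (n≤2^n L) (n≤2^n L)) (≤-trans (≤-reflexive (sym (^-distribˡ-+-* 2 L L)))
    (^-monoʳ-≤ 2 (≤-trans (m≤m+n (dbl L) (dbl L)) (m≤m+n (dbl (dbl L)) (dbl (dbl L))))))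

  power-split : ∀ L → 2 ≤ L → 2 ^ dbl (dbl (dbl L)) * 2 ^ dbl (dbl (dbl L)) ≡ 2 ^ shiftBits * 2 ^ (16 * (L ∸ 2))
  power-split L 2≤L = trans (sym (^-distribˡ-+-* 2 (dbl (dbl (dbl L))) (dbl (dbl (dbl L)))))
    (trans (cong (2 ^_) (trans (cong (λ n → dbl (dbl (dbl (dbl n)))) (sym (m+[n∸m]≡n 2≤L))) (trans (sixteen (L ∸ 2)) (cong (_+ 16 * (L ∸ 2)) shiftBits≡))))
      (^-distribˡ-+-* 2 shiftBits (16 * (L ∸ 2))))
    where
    sixteen : ∀ x → (((2 + x + (2 + x)) + (2 + x + (2 + x))) + ((2 + x + (2 + x)) + (2 + x + (2 + x)))) +
      (((2 + x + (2 + x)) + (2 + x + (2 + x))) + ((2 + x + (2 + x)) + (2 + x + (2 + x)))) ≡ 32 + 16 * x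
    sixteen = solve-∀

  total-time : ∀ {r L} → 1 ≤ r → 2 ≤ L → timeConstant * (r * r * (L * (L * 2 ^ dbl (dbl (dbl L))))) ≤ constant * order r * 2 ^ (16 * (L ∸ 2))
  total-time {r} {L} 1≤r 2≤L = begin
    timeConstant * (r * r * (L * (L * P)))             ≡⟨ cong (λ x → timeConstant * (r * r * x)) (*-assoc L L P) ⟨
    timeConstant * (r * r * (L * L * P))               ≤⟨ *-monoʳ-≤ timeConstant (*-mono-≤ rr≤ (*-monoˡ-≤ P (square≤ L))) ⟩
    timeConstant * (order r * (P * P))                 ≡⟨ cong (λ x → timeConstant * (order r * x)) (power-split L 2≤L) ⟩
    timeConstant * (order r * (2 ^ shiftBits * 2 ^ e))        ≡⟨ rearrange timeConstant (order r) (2 ^ shiftBits) (2 ^ e) ⟩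
    timeConstant * 2 ^ shiftBits * order r * 2 ^ e            ∎
    where
    open ≤-Reasoning
    P = 2 ^ dbl (dbl (dbl L))
    e = 16 * (L ∸ 2)
    rr≤ : r * r ≤ order r
    rr≤ = ≤-trans (≤-reflexive (cong (r *_) (sym (*-identityʳ r)))) (m≤n*m (r ^ 2) 8)
    rearrange : ∀ a b c d → a * (b * (c * d)) ≡ a * c * b * d
    rearrange = solve-∀

  *-^ : ∀ m n q → (m * n) ^ q ≡ m ^ q * n ^ q
  *-^ m n zero    = refl
  *-^ m n (suc q) = trans (cong (m * n *_) (*-^ m n q)) ([m*n]*[o*p]≡[m*o]*[n*p] m n (m ^ q) (n ^ q))

  power-bound : ∀ {t A e q p} → t ≤ A * 2 ^ e → e * q ≤ p → t ^ q ≤ A ^ q * 2 ^ p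
  power-bound {t} {A} {e} {q} {p} t≤ eq≤p = begin
    t ^ q                  ≤⟨ ^-monoˡ-≤ q t≤ ⟩
    (A * 2 ^ e) ^ q        ≡⟨ *-^ A (2 ^ e) q ⟩
    A ^ q * (2 ^ e) ^ q    ≡⟨ cong (A ^ q *_) (^-*-assoc 2 e q) ⟩
    A ^ q * 2 ^ (e * q)    ≤⟨ *-monoʳ-≤ (A ^ q) (^-monoʳ-≤ 2 eq≤p) ⟩
    A ^ q * 2 ^ p          ∎
    where open ≤-Reasoning

module _ {a ℓ} (ℝ : Reals a ℓ) (r : ℕ) .{{r≢0 : NonZero r}} (dd up lf cc : ℕ → Reals.Carrier ℝ) (ε : Reals.Carrier ℝ) where
  open Main ℝ r dd up lf cc ε using (heightTime; restTime)
  open TimeBound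

  totalTime≤ : ∀ L .{{_ : NonZero L}} → 2 ℕ.≤ L → heightTime ℕ.+ restTime L ℕ.≤ constant *ℕ order r *ℕ 2 ℕ.^ (16 ℕ.* (L ∸ 2))
  totalTime≤ L 2≤L = ℕ.≤-trans (ℕ.≤-reflexive (total-expand stripConstant r L P))
    (ℕ.≤-trans (total-bound stripConstant {timeConstant} {r} {L} {P} timeConstant≡ (ℕ.>-nonZero⁻¹ r) (ℕ.<⇒≤ 2≤L) (ℕ.m^n>0 2 (dbl (dbl (dbl L)))))
      (total-time {r} {L} (ℕ.>-nonZero⁻¹ r) 2≤L))
    where P = 2 ℕ.^ dbl (dbl (dbl L))

module _ (r : ℕ) where

  private
    fromCell : Fin r × Fin r → Fin 4 → Fin 2 → Vertex r
    fromCell (i , j) k l = i , j , k , l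

    fromRest : Fin (r *ℕ r) × Fin 4 → Fin 2 → Vertex r
    fromRest (c , k) l = fromCell (remQuot {r} r c) k l

    fromPair : Fin (r *ℕ r *ℕ 4) × Fin 2 → Vertex r
    fromPair (g , l) = fromRest (remQuot {r *ℕ r} 4 g) l

  vertexAt : Fin (r *ℕ r *ℕ 4 *ℕ 2) → Vertex r
  vertexAt w = fromPair (remQuot {r *ℕ r *ℕ 4} 2 w)

  vertexAt-combine : ∀ i j k l → vertexAt (combine (combine (combine i j) k) l) ≡ (i , j , k , l)
  vertexAt-combine i j k l =
    trans (cong fromPair (remQuot-combine {r *ℕ r *ℕ 4} {2} (combine (combine i j) k) l))
    (trans (cong (λ p → fromRest p l) (remQuot-combine {r *ℕ r} {4} (combine i j) k))
    (cong (λ p → fromCell p k l) (remQuot-combine {r} {r} i j)))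

module Approximation {a ℓ} (ℝ : Reals a ℓ) (r : ℕ) .{{r≢0 : NonZero r}} (dd up lf cc : ℕ → Reals.Carrier ℝ) (ε : Reals.Carrier ℝ) where
  open Reals ℝ
  open Hamiltonian ℝ
  open RealExponent ℝ
  open OrderedField ℝ
  open Mult (CommutativeMonoid.monoid +-commutativeMonoid) using (×-assocˡ; ×-homo-+; ×-congʳ)

  open Address r
  open Energy ℝ r dd up lf cc
  open Rounding ℝ r dd up lf cc
  open Averaging ℝ r dd up lf cc
  open Strips ℝ r dd up lf cc using (Admissible)
  open Main ℝ r dd up lf cc ε using (GoodHeight; Beats; 0≤1; 0≰-1)
  open TimeBound

  ·-monoʳ : ∀ n {x y} → x ≤ y → n · x ≤ n · y
  ·-monoʳ zero    _ = ≤-refl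
  ·-monoʳ (suc n) p = +-mono-≤ p (·-monoʳ n p)

  ·-nonNeg : ∀ n {x} → 0# ≤ x → 0# ≤ n · x
  ·-nonNeg zero    _ = ≤-refl
  ·-nonNeg (suc n) p = ≤-respˡ-≈ (+-identityˡ 0#) (+-mono-≤ p (·-nonNeg n p))

  ·-monoˡ : ∀ {m n x} → 0# ≤ x → m ℕ.≤ n → m · x ≤ n · x
  ·-monoˡ {m} {n} {x} 0≤x m≤n = ≤-resp₂ (+-identityʳ _)
    (≈-trans (≈-sym (×-homo-+ x m (n ∸ m))) (≈-reflexive (cong (_· x) (ℕ.m+[n∸m]≡n m≤n))))
    (+-mono-≤ (≤-refl {m · x}) (·-nonNeg (n ∸ m) 0≤x))

  ⅀-const : ∀ n x → ⅀ n (λ _ → x) ≈ n · x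
  ⅀-const zero    x = ⅀-0
  ⅀-const (suc n) x = ≈-trans (⅀-suc n) (≈-trans (+-comm _ _) (+-congˡ (⅀-const n x)))

  -- For `L = 2` the exponent is 0. Otherwise (L - 1) ε is below 2, so p < 16 (L - 2) q would give p
  -- ε ≤ 16 q (L - 1) ε ≤ 32 q, contrary to the choice of p/q above 32/ε.
  exponent-bound : 0# < ε → ∀ {L} → GoodHeight L → ∀ p q → (32 ℕ.* q) · 1# < p · ε → 16 ℕ.* (L ∸ 2) ℕ.* q ℕ.≤ p
  exponent-bound 0<ε (2≤L , _ , inj₁ refl) p q _ = z≤n
  exponent-bound 0<ε {L} (2≤L , _ , inj₂ small) p q lt with 16 ℕ.* (L ∸ 2) ℕ.* q ℕ.≤? p
  ... | yes le = le
  ... | no nle = ⊥-elim (lt (≤-trans (·-monoˡ (≰⇒≥ 0<ε) p≤) (≤-resp₂ eqˡ eqʳ (·-monoʳ (16 ℕ.* q) (≰⇒≥ small)))))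
    where
    p≤ : p ℕ.≤ 16 ℕ.* q ℕ.* (L ∸ 1)
    p≤ = ℕ.≤-trans (ℕ.<⇒≤ (ℕ.≰⇒> nle)) (ℕ.≤-trans (ℕ.*-monoˡ-≤ q (ℕ.*-monoʳ-≤ 16 (ℕ.∸-monoʳ-≤ L (s≤s z≤n)))) (ℕ.≤-reflexive (swap (L ∸ 1) q)))
      where
      swap : ∀ x q → 16 ℕ.* x ℕ.* q ≡ 16 ℕ.* q ℕ.* x
      swap = solve-∀
    eqˡ : (16 ℕ.* q) · ((L ∸ 1) · ε) ≈ (16 ℕ.* q ℕ.* (L ∸ 1)) · ε
    eqˡ = ×-assocˡ ε (16 ℕ.* q) (L ∸ 1)
    eqʳ : (16 ℕ.* q) · (1# + 1#) ≈ (32 ℕ.* q) · 1#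
    eqʳ = ≈-trans (×-congʳ (16 ℕ.* q) (+-congˡ (≈-sym (+-identityʳ 1#)))) (≈-trans (×-assocˡ 1# (16 ℕ.* q) 2) (≈-reflexive (cong (_· 1#) (thirtytwo q))))
      where
      thirtytwo : ∀ q → 16 ℕ.* q ℕ.* 2 ≡ 32 ℕ.* q
      thirtytwo = solve-∀

  private
    best-spins : ∃ λ (Y : Config) → (∀ z → z ℕ.< rowStart r → IsSpin (Y z))
      × (∀ (Z : Config) → (∀ z → rowStart r ℕ.≤ z → Z z ≈ 1#) → (∀ z → z ℕ.< rowStart r → IsSpin (Z z)) → energy Y ≤ energy Z)
    best-spins = minimiser energy (strip-cong′ 0 r) (rowStart r) (λ _ → 1#)

  -- Set to 1 beyond the grid, so that every address carries a spin, as the averaging argument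
  -- assumes.
  optimum : Config
  optimum = splice (rowStart r) (proj₁ best-spins) (λ _ → 1#)

  optimum-spins : ∀ z → IsSpin (optimum z)
  optimum-spins z with z ℕ.<? rowStart r
  ... | yes p = proj₁ (proj₂ best-spins) z p
  ... | no _  = inj₁ ≈-refl

  optimum-minimal : ∀ Z → SpinsBetween 0 r Z → energy optimum ≤ energy Z
  optimum-minimal Z sp = ≤-resp₂ (≈-sym (strip-cong 0 r λ z z< → splice-< (rowStart r) _ _ z<))
    (strip-cong 0 r λ z z< → splice-< (rowStart r) Z (λ _ → 1#) z<)
    (proj₂ (proj₂ best-spins) (splice (rowStart r) Z (λ _ → 1#)) (λ z z≥ → splice-≥ (rowStart r) Z (λ _ → 1#) z≥)
      (λ z z< → IsSpin-resp (≈-sym (splice-< (rowStart r) Z (λ _ → 1#) z<)) (sp z z≤n z<)))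

  H* : Carrier
  H* = energy optimum

  H*≤0 : H* ≤ 0#
  H*≤0 = optimal-nonPos optimum optimum-spins optimum-minimal

  ratio : 0# < ε → ∀ {L best} → GoodHeight (suc L) → Beats (suc L) (suc L) best → best ≤ (1# - ε) * H*
  ratio 0<ε {L} {best} (2≤L , inj₁ r≤L , _) beats = ≤-trans
    -- For `r ≤ L` offset 0 cuts no row strictly between 0 and `r`, so the optimum itself is
    -- admissible. The remaining inequality holds because the optimum is nonpositive and ε positive.
    (beats 0 (s≤s z≤n) optimum ((λ z → inj₁ (optimum-spins z)) ,
      λ i i<r 0<i e → ⊥-elim (ℕ.<⇒≢ 0<i (sym (trans (sym (m<n⇒m%n≡m (ℕ.<-≤-trans i<r r≤L))) e)))))
    (≤-respˡ-≈ (*-identityˡ H*) (*-antiˡ-nonPos H*≤0 (≤-respʳ-≈ (+-identityʳ 1#) (+-mono-≤ ≤-refl (≤-respʳ-≈ -0#≈0# (neg-mono-≤ (≰⇒≥ 0<ε)))))))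
  -- With n = `suc L` offsets: n best + 2 H* ≤ n H* = n (1 - ε) H* + n ε H* ≤ n (1 - ε) H* + 2 H*,
  -- the last step by n ε ≥ 2 and H* ≤ 0. Cancelling 2 H* and then n gives the ratio.
  ratio 0<ε {L} {best} (2≤L , inj₂ large , _) beats = ⅀-cancel-≤ L (+-cancelʳ-≤ (H* + H*) (≤-trans
    (≤-trans (+-monoˡ-≤ (H* + H*) (⅀-mono (suc L) λ o o<L → beats o o<L (mask (suc L) o optimum)
      (mask-trit (suc L) o optimum (λ z → inj₁ (optimum-spins z)) , λ i _ _ e → mask-vanishes (suc L) optimum i e)))
      (masked-energies optimum optimum-spins optimum-minimal (suc L) 2≤L))
    (≤-respˡ-≈ (≈-sym split) (+-mono-≤ ≤-refl loss))))
    where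
    open import Relation.Binary.Reasoning.Setoid setoid
    loss : (suc L · ε) * H* ≤ H* + H*
    loss = ≤-respʳ-≈ (≈-trans (distribʳ H* 1# 1#) (+-cong (*-identityˡ H*) (*-identityˡ H*))) (*-antiˡ-nonPos H*≤0 large)
    ε-part : ⅀ (suc L) (λ _ → ε * H*) ≈ (suc L · ε) * H*
    ε-part = ≈-trans (⅀-cong (suc L) λ _ _ → *-comm ε H*) (≈-trans (≈-sym (⅀-*ˡ (suc L) H*)) (≈-trans (*-comm _ _) (*-congʳ (⅀-const (suc L) ε))))
    unit : H* ≈ (1# - ε) * H* + ε * H*
    unit = ≈-sym (≈-trans (≈-sym (distribʳ H* (1# - ε) ε)) (≈-trans (*-congʳ (x-y+y≈x 1# ε)) (*-identityˡ H*)))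
    split : ⅀ (suc L) (λ _ → H*) ≈ ⅀ (suc L) (λ _ → (1# - ε) * H*) + (suc L · ε) * H*
    split = ≈-trans (⅀-cong (suc L) λ _ _ → unit) (≈-trans (≈-sym (⅀-+ (suc L))) (+-congˡ ε-part))

  sign : Carrier → Sign
  sign x with 0# ≤? x
  ... | yes _ = Sign.+
  ... | no _  = Sign.-

  spin-sign : ∀ {x} → IsSpin x → x ≈ spin (sign x)
  spin-sign {x} sp with 0# ≤? x | sp
  ... | yes _ | inj₁ e = e
  ... | yes p | inj₂ e = ⊥-elim (0≰-1 (≤-respʳ-≈ e p))
  ... | no n  | inj₁ e = ⊥-elim (n (≤-respʳ-≈ (≈-sym e) 0≤1))
  ... | no _  | inj₂ e = e

  extend : (Vertex r → Sign) → Config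
  extend S z with z ℕ.<? r *ℕ r *ℕ 4 *ℕ 2
  ... | yes p = spin (S (vertexAt r (fromℕ< p)))
  ... | no _  = 1#

  spin-IsSpin : ∀ s → IsSpin (spin s)
  spin-IsSpin Sign.+ = inj₁ ≈-refl
  spin-IsSpin Sign.- = inj₂ ≈-refl

  extend-spins : ∀ S z → IsSpin (extend S z)
  extend-spins S z with z ℕ.<? r *ℕ r *ℕ 4 *ℕ 2
  ... | yes p = spin-IsSpin (S (vertexAt r (fromℕ< p)))
  ... | no _  = inj₁ ≈-refl

  extend-vertex : ∀ S u → extend S (vertexIndex u) ≈ spin (S u)
  extend-vertex S u@(i , j , k , l) with vertexIndex u ℕ.<? r *ℕ r *ℕ 4 *ℕ 2
  ... | yes p = ≈-reflexive (cong (λ w → spin (S w))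
        (trans (cong (vertexAt r) (fromℕ<-toℕ (combine (combine (combine i j) k) l) p)) (vertexAt-combine r i j k l)))
  ... | no n = ⊥-elim (n (toℕ<n (combine (combine (combine i j) k) l)))

-- Assembling time bound, minimum and ratio

module Conclusion {a ℓ} (ℝ : Reals a ℓ) (m : ℕ) where
  open Reals ℝ
  open Hamiltonian ℝ
  open Semantics ℝ
  open InputOutput ℝ
  open RealExponent ℝ
  open OrderedField ℝ
  open TimeBound

  private
    r = suc m

  conclude : (c : Edge r → Carrier) (d : Vertex r → Carrier) (ε : Carrier) → 0# < ε → (σ : State) → Holds σ r c d ε →
    ∃[ τ ] ∃[ t ] ((approximate ⊢ σ ⇓ τ ∣ t) × (t ≤ constant *ℕ order r ·2^[ 32 / ε ])
      × (∃[ H* ] (IsMinimumOfH c d H* × H c d (output τ) ≤ (1# - ε) * H*)))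
  conclude c d ε₀ 0<ε₀ σ holds = finish (runs-approximate σ (holds-r , (λ _ → refl) , (λ _ → refl) , (λ _ → refl) , (λ _ → refl)) refl)
    where
    open Holds holds
    -- The memory holds the input only up to `≈`. The analysis runs on the actual contents, and the
    -- conclusions are transported to the given data at the end.
    ε = reals σ 0 0
    dd = reals σ 1
    up = reals σ 2
    lf = reals σ 3
    cc = reals σ 4
    open Energy ℝ r dd up lf cc using (Config)
    open Averaging ℝ r dd up lf cc using (energy)
    open Main ℝ r dd up lf cc ε
    open Approximation ℝ r dd up lf cc ε
    open HamiltonianEnergy ℝ m dd up lf cc using (H≈energy)
    open Logic ℝ using (Runs; runs)

    0<ε : 0# < ε
    0<ε ε≤0 = 0<ε₀ (≤-respˡ-≈ holds-ε ε≤0)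

    H≈ : ∀ S X → (∀ u → X (vertexIndex u) ≈ spin (S u)) → H c d S ≈ energy X
    H≈ S X e = H≈energy c d S X holds-d (λ i j k → holds-c (e₀ i j k)) (λ i j k → holds-c (e₁ i j k)) (λ i j k₀ k₁ → holds-c (e₀₁ i j k₀ k₁)) e

    S* : Vertex r → Sign
    S* u = sign (optimum (vertexIndex u))

    isMinimum : IsMinimumOfH c d H*
    isMinimum = (S* , ≈-sym (H≈ S* optimum (λ u → spin-sign {optimum (vertexIndex u)} (optimum-spins (vertexIndex u)))))
      , λ S → ≤-respʳ-≈ (≈-sym (H≈ S (extend S) (extend-vertex S))) (optimum-minimal (extend S) (λ z _ _ → extend-spins S z))

    Goal = ∃[ τ ] ∃[ t ] ((approximate ⊢ σ ⇓ τ ∣ t) × (t ≤ constant *ℕ order r ·2^[ 32 / ε₀ ])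
      × (∃[ H* ] (IsMinimumOfH c d H* × H c d (output τ) ≤ (1# - ε₀) * H*)))

    finish : (∃ λ L → GoodHeight (suc L) × Runs approximate σ (heightTime ℕ.+ restTime (suc L))
      (λ τ → ∃ λ best → Beats (suc L) (suc L) best × (best ≈ energy (written τ)))) → Goal
    finish (L , good , runs {τ} {t} run t≤ (best , beats , best≈)) = τ , t , run , time , H* , isMinimum ,
      ≤-resp₂ (≈-trans best≈ (≈-sym (H≈ (output τ) (written τ) (λ _ → ≈-refl)))) (*-congʳ (+-congˡ (-‿cong holds-ε))) (ratio 0<ε good beats)
      where
      t≤′ : t ℕ.≤ constant *ℕ order r *ℕ 2 ℕ.^ (16 ℕ.* (suc L ∸ 2))
      t≤′ = ℕ.≤-trans t≤ (totalTime≤ ℝ r dd up lf cc ε (suc L) (proj₁ good))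
      time : t ≤ constant *ℕ order r ·2^[ 32 / ε₀ ]
      time p q lt = power-bound {t} {constant *ℕ order r} {16 ℕ.* (suc L ∸ 2)} {q} {p} t≤′
        (exponent-bound 0<ε good p q (λ le → lt (≤-respˡ-≈ (×-congʳ′ p) le)))
        where
        ×-congʳ′ : ∀ n → n · ε ≈ n · ε₀
        ×-congʳ′ zero    = ≈-refl
        ×-congʳ′ (suc n) = +-cong holds-ε (×-congʳ′ n)

theorem1 : ∀ {a ℓ} → ∃[ P ] ∃[ C ]
    ((ℝ : Reals a ℓ) →
     let open Reals ℝ
         open Hamiltonian ℝ
         open Semantics ℝ
         open InputOutput ℝ
         open RealExponent ℝ
     in
     (r : ℕ) → .{{_ : NonZero r}} →
     (c : Edge r → Carrier) (d : Vertex r → Carrier) (ε : Carrier) → 0# < ε →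
     (σ : State) → Holds σ r c d ε →
     ∃[ τ ] ∃[ t ]
       ((P ⊢ σ ⇓ τ ∣ t)
        × (t ≤ C *ℕ order r ·2^[ 32 / ε ])
        × (∃[ H* ] (IsMinimumOfH c d H* × H c d (output τ) ≤ (1# - ε) * H*))))
theorem1 = approximate , TimeBound.constant , λ ℝ → λ
  { zero    → λ _ _ _ _ _ _ → ⊥-elim (ℕ.≢-nonZero⁻¹ 0 refl)
  ; (suc m) → Conclusion.conclude ℝ m }
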